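{- For any $\epsilon>0$, $\zeta>0$ and any function $\omega(n)$ with $\omega(n)\to\infty$ as $n\to\infty$, there exist constants $A>0$ and $N$ such that for any $n\ge N$ and any degree sequence $\mathcal{D}=(d_1,\dots,d_n)$ on $n$ vertices satisfying Condition D with constant $\zeta$ and with $Q>\omega(n)n^{ -1/3}R^{2/3}$, if $G$ is chosen uniformly at random from all simple graphs with degree sequence $\mathcal{D}$ and $\mathcal{C}_{\max}$ is a largest connected component of $G$, then $$\Pr\left(|\mathcal{C}_{\max}|\le AQn/R\right)<\epsilon.$$
   Context: A degree sequence $\mathcal{D}=(d_1,\dots,d_n)$ assigns a degree $d_v$ to each of $n$ vertices; it is assumed that at least one simple graph with this degree sequence exists. Let $|E|=\frac12\sum_v d_v$, let $n_i$ be the number of vertices of degree $i$, and let $\Delta=\max_v d_v$. Define $$Q=\frac{\sum_{u}d_u^2}{2|E|}-2,\qquad R=\frac{\sum_{u}d_u(d_u-2)^2}{2|E|}.$$ For a constant $0<\zeta<1/10$, $\mathcal{D}$ satisfies Condition D with constant $\zeta$ if: (a) $\Delta\le n^{1/3}R^{1/3}(\ln n)^{ -1}$; (b) $n_0=0$; (c) $n_2\le(1-\zeta)n$; (d) $|Q|\le \zeta/2$. $|\mathcal{C}_{\max}|$ denotes the number of vertices of the largest component.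
   Formalization: The constants ε and ζ and the values of ω(n) are taken to be rational rather than real; the constant A obtained is rational. -}

module Defs where

open import Data.Bool using (Bool; true; false; _∧_; _∨_; T)
open import Data.Nat as ℕ using (ℕ; zero; suc; _⊔_; _≡ᵇ_; _<ᵇ_)
open import Data.Nat using (_!)
open import Data.Fin using (Fin; toℕ)
open import Data.Fin.Properties using () renaming (_≟_ to _≟F_)
open import Data.Vec using (Vec; lookup)
open import Data.List using (List; []; _∷_; _++_; map; length; filterᵇ; concatMap; foldr; allFin)
open import Data.Bool.ListAction using (any; and)
open import Data.List.Membership.Propositional using (_∈_)
open import Data.Product using (_×_; _,_; ∃-syntax)
open import Data.Integer using (+_)
open import Data.Rational using (ℚ; 0ℚ; 1ℚ; _+_; _-_; _*_; _≤_; _<_; _÷_; _/_; ∣_∣; ≢-nonZero)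
open import Data.Rational.Properties using (_≟_; _≤?_)
open import Relation.Nullary using (yes; no)
open import Relation.Binary.PropositionalEquality using (_≡_)
open import Relation.Nullary.Decidable using (⌊_⌋)

ℕtoℚ : ℕ → ℚ
ℕtoℚ m = + m / 1

-- total division on ℚ (convention: p ÷' 0 = 0; only used where the
-- denominator is nonzero under the hypotheses of the theorem)
_÷'_ : ℚ → ℚ → ℚ
p ÷' q with q ≟ 0ℚ
... | yes _   = 0ℚ
... | no q≢0 = _÷_ p q {{≢-nonZero q≢0}}

sumℚ : List ℚ → ℚ
sumℚ = foldr _+_ 0ℚ

_^ℚ_ : ℚ → ℕ → ℚ
y ^ℚ zero  = 1ℚ
y ^ℚ suc k = y * (y ^ℚ k)

expPartial : ℚ → ℕ → ℚ
expPartial y zero    = 0ℚ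
expPartial y (suc K) = expPartial y K + ((y ^ℚ K) ÷' ℕtoℚ (K !))

module DegSeq {n : ℕ} (D : Vec ℕ n) where

  d : Fin n → ℕ
  d = lookup D

  twoE : ℕ
  twoE = foldr ℕ._+_ 0 (map d (allFin n))

  Q : ℚ
  Q = (ℕtoℚ (foldr ℕ._+_ 0 (map (λ v → d v ℕ.* d v) (allFin n))) ÷' ℕtoℚ twoE) - ℕtoℚ 2

  R : ℚ
  R = sumℚ (map (λ v → ℕtoℚ (d v) * ((ℕtoℚ (d v) - ℕtoℚ 2) * (ℕtoℚ (d v) - ℕtoℚ 2))) (allFin n)) ÷' ℕtoℚ twoE

  Δ : ℕ
  Δ = foldr _⊔_ 0 (map d (allFin n))

  nOf : ℕ → ℕ
  nOf i = length (filterᵇ (λ v → d v ≡ᵇ i) (allFin n))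

  -- Condition (a): Δ ≤ n^{1/3} R^{1/3} / ln n, written without reals as
  --   n^Δ ≤ exp((nR)^{1/3}),
  -- where "m ≤ exp(x)" for x = c^{1/3} ≥ 0 is expressed through rational
  -- lower approximations: every rational q < m is exceeded by some partial
  -- sum of the exponential series at some rational y ≥ 0 with y³ ≤ c.
  CondA : Set
  CondA = ∀ (q : ℚ) → q < ℕtoℚ (n ℕ.^ Δ) →
            ∃[ y ] (0ℚ ≤ y × (y * y * y) ≤ ℕtoℚ n * R × ∃[ K ] (q < expPartial y K))

  record ConditionD (ζ : ℚ) : Set where
    field
      condA : CondA
      condB : nOf 0 ≡ 0
      condC : ℕtoℚ (nOf 2) ≤ (1ℚ - ζ) * ℕtoℚ n
      condD : ∣ Q ∣ ≤ ζ * (+ 1 / 2)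


-- Simple graphs on vertex set Fin n, as edge sets {i,j} with i < j

Edge : ℕ → Set
Edge n = Fin n × Fin n

allPairs : (n : ℕ) → List (Edge n)
allPairs n = concatMap (λ i → map (i ,_) (filterᵇ (λ j → toℕ i <ᵇ toℕ j) (allFin n))) (allFin n)

subs : ∀ {A : Set} → List A → List (List A)
subs []       = [] ∷ []
subs (x ∷ xs) = subs xs ++ map (x ∷_) (subs xs)

SimpleGraph : ℕ → Set
SimpleGraph n = List (Edge n)

-- every simple graph on Fin n, each exactly once
allGraphs : (n : ℕ) → List (SimpleGraph n)
allGraphs n = subs (allPairs n)

_=F_ : ∀ {n} → Fin n → Fin n → Bool
i =F j = ⌊ i ≟F j ⌋

degree : ∀ {n} → SimpleGraph n → Fin n → ℕ
degree G v = length (filterᵇ (λ e → (Data.Product.proj₁ e =F v) ∨ (Data.Product.proj₂ e =F v)) G)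
  where import Data.Product

hasDegSeq : ∀ {n} → Vec ℕ n → SimpleGraph n → Bool
hasDegSeq {n} D G = and (map (λ v → degree G v ≡ᵇ lookup D v) (allFin n))

Graphical : ∀ {n} → Vec ℕ n → Set
Graphical {n} D = ∃[ G ] (G ∈ allGraphs n × T (hasDegSeq D G))

reachStep : ∀ {n} → SimpleGraph n → (Fin n → Bool) → Fin n → Bool
reachStep G S v = S v ∨ any (λ e → (S (Data.Product.proj₁ e) ∧ (Data.Product.proj₂ e =F v))
                                 ∨ (S (Data.Product.proj₂ e) ∧ (Data.Product.proj₁ e =F v))) G
  where import Data.Product

iter : ∀ {A : Set} → ℕ → (A → A) → A → A
iter zero    f a = a
iter (suc k) f a = f (iter k f a)

-- vertices in the connected component of u (closure after n steps,
-- which suffices since paths have length < n)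
component : ∀ {n} → SimpleGraph n → Fin n → Fin n → Bool
component {n} G u = iter n (reachStep G) (u =F_)

componentSize : ∀ {n} → SimpleGraph n → Fin n → ℕ
componentSize {n} G u = length (filterᵇ (component G u) (allFin n))

Cmax : ∀ {n} → SimpleGraph n → ℕ
Cmax {n} G = foldr _⊔_ 0 (map (componentSize G) (allFin n))

Pr : ∀ {n} → Vec ℕ n → (SimpleGraph n → Bool) → ℚ
Pr {n} D P = ℕtoℚ (length (filterᵇ P graphsD)) ÷' ℕtoℚ (length graphsD)
  where graphsD = filterᵇ (hasDegSeq D) (allGraphs n)

TendsToInfinity : (ℕ → ℚ) → Set
TendsToInfinity ω = ∀ (M : ℚ) → ∃[ N₀ ] (∀ n → N₀ ℕ.≤ n → M < ω n)

smallCmax : ∀ {n} → Vec ℕ n → ℚ → SimpleGraph n → Bool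
smallCmax {n} D A G = ⌊ ℕtoℚ (Cmax G) ≤? ((A * DegSeq.Q D * ℕtoℚ n) ÷' DegSeq.R D) ⌋

{-# OPTIONS --safe #-}
-- Reveal the graph edge by edge, one component after the other. Among the graphs with the given
-- degrees that contain the revealed edges F, the next neighbour of an active vertex is w with
-- probability about d w / 2|E|: edge switchings give this up to a relative error O(Δ² / |E|), which
-- condition (a) makes much smaller than Q. Hence, while little of the graph has been explored, the
-- number Y of unmatched half-edges at explored vertices has drift at least Q / 4 and variance O(R)
-- for each new vertex. If all components had fewer than M₁ ≈ δ Q n / R vertices, some component would
-- be finished between times M₁ and 2 M₁; then Y = 0 instead of about Q M₁, a deviation which by
-- Chebyshev's inequality has probability O(R M₁ / (Q M₁)²) = O(R² / (δ Q³ n)). Conditional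
-- probabilities are quotients of the numbers N F of graphs containing F, so Chebyshev's inequality
-- becomes a bound Nbad F * Λ ≤ N F * h F A, proved by induction along the exploration.

module Submission where

open import Defs

-- With s = 2|E|, q = s Q and ρ = s R, all estimates are cross-multiplied inequalities between
-- natural numbers. The obstacle is that Y keeps its drift only while the squared degrees of the
-- explored vertices sum to at most q / 4, since this sum is missing from the second moment of the
-- vertices still to be found. Moreover, components may die out early. So `h` must not increase in
-- the mean, and must reach Λ at every ending that a bad graph can have. If the squared degrees
-- exceed q / 4, its second term does so; if all half-edges at M₁ or more explored vertices are
-- matched, Y = 0 and its first term does so. An earlier saturation is no ending: a new component
-- starts at an unexplored vertex of degree at most 4, and one unit of the third term pays for it.
-- At 2 M₁ vertices the current component has at least M₁ of them, so no bad graph is left. The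
-- drift needs a sharp lower bound on the probability of a next neighbour. The variance needs only
-- an upper bound with a spare factor 2, and the same bound controls the failing switchings in the
-- proof of the lower one.

module Combinatorics where

  open import Data.Bool using (Bool; true; false; _∧_; _∨_; not; T)
  open import Data.Bool.ListAction using (any; and)
  open import Data.Bool.Properties using (∨-comm; ∨-assoc; ∧-comm; ∨-zeroʳ; ∧-identityʳ)
  open import Data.Empty using (⊥-elim)
  open import Data.Fin using (Fin; toℕ) renaming (zero to fzero; suc to fsuc)
  open import Data.Fin.Properties using (toℕ-injective; ¬∀⟶∃¬) renaming (_≟_ to _≟F_)
  open import Data.List using (List; []; _∷_; _++_; map; length; filterᵇ; concatMap; foldr; allFin)
  open import Data.List.Membership.Propositional using (_∈_)
  open import Data.List.Membership.Propositional.Properties using (∈-++⁻; ∈-++⁺ˡ; ∈-map⁻; ∈-allFin)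
  open import Data.List.Properties using (map-tabulate; map-cong; length-++; length-tabulate)
  open import Data.List.Relation.Unary.Any using (here; there)
  open import Data.Nat
  open import Data.Nat.DivMod using (_/_; _%_; m≡m%n+[m/n]*n; m%n<n; m/n*n≤m; m≥n⇒m/n>0)
  open import Data.Nat.Properties
  open import Data.Nat.Tactic.RingSolver using (solve-∀)
  open import Data.Product using (_×_; _,_; ∃-syntax; proj₁; proj₂)
  open import Data.Sum using (_⊎_; inj₁; inj₂)
  open import Data.Unit using (tt)
  open import Data.Vec using (Vec; lookup)
  open import Function using (_∘_)
  open import Relation.Binary.PropositionalEquality
  open import Relation.Nullary using (yes; no; Dec; ¬_)
  open import Relation.Nullary.Decidable using (_×-dec_; ¬?; decidable-stable)

  -- Finite sums of natural numbers and indicators.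

  variable
    Ix Iy : Set

  -- Stated so that the equation is a semiring identity, which the ring solver proves.
  ≤-cert : ∀ {u v x y} → u ≤ v → x + v ≡ y + u → x ≤ y
  ≤-cert {u} {v} {x} {y} u≤v eq =
    +-cancelʳ-≤ v x y (≤-trans (≤-reflexive eq) (+-monoʳ-≤ y u≤v))

  ≤-cert⁺ : ∀ {u v x y} k → u ≤ v → x + k + v ≡ y + u → x ≤ y
  ≤-cert⁺ {x = x} k u≤v eq = ≤-trans (m≤m+n x k) (≤-cert u≤v eq)

  ≤-slack : ∀ {x y} k → x + k ≡ y → x ≤ y
  ≤-slack {x} k refl = m≤m+n x k

  𝟙 : Bool → ℕ
  𝟙 true  = 1
  𝟙 false = 0

  𝟙≤1 : ∀ b → 𝟙 b ≤ 1
  𝟙≤1 true  = ≤-refl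
  𝟙≤1 false = z≤n

  ∑ : List Ix → (Ix → ℕ) → ℕ
  ∑ []       f = 0
  ∑ (x ∷ xs) f = f x + ∑ xs f

  foldr-∑ : ∀ (xs : List Ix) f → foldr _+_ 0 (map f xs) ≡ ∑ xs f
  foldr-∑ []       f = refl
  foldr-∑ (x ∷ xs) f = cong (f x +_) (foldr-∑ xs f)

  ∑-cong : ∀ (xs : List Ix) {f g : Ix → ℕ} → (∀ x → f x ≡ g x) → ∑ xs f ≡ ∑ xs g
  ∑-cong []       e = refl
  ∑-cong (x ∷ xs) e = cong₂ _+_ (e x) (∑-cong xs e)

  ∑-mono∈ : ∀ (xs : List Ix) {f g : Ix → ℕ} → (∀ x → x ∈ xs → f x ≤ g x) → ∑ xs f ≤ ∑ xs g
  ∑-mono∈ []       e = z≤n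
  ∑-mono∈ (x ∷ xs) e = +-mono-≤ (e x (here refl)) (∑-mono∈ xs (λ y → e y ∘ there))

  ∑-mono : ∀ (xs : List Ix) {f g : Ix → ℕ} → (∀ x → f x ≤ g x) → ∑ xs f ≤ ∑ xs g
  ∑-mono xs e = ∑-mono∈ xs (λ x _ → e x)

  ∑-cong∈ : ∀ (xs : List Ix) {f g : Ix → ℕ} → (∀ x → x ∈ xs → f x ≡ g x) → ∑ xs f ≡ ∑ xs g
  ∑-cong∈ []       e = refl
  ∑-cong∈ (x ∷ xs) e = cong₂ _+_ (e x (here refl)) (∑-cong∈ xs (λ y → e y ∘ there))

  +-exchange : ∀ a b c d → (a + b) + (c + d) ≡ (a + c) + (b + d)
  +-exchange = solve-∀

  ∑-+ : ∀ (xs : List Ix) f g → ∑ xs (λ x → f x + g x) ≡ ∑ xs f + ∑ xs g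
  ∑-+ []       f g = refl
  ∑-+ (x ∷ xs) f g = trans (cong (f x + g x +_) (∑-+ xs f g)) (+-exchange (f x) (g x) _ _)

  ∑-*ˡ : ∀ (xs : List Ix) c f → ∑ xs (λ x → c * f x) ≡ c * ∑ xs f
  ∑-*ˡ []       c f = sym (*-zeroʳ c)
  ∑-*ˡ (x ∷ xs) c f = trans (cong (c * f x +_) (∑-*ˡ xs c f)) (sym (*-distribˡ-+ c (f x) _))

  ∑-*ʳ : ∀ (xs : List Ix) f c → ∑ xs (λ x → f x * c) ≡ ∑ xs f * c
  ∑-*ʳ xs f c = trans (∑-cong xs (λ x → *-comm (f x) c)) (trans (∑-*ˡ xs c f) (*-comm c _))

  ∑-0 : ∀ (xs : List Ix) → ∑ xs (λ _ → 0) ≡ 0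
  ∑-0 []       = refl
  ∑-0 (x ∷ xs) = ∑-0 xs

  ∑-1 : ∀ (xs : List Ix) → ∑ xs (λ _ → 1) ≡ length xs
  ∑-1 []       = refl
  ∑-1 (x ∷ xs) = cong suc (∑-1 xs)

  ∑-swap : ∀ (xs : List Ix) (ys : List Iy) (f : Ix → Iy → ℕ) →
    ∑ xs (λ x → ∑ ys (f x)) ≡ ∑ ys (λ y → ∑ xs (λ x → f x y))
  ∑-swap []       ys f = sym (∑-0 ys)
  ∑-swap (x ∷ xs) ys f = trans (cong (∑ ys (f x) +_) (∑-swap xs ys f))
    (sym (∑-+ ys (f x) (λ y → ∑ xs (λ x′ → f x′ y))))

  ∑-++ : ∀ (xs ys : List Ix) f → ∑ (xs ++ ys) f ≡ ∑ xs f + ∑ ys f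
  ∑-++ []       ys f = refl
  ∑-++ (x ∷ xs) ys f = trans (cong (f x +_) (∑-++ xs ys f)) (sym (+-assoc (f x) _ _))

  ∑-map : ∀ (g : Ix → Iy) (xs : List Ix) f → ∑ (map g xs) f ≡ ∑ xs (f ∘ g)
  ∑-map g []       f = refl
  ∑-map g (x ∷ xs) f = cong (f (g x) +_) (∑-map g xs f)

  ∑-concatMap : ∀ (g : Ix → List Iy) (xs : List Ix) f → ∑ (concatMap g xs) f ≡ ∑ xs (λ x → ∑ (g x) f)
  ∑-concatMap g []       f = refl
  ∑-concatMap g (x ∷ xs) f = trans (∑-++ (g x) (concatMap g xs) f) (cong (∑ (g x) f +_) (∑-concatMap g xs f))

  ∑-filter : ∀ (p : Ix → Bool) (xs : List Ix) f → ∑ (filterᵇ p xs) f ≡ ∑ xs (λ x → 𝟙 (p x) * f x)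
  ∑-filter p []       f = refl
  ∑-filter p (x ∷ xs) f with p x
  ... | true  = cong₂ _+_ (sym (+-identityʳ (f x))) (∑-filter p xs f)
  ... | false = ∑-filter p xs f

  length-filter : ∀ (p : Ix → Bool) (xs : List Ix) → length (filterᵇ p xs) ≡ ∑ xs (𝟙 ∘ p)
  length-filter p []       = refl
  length-filter p (x ∷ xs) with p x
  ... | true  = cong suc (length-filter p xs)
  ... | false = length-filter p xs

  ∑-∈ : ∀ {xs : List Ix} {x} f → x ∈ xs → f x ≤ ∑ xs f
  ∑-∈ f (here refl) = m≤m+n _ _
  ∑-∈ f (there x∈)  = ≤-trans (∑-∈ f x∈) (m≤n+m _ _)

  ∑-zero : ∀ (xs : List Ix) {f} → (∀ x → f x ≡ 0) → ∑ xs f ≡ 0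
  ∑-zero xs e = trans (∑-cong xs e) (∑-0 xs)

  ∑-allFin-suc : ∀ n (f : Fin (suc n) → ℕ) → ∑ (allFin (suc n)) f ≡ f fzero + ∑ (allFin n) (f ∘ fsuc)
  ∑-allFin-suc n f = cong (f fzero +_)
    (trans (cong (λ l → ∑ l f) (sym (map-tabulate (λ x → x) fsuc))) (∑-map fsuc (allFin n) f))

  =F-refl : ∀ {n} (i : Fin n) → (i =F i) ≡ true
  =F-refl i with i ≟F i
  ... | yes _ = refl
  ... | no ¬p = ⊥-elim (¬p refl)

  =F-no : ∀ {n} {i j : Fin n} → i ≢ j → (i =F j) ≡ false
  =F-no {i = i} {j} i≢j with i ≟F j
  ... | yes p = ⊥-elim (i≢j p)
  ... | no _  = refl

  =F-sound : ∀ {n} {i j : Fin n} → (i =F j) ≡ true → i ≡ j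
  =F-sound {i = i} {j} e with i ≟F j
  ... | yes p = p

  =F-suc : ∀ {n} (i j : Fin n) → (fsuc i =F fsuc j) ≡ (i =F j)
  =F-suc i j = by (i ≟F j)
    where
    by : Dec (i ≡ j) → (fsuc i =F fsuc j) ≡ (i =F j)
    by (yes refl) = trans (=F-refl (fsuc i)) (sym (=F-refl i))
    by (no i≢j)   = trans (=F-no (λ { refl → i≢j refl })) (sym (=F-no i≢j))

  ∑-point : ∀ {n} (i : Fin n) (f : Fin n → ℕ) → ∑ (allFin n) (λ j → 𝟙 (i =F j) * f j) ≡ f i
  ∑-point {suc n} fzero f = trans (∑-allFin-suc n _)
    (trans (cong₂ _+_ (+-identityʳ (f fzero)) (∑-zero (allFin n) (λ j → cong (λ b → 𝟙 b * f (fsuc j))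
        (=F-no {i = fzero} {fsuc j} (λ ())))))
           (+-identityʳ _))
  ∑-point {suc n} (fsuc i) f = trans (∑-allFin-suc n (λ j → 𝟙 (fsuc i =F j) * f j))
    (trans (∑-cong (allFin n) (λ j → cong (λ b → 𝟙 b * f (fsuc j)) (=F-suc i j)))
           (∑-point i (f ∘ fsuc)))

  ∑-point1 : ∀ {n} (i : Fin n) → ∑ (allFin n) (λ j → 𝟙 (i =F j)) ≡ 1
  ∑-point1 i = trans (∑-cong (allFin _) (λ j → sym (*-identityʳ (𝟙 (i =F j))))) (∑-point i (λ _ → 1))

  ≡⇒T : ∀ {b} → b ≡ true → T b
  ≡⇒T refl = tt

  -- With f the indicator of a pair, bounds on multiplicities pass from `allPairs` to every graph:
  -- no loops, no repeated edges.
  ∑-subs : ∀ (L : List Ix) {H} f → H ∈ subs L → ∑ H f ≤ ∑ L f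
  ∑-subs []       f (here refl) = z≤n
  ∑-subs (x ∷ xs) f H∈ with ∈-++⁻ (subs xs) H∈
  ... | inj₁ H∈′ = ≤-trans (∑-subs xs f H∈′) (m≤n+m _ (f x))
  ... | inj₂ H∈′ with ∈-map⁻ (x ∷_) H∈′
  ...   | _ , H∈″ , refl = +-monoʳ-≤ (f x) (∑-subs xs f H∈″)

  -- Graphs as edge lists: adjacency, degrees, insertion of an edge.

  module _ {n : ℕ} where

    V : List (Fin n)
    V = allFin n

    inc : Edge n → Fin n → Bool
    inc e v = (proj₁ e =F v) ∨ (proj₂ e =F v)

    =F-sym : ∀ (i j : Fin n) → (i =F j) ≡ (j =F i)
    =F-sym i j = by (i ≟F j)
      where
      by : Dec (i ≡ j) → (i =F j) ≡ (j =F i)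
      by (yes refl) = refl
      by (no i≢j)   = trans (=F-no i≢j) (sym (=F-no (i≢j ∘ sym)))

    opaque
      -- Edges are compared as unordered pairs, so that `(v , w) ∷ H` may be formed for v and w in
      -- either order.
      match : Fin n → Fin n → Edge n → Bool
      match i j (a , b) = ((a =F i) ∧ (b =F j)) ∨ ((a =F j) ∧ (b =F i))

      match-sym : ∀ i j e → match i j e ≡ match j i e
      match-sym i j (a , b) = ∨-comm ((a =F i) ∧ (b =F j)) _

      match-refl : ∀ i j → match i j (i , j) ≡ true
      match-refl i j rewrite =F-refl i | =F-refl j = refl

      match-sound : ∀ i j a b → match i j (a , b) ≡ true → (a ≡ i × b ≡ j) ⊎ (a ≡ j × b ≡ i)
      match-sound i j a b e with a =F i in ai | b =F j in bj
      ... | true  | true  = inj₁ (=F-sound ai , =F-sound bj)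
      ... | true  | false with a =F j in aj | b =F i in bi
      ...   | true | true = inj₂ (=F-sound aj , =F-sound bi)
      match-sound i j a b e | false | _ with a =F j in aj | b =F i in bi
      ...   | true | true = inj₂ (=F-sound aj , =F-sound bi)

      ¬match : ∀ {i j a b} → ¬ (a ≡ i × b ≡ j) → ¬ (a ≡ j × b ≡ i) → match i j (a , b) ≡ false
      ¬match {i} {j} {a} {b} h₁ h₂ with match i j (a , b) in eq
      ... | false = refl
      ... | true with match-sound i j a b eq
      ...   | inj₁ x = ⊥-elim (h₁ x)
      ...   | inj₂ x = ⊥-elim (h₂ x)

      ∑-match : ∀ {a b} → a ≢ b → ∀ v → ∑ V (λ w → 𝟙 (match v w (a , b))) ≡ 𝟙 (inc (a , b) v)
      ∑-match {a} {b} a≢b v with a =F v in av | b =F v in bv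
      ... | true  | true  = ⊥-elim (a≢b (trans (=F-sound av) (sym (=F-sound bv))))
      ... | true  | false = trans (∑-cong V (λ w → cong 𝟙 (lem w))) (∑-point1 b)
        where
        lem : ∀ w → (b =F w) ∨ ((a =F w) ∧ false) ≡ (b =F w)
        lem w with b =F w | a =F w
        ... | true  | _     = refl
        ... | false | true  = refl
        ... | false | false = refl
      ... | false | true  = trans (∑-cong V (λ w → cong 𝟙 (lem w))) (∑-point1 a)
        where
        lem : ∀ w → ((a =F w) ∧ true) ≡ (a =F w)
        lem w with a =F w
        ... | true  = refl
        ... | false = refl
      ... | false | false = ∑-zero V lem
        where
        lem : ∀ w → 𝟙 ((a =F w) ∧ false) ≡ 0
        lem w with a =F w
        ... | true  = refl
        ... | false = refl

      -- The two orientations exclude each other when i and j differ, so the disjunction becomes a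
      -- sum.
      match-split : ∀ {i j} → i ≢ j → ∀ a b →
        𝟙 (match i j (a , b)) ≡ 𝟙 (i =F a) * 𝟙 (j =F b) + 𝟙 (j =F a) * 𝟙 (i =F b)
      match-split {i} {j} i≢j a b rewrite =F-sym a i | =F-sym b j | =F-sym a j | =F-sym b i
        with i =F a in ia | j =F a in ja
      ... | true  | true  = ⊥-elim (i≢j (trans (=F-sound ia) (sym (=F-sound ja))))
      ... | false | false = refl
      ... | false | true  = sym (+-identityʳ _)
      ... | true  | false with j =F b
      ...   | true  = refl
      ...   | false = refl

      match-swap : ∀ i j a b → match i j (a , b) ≡ match a b (i , j)
      match-swap i j a b = cong₂ _∨_ (cong₂ _∧_ (=F-sym a i) (=F-sym b j))
        (trans (cong₂ _∧_ (=F-sym a j) (=F-sym b i)) (∧-comm (j =F a) (i =F b)))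

      match-flip : ∀ i j a b → match i j (a , b) ≡ match i j (b , a)
      match-flip i j a b = trans (∨-comm ((a =F i) ∧ (b =F j)) _)
        (cong₂ _∨_ (∧-comm (a =F j) (b =F i)) (∧-comm (a =F i) (b =F j)))

    inc-≢ : ∀ {a b} → a ≢ b → ∀ z → 𝟙 (inc (a , b) z) ≡ 𝟙 (a =F z) + 𝟙 (b =F z)
    inc-≢ {a} {b} a≢b z with a =F z in az | b =F z in bz
    ... | true  | true  = ⊥-elim (a≢b (trans (=F-sound az) (sym (=F-sound bz))))
    ... | true  | false = refl
    ... | false | true  = refl
    ... | false | false = refl

    adj : SimpleGraph n → Fin n → Fin n → Bool
    adj []      i j = false
    adj (e ∷ H) i j = match i j e ∨ adj H i j

    adj-sym : ∀ H i j → adj H i j ≡ adj H j i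
    adj-sym []      i j = refl
    adj-sym (e ∷ H) i j = cong₂ _∨_ (match-sym i j e) (adj-sym H i j)

    adj-∑ : ∀ H i j → ∑ H (𝟙 ∘ match i j) ≤ 1 → 𝟙 (adj H i j) ≡ ∑ H (𝟙 ∘ match i j)
    adj-∑ []      i j _ = refl
    adj-∑ (e ∷ H) i j h with match i j e
    ... | true  = cong suc (sym (n≤0⇒n≡0 (s≤s⁻¹ h)))
    ... | false = adj-∑ H i j h

    adj-none : ∀ H i j → ∑ H (𝟙 ∘ match i j) ≡ 0 → adj H i j ≡ false
    adj-none []      i j _ = refl
    adj-none (e ∷ H) i j h with match i j e
    ... | false = adj-none H i j h

    Deg : SimpleGraph n → Fin n → ℕ
    Deg H z = ∑ H (λ e → 𝟙 (inc e z))

    degree-∑ : ∀ (H : SimpleGraph n) z → degree H z ≡ Deg H z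
    degree-∑ H z = length-filter _ H

    ∑-allPairs : ∀ f → ∑ (allPairs n) f ≡ ∑ V (λ a → ∑ V (λ b → 𝟙 (toℕ a <ᵇ toℕ b) * f (a , b)))
    ∑-allPairs f = trans (∑-concatMap (λ i → map (i ,_) (filterᵇ (λ j → toℕ i <ᵇ toℕ j) V)) V f)
      (∑-cong V λ a → trans (∑-map (a ,_) (filterᵇ (λ j → toℕ a <ᵇ toℕ j) V) f)
                             (∑-filter (λ j → toℕ a <ᵇ toℕ j) V (λ b → f (a , b))))

    ∑∑-point : ∀ i j (f : Fin n → Fin n → ℕ) →
      ∑ V (λ a → ∑ V (λ b → f a b * (𝟙 (i =F a) * 𝟙 (j =F b)))) ≡ f i j
    ∑∑-point i j f = trans (∑-cong V λ a → trans (∑-cong V λ b → lem (f a b) (𝟙 (i =F a)) (𝟙 (j =F b)))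
        (trans (∑-point j (λ b → 𝟙 (i =F a) * f a b)) refl))
      (∑-point i (λ a → f a j))
      where
      lem : ∀ x y z → x * (y * z) ≡ z * (y * x)
      lem = solve-∀

    <ᵇ-one : ∀ k l → k ≢ l → 𝟙 (k <ᵇ l) + 𝟙 (l <ᵇ k) ≡ 1
    <ᵇ-one zero    zero    h = ⊥-elim (h refl)
    <ᵇ-one zero    (suc l) h = refl
    <ᵇ-one (suc k) zero    h = refl
    <ᵇ-one (suc k) (suc l) h = <ᵇ-one k l (h ∘ cong suc)

    <ᵇ-irrefl : ∀ k → (k <ᵇ k) ≡ false
    <ᵇ-irrefl zero    = refl
    <ᵇ-irrefl (suc k) = <ᵇ-irrefl k

    allPairs-once : ∀ {i j} → i ≢ j → ∑ (allPairs n) (𝟙 ∘ match i j) ≡ 1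
    allPairs-once {i} {j} i≢j = begin
      ∑ (allPairs n) (𝟙 ∘ match i j)
        ≡⟨ ∑-allPairs _ ⟩
      ∑ V (λ a → ∑ V (λ b → lt a b * 𝟙 (match i j (a , b))))
        ≡⟨ (∑-cong V λ a → trans (∑-cong V λ b →
             trans (cong (lt a b *_) (match-split i≢j a b)) (*-distribˡ-+ (lt a b) _ _))
             (∑-+ V (λ b → lt a b * (𝟙 (i =F a) * 𝟙 (j =F b))) _)) ⟩
      ∑ V (λ a → ∑ V (λ b → lt a b * (𝟙 (i =F a) * 𝟙 (j =F b))) + ∑ V (λ b → lt a b * (𝟙 (j =F a) * 𝟙 (i =F b))))
        ≡⟨ ∑-+ V (λ a → ∑ V (λ b → lt a b * (𝟙 (i =F a) * 𝟙 (j =F b)))) _ ⟩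
      _ ≡⟨ cong₂ _+_ (∑∑-point i j lt) (∑∑-point j i lt) ⟩
      lt i j + lt j i
        ≡⟨ <ᵇ-one (toℕ i) (toℕ j) (i≢j ∘ toℕ-injective) ⟩
      1 ∎
      where
      open ≡-Reasoning
      lt : Fin n → Fin n → ℕ
      lt a b = 𝟙 (toℕ a <ᵇ toℕ b)

    allPairs-irrefl : ∀ i → ∑ (allPairs n) (𝟙 ∘ match i i) ≡ 0
    allPairs-irrefl i = trans (∑-allPairs _) (∑-zero V λ a → ∑-zero V λ b → lem a b)
      where
      lem : ∀ a b → 𝟙 (toℕ a <ᵇ toℕ b) * 𝟙 (match i i (a , b)) ≡ 0
      lem a b with match i i (a , b) in eq
      ... | false = *-zeroʳ (𝟙 (toℕ a <ᵇ toℕ b))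
      ... | true with match-sound i i a b eq
      ...   | inj₁ (refl , refl) = cong (λ x → 𝟙 x * 1) (<ᵇ-irrefl (toℕ i))
      ...   | inj₂ (refl , refl) = cong (λ x → 𝟙 x * 1) (<ᵇ-irrefl (toℕ i))

    allPairs-≤1 : ∀ i j → ∑ (allPairs n) (𝟙 ∘ match i j) ≤ 1
    allPairs-≤1 i j with i ≟F j
    ... | yes refl = ≤-trans (≤-reflexive (allPairs-irrefl i)) z≤n
    ... | no i≢j   = ≤-reflexive (allPairs-once i≢j)

    adj-irrefl : ∀ {H} → H ∈ allGraphs n → ∀ i → adj H i i ≡ false
    adj-irrefl {H} H∈ i = adj-none H i i
      (n≤0⇒n≡0 (≤-trans (∑-subs (allPairs n) (𝟙 ∘ match i i) H∈) (≤-reflexive (allPairs-irrefl i))))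

    -- Membership in `allGraphs` enters twice: a loop would break `∑-match`, a repeated edge
    -- `adj-∑`.
    Deg-adj : ∀ {H} → H ∈ allGraphs n → ∀ v → Deg H v ≡ ∑ V (λ w → 𝟙 (adj H v w))
    Deg-adj {H} H∈ v = begin
      ∑ H (λ e → 𝟙 (inc e v))                      ≡⟨ ∑-cong∈ H (λ e e∈ → sym (∑-match (loopless e e∈) v)) ⟩
      ∑ H (λ e → ∑ V (λ w → 𝟙 (match v w e)))      ≡⟨ ∑-swap H V (λ e w → 𝟙 (match v w e)) ⟩
      ∑ V (λ w → ∑ H (λ e → 𝟙 (match v w e)))      ≡⟨ ∑-cong V (λ w → sym (adj-∑ H v w
                                                        (≤-trans (∑-subs (allPairs n) _ H∈) (allPairs-≤1 v w)))) ⟩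
      ∑ V (λ w → 𝟙 (adj H v w))                    ∎
      where
      open ≡-Reasoning
      loopless : ∀ e → e ∈ H → proj₁ e ≢ proj₂ e
      loopless (a , b) e∈ refl with
        ≤-trans (≤-reflexive (cong 𝟙 (sym (match-refl a a))))
                (≤-trans (∑-∈ (𝟙 ∘ match a a) e∈)
                         (≤-trans (∑-subs (allPairs n) (𝟙 ∘ match a a) H∈) (≤-reflexive (allPairs-irrefl a))))
      ... | ()

    infix 4 _≈_
    -- Members of `allGraphs` list their edges in a fixed order, which putting an edge in front
    -- destroys. Counting therefore uses only functions that see a graph through its adjacencies and
    -- degrees.
    record _≈_ (H H′ : SimpleGraph n) : Set where
      constructor _,_
      field
        adj≡ : ∀ i j → adj H i j ≡ adj H′ i j
        Deg≡ : ∀ z → Deg H z ≡ Deg H′ z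

    ≈-refl : ∀ H → H ≈ H
    ≈-refl H = (λ _ _ → refl) , (λ _ → refl)

    ∷-cong : ∀ e {H H′} → H ≈ H′ → (e ∷ H) ≈ (e ∷ H′)
    ∷-cong e (a , dg) = (λ i j → cong (match i j e ∨_) (a i j)) , (λ z → cong (𝟙 (inc e z) +_) (dg z))

    ∷-swap : ∀ e e′ H → (e ∷ e′ ∷ H) ≈ (e′ ∷ e ∷ H)
    ∷-swap e e′ H = (λ i j → lem (match i j e) (match i j e′) (adj H i j)) ,
      λ z → lem₂ (𝟙 (inc e z)) (𝟙 (inc e′ z)) (Deg H z)
      where
      lem : ∀ a b c → a ∨ (b ∨ c) ≡ b ∨ (a ∨ c)
      lem a b c = trans (sym (∨-assoc a b c)) (trans (cong (_∨ c) (∨-comm a b)) (∨-assoc b a c))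
      lem₂ : ∀ a b c → a + (b + c) ≡ b + (a + c)
      lem₂ = solve-∀

    match-≈ : ∀ {v w} e H → match v w e ≡ true → (e ∷ H) ≈ ((v , w) ∷ H)
    match-≈ {v} {w} (a , b) H m with match-sound v w a b m
    ... | inj₁ (refl , refl) = ≈-refl ((a , b) ∷ H)
    ... | inj₂ (refl , refl) =
      (λ i j → cong (_∨ adj H i j) (match-flip i j a b)) ,
      (λ z → cong (λ x → 𝟙 x + Deg H z) (∨-comm (a =F z) (b =F z)))

    open _≈_ public

    Invariant : (SimpleGraph n → ℕ) → Set
    Invariant f = ∀ {H H′} → H ≈ H′ → f H ≡ f H′

    -- Inserting vw is a bijection from the sublists without this pair to those with it. The
    -- induction descends to the place of the pair in L.
    toggle-subs : ∀ v w L → ∑ L (𝟙 ∘ match v w) ≡ 1 → ∀ f → Invariant f →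
      ∑ (subs L) (λ H → 𝟙 (adj H v w) * f H) ≡ ∑ (subs L) (λ H → 𝟙 (not (adj H v w)) * f ((v , w) ∷ H))
    toggle-subs v w (x ∷ xs) once f inv with match v w x in eq
    -- Here x is the pair itself: on the left only the sublists with x survive, on the right only
    -- those without it, and these correspond.
    ... | true = begin
      ∑ (subs xs ++ map (x ∷_) (subs xs)) (λ H → 𝟙 (adj H v w) * f H)
        ≡⟨ ∑-++ (subs xs) _ _ ⟩
      ∑ (subs xs) (λ H → 𝟙 (adj H v w) * f H) + ∑ (map (x ∷_) (subs xs)) (λ H → 𝟙 (adj H v w) * f H)
        ≡⟨ cong₂ _+_ (trans (∑-cong∈ (subs xs) λ H H∈ → cong (λ b → 𝟙 b * f H) (absent H H∈)) (∑-0 (subs xs)))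
                     (∑-map (x ∷_) (subs xs) _) ⟩
      ∑ (subs xs) (λ H → 𝟙 (match v w x ∨ adj H v w) * f (x ∷ H))
        ≡⟨ (∑-cong∈ (subs xs) λ H H∈ → trans (cong (λ b → 𝟙 (b ∨ adj H v w) * f (x ∷ H)) eq)
              (trans (cong (1 *_) (inv (match-≈ x H eq)))
                     (sym (cong (λ b → 𝟙 (not b) * f ((v , w) ∷ H)) (absent H H∈))))) ⟩
      ∑ (subs xs) g
        ≡⟨ sym (+-identityʳ _) ⟩
      ∑ (subs xs) g + 0
        ≡⟨ cong (∑ (subs xs) g +_) (sym (trans (∑-map (x ∷_) (subs xs) g)
              (∑-zero (subs xs) λ H → cong (λ b → 𝟙 (not (b ∨ adj H v w)) * f ((v , w) ∷ x ∷ H)) eq))) ⟩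
      ∑ (subs xs) g + ∑ (map (x ∷_) (subs xs)) g
        ≡⟨ sym (∑-++ (subs xs) _ _) ⟩
      ∑ (subs xs ++ map (x ∷_) (subs xs)) g ∎
      where
      open ≡-Reasoning
      g : SimpleGraph n → ℕ
      g H = 𝟙 (not (adj H v w)) * f ((v , w) ∷ H)
      absent : ∀ H → H ∈ subs xs → adj H v w ≡ false
      absent H H∈ = adj-none H v w
        (n≤0⇒n≡0 (≤-trans (∑-subs xs (𝟙 ∘ match v w) H∈) (≤-reflexive (suc-injective once))))
    ... | false = begin
      ∑ (subs xs ++ map (x ∷_) (subs xs)) (λ H → 𝟙 (adj H v w) * f H)
        ≡⟨ trans (∑-++ (subs xs) _ _) (cong (∑ (subs xs) (λ H → 𝟙 (adj H v w) * f H) +_) (∑-map (x ∷_) (subs xs) _)) ⟩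
      ∑ (subs xs) (λ H → 𝟙 (adj H v w) * f H) + ∑ (subs xs) (λ H → 𝟙 (match v w x ∨ adj H v w) * f (x ∷ H))
        ≡⟨ cong₂ _+_ (toggle-subs v w xs once f inv)
             (trans (∑-cong (subs xs) λ H → cong (λ b → 𝟙 (b ∨ adj H v w) * f (x ∷ H)) eq)
                    (toggle-subs v w xs once (λ H → f (x ∷ H)) (λ p → inv (∷-cong x p)))) ⟩
      ∑ (subs xs) g + ∑ (subs xs) (λ H → 𝟙 (not (adj H v w)) * f (x ∷ (v , w) ∷ H))
        ≡⟨ cong (∑ (subs xs) g +_) (trans
             (∑-cong (subs xs) λ H → sym (cong₂ (λ b y → 𝟙 (not (b ∨ adj H v w)) * y) eq (inv (∷-swap (v , w) x H))))
             (sym (∑-map (x ∷_) (subs xs) g))) ⟩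
      ∑ (subs xs) g + ∑ (map (x ∷_) (subs xs)) g
        ≡⟨ sym (∑-++ (subs xs) _ _) ⟩
      ∑ (subs xs ++ map (x ∷_) (subs xs)) g ∎
      where
      open ≡-Reasoning
      g : SimpleGraph n → ℕ
      g H = 𝟙 (not (adj H v w)) * f ((v , w) ∷ H)

    𝒢 : List (SimpleGraph n)
    𝒢 = allGraphs n

    toggle : ∀ {v w} → v ≢ w → ∀ f → Invariant f →
      ∑ 𝒢 (λ H → 𝟙 (adj H v w) * f H) ≡ ∑ 𝒢 (λ H → 𝟙 (not (adj H v w)) * f ((v , w) ∷ H))
    toggle {v} {w} v≢w f inv = toggle-subs v w (allPairs n) (allPairs-once v≢w) f inv

    -- Two applications of `toggle`; as the pairs pq and rt differ, inserting one does not affect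
    -- whether the other is present.
    toggle₂ : ∀ {p q r t} → p ≢ q → r ≢ t → match r t (p , q) ≡ false → match p q (r , t) ≡ false →
      ∀ f → Invariant f →
      ∑ 𝒢 (λ H → 𝟙 (adj H p q) * (𝟙 (adj H r t) * f H)) ≡
      ∑ 𝒢 (λ H → 𝟙 (not (adj H p q)) * (𝟙 (not (adj H r t)) * f ((p , q) ∷ (r , t) ∷ H)))
    toggle₂ {p} {q} {r} {t} p≢q r≢t d₁ d₂ f inv = begin
      ∑ 𝒢 (λ H → 𝟙 (adj H p q) * (𝟙 (adj H r t) * f H))
        ≡⟨ toggle p≢q (λ H → 𝟙 (adj H r t) * f H) (λ e → cong₂ (λ b y → 𝟙 b * y) (adj≡ e r t) (inv e)) ⟩
      ∑ 𝒢 (λ H → 𝟙 (not (adj H p q)) * (𝟙 (match r t (p , q) ∨ adj H r t) * f ((p , q) ∷ H)))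
        ≡⟨ (∑-cong 𝒢 λ H → trans (cong (λ b → 𝟙 (not (adj H p q)) * (𝟙 (b ∨ adj H r t) * f ((p , q) ∷ H))) d₁)
              (comm (𝟙 (not (adj H p q))) (𝟙 (adj H r t)) (f ((p , q) ∷ H)))) ⟩
      ∑ 𝒢 (λ H → 𝟙 (adj H r t) * (𝟙 (not (adj H p q)) * f ((p , q) ∷ H)))
        ≡⟨ toggle r≢t (λ H → 𝟙 (not (adj H p q)) * f ((p , q) ∷ H))
             (λ e → cong₂ (λ b y → 𝟙 (not b) * y) (adj≡ e p q) (inv (∷-cong (p , q) e))) ⟩
      ∑ 𝒢 (λ H → 𝟙 (not (adj H r t)) * (𝟙 (not (match p q (r , t) ∨ adj H p q)) * f ((p , q) ∷ (r , t) ∷ H)))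
        ≡⟨ (∑-cong 𝒢 λ H → trans (cong (λ b → 𝟙 (not (adj H r t)) * (𝟙 (not (b ∨ adj H p q)) * f ((p , q) ∷
            (r , t) ∷ H))) d₂)
              (comm (𝟙 (not (adj H r t))) (𝟙 (not (adj H p q))) (f ((p , q) ∷ (r , t) ∷ H)))) ⟩
      _ ∎
      where
      open ≡-Reasoning
      comm : ∀ a b c → a * (b * c) ≡ b * (a * c)
      comm = solve-∀

  ∧-trueˡ : ∀ {a b} → (a ∧ b) ≡ true → a ≡ true
  ∧-trueˡ {true} _ = refl

  ∧-trueʳ : ∀ {a b} → (a ∧ b) ≡ true → b ≡ true
  ∧-trueʳ {true} e = e

  ∨-falseˡ : ∀ {a b} → (a ∨ b) ≡ false → a ≡ false
  ∨-falseˡ {false} _ = refl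

  ∨-falseʳ : ∀ {a b} → (a ∨ b) ≡ false → b ≡ false
  ∨-falseʳ {false} e = e

  and-∈ : ∀ (xs : List Ix) (p : Ix → Bool) {x} → and (map p xs) ≡ true → x ∈ xs → p x ≡ true
  and-∈ (y ∷ xs) p e (here refl) = ∧-trueˡ e
  and-∈ (y ∷ xs) p e (there x∈)  = and-∈ xs p (∧-trueʳ {p y} e) x∈

  ∑-* : ∀ (xs : List Ix) (ys : List Iy) f g → ∑ xs (λ x → ∑ ys (λ y → f x * g y)) ≡ ∑ xs f * ∑ ys g
  ∑-* xs ys f g = trans (∑-cong xs (λ x → ∑-*ˡ ys (f x) g)) (∑-*ʳ xs f (∑ ys g))

  ∑-swap₃ : ∀ {C : Set} (xs : List Ix) (ys : List Iy) (zs : List C) (f : Ix → Iy → C → ℕ) →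
    ∑ xs (λ x → ∑ ys (λ y → ∑ zs (f x y))) ≡ ∑ ys (λ y → ∑ zs (λ z → ∑ xs (λ x → f x y z)))
  ∑-swap₃ xs ys zs f = trans (∑-swap xs ys (λ x y → ∑ zs (f x y)))
    (∑-cong ys (λ y → ∑-swap xs zs (λ x → f x y)))

  ∑∑-*ˡ : ∀ (xs : List Ix) (ys : List Iy) c (f : Ix → Iy → ℕ) →
    ∑ xs (λ x → ∑ ys (λ y → c * f x y)) ≡ c * ∑ xs (λ x → ∑ ys (f x))
  ∑∑-*ˡ xs ys c f = trans (∑-cong xs (λ x → ∑-*ˡ ys c (f x))) (∑-*ˡ xs c _)

  -- Graphs with the given degrees that contain the revealed edges, and the switching between them.

  module Counting {n : ℕ} (D : Vec ℕ n) where

    d : Fin n → ℕ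
    d = lookup D

    s : ℕ
    s = ∑ V d

    opaque
      ok : SimpleGraph n → Bool
      ok = hasDegSeq D

      ok-def : ∀ H → ok H ≡ hasDegSeq D H
      ok-def H = refl

      ok-cong : ∀ H H′ → (∀ z → Deg H z ≡ Deg H′ z) → ok H ≡ ok H′
      ok-cong H H′ e = cong and (map-cong (λ v → cong (_≡ᵇ lookup D v)
        (trans (degree-∑ H v) (trans (e v) (sym (degree-∑ H′ v))))) V)

      ok-Deg : ∀ {H} → ok H ≡ true → ∀ v → Deg H v ≡ d v
      ok-Deg {H} e v = trans (sym (degree-∑ H v)) (≡ᵇ⇒≡ (degree H v) (d v)
        (≡⇒T (and-∈ V (λ v → degree H v ≡ᵇ lookup D v) e (∈-allFin v))))

    sub : SimpleGraph n → SimpleGraph n → Bool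
    sub []            H = true
    sub ((a , b) ∷ F) H = adj H a b ∧ sub F H

    wt : SimpleGraph n → SimpleGraph n → ℕ
    wt F H = 𝟙 (ok H ∧ sub F H)

    N : SimpleGraph n → ℕ
    N F = ∑ 𝒢 (wt F)

    nb : SimpleGraph n → Fin n → Fin n → ℕ
    nb H v w = 𝟙 (adj H v w)

    cl : SimpleGraph n → Fin n → Fin n → Bool
    cl H v w = (v =F w) ∨ adj H v w

    -- Only unrevealed edges are switched, so that the graph keeps containing F.
    fresh : SimpleGraph n → SimpleGraph n → Fin n → Fin n → ℕ
    fresh F H v w = 𝟙 (adj H v w ∧ not (adj F v w))

    -- Indicator that the edge vw may be inserted: w is neither v nor a neighbour of v.
    ν : SimpleGraph n → Fin n → Fin n → ℕ
    ν H v w = 𝟙 (not (cl H v w))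

    deg : SimpleGraph n → Fin n → ℕ
    deg F v = ∑ V (nb F v)

    -- Half-edges at v that F leaves unmatched. If any graph is counted by `N F`, it contains F and
    -- the subtraction is exact.
    rem : SimpleGraph n → Fin n → ℕ
    rem F v = d v ∸ deg F v

    s′ : SimpleGraph n → ℕ
    s′ F = ∑ V (rem F)

    wt-mono : ∀ F H {x y} → (ok H ≡ true → sub F H ≡ true → x ≤ y) → wt F H * x ≤ wt F H * y
    wt-mono F H h with ok H in e₁ | sub F H in e₂
    ... | true  | true  = +-monoˡ-≤ 0 (h refl refl)
    ... | true  | false = z≤n
    ... | false | _     = z≤n

    wt-cong : ∀ F H {x y} → (ok H ≡ true → sub F H ≡ true → x ≡ y) → wt F H * x ≡ wt F H * y
    wt-cong F H h = ≤-antisym (wt-mono F H (λ a b → ≤-reflexive (h a b)))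
                              (wt-mono F H (λ a b → ≤-reflexive (sym (h a b))))

    sub-cong : ∀ F {H H′} → (∀ i j → adj H i j ≡ adj H′ i j) → sub F H ≡ sub F H′
    sub-cong []            e = refl
    sub-cong ((a , b) ∷ F) e = cong₂ _∧_ (e a b) (sub-cong F e)

    wt-inv : ∀ F → Invariant (wt F)
    wt-inv F {H} {H′} e = cong 𝟙 (cong₂ _∧_ (ok-cong H H′ (Deg≡ e)) (sub-cong F (adj≡ e)))

    sub-∷ : ∀ F {p q} H → adj F p q ≡ false → sub F ((p , q) ∷ H) ≡ sub F H
    sub-∷ []            H _ = refl
    sub-∷ ((a , b) ∷ F) {p} {q} H e = cong₂ _∧_
      (cong (_∨ adj H a b) (trans (match-swap a b p q) (∨-falseˡ e)))
      (sub-∷ F H (∨-falseʳ {match p q (a , b)} e))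

    sub-adj : ∀ F H → sub F H ≡ true → ∀ i j → adj F i j ≡ true → adj H i j ≡ true
    sub-adj ((a , b) ∷ F) H e i j f with match i j (a , b) in m
    ... | false = sub-adj F H (∧-trueʳ {adj H a b} e) i j f
    ... | true with match-sound i j a b m
    ...   | inj₁ (refl , refl) = ∧-trueˡ e
    ...   | inj₂ (refl , refl) = trans (adj-sym H i j) (∧-trueˡ e)

    wt-∷ : ∀ v w F H → wt ((v , w) ∷ F) H ≡ wt F H * nb H v w
    wt-∷ v w F H with ok H | adj H v w
    ... | false | _     = refl
    ... | true  | true  = sym (*-identityʳ _)
    ... | true  | false = sym (*-zeroʳ (𝟙 (sub F H)))

    fresh-≡ : ∀ F H {v w} → adj F v w ≡ false → fresh F H v w ≡ nb H v w
    fresh-≡ F H {v} {w} e rewrite e with adj H v w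
    ... | true  = refl
    ... | false = refl

    fresh-0 : ∀ F H {v w} → adj F v w ≡ true → fresh F H v w ≡ 0
    fresh-0 F H {v} {w} e rewrite e with adj H v w
    ... | true  = refl
    ... | false = refl

    fresh-0′ : ∀ F H {v w} → adj H v w ≡ false → fresh F H v w ≡ 0
    fresh-0′ F H e rewrite e = refl

    fresh≤nb : ∀ F H v w → fresh F H v w ≤ nb H v w
    fresh≤nb F H v w with adj H v w | adj F v w
    ... | true  | true  = z≤n
    ... | true  | false = ≤-refl
    ... | false | _     = z≤n

    fresh-sym : ∀ F H v w → fresh F H v w ≡ fresh F H w v
    fresh-sym F H v w = cong₂ (λ a b → 𝟙 (a ∧ not b)) (adj-sym H v w) (adj-sym F v w)

    nb-sum : ∀ H → H ∈ 𝒢 → ok H ≡ true → ∀ v → ∑ V (nb H v) ≡ d v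
    nb-sum H H∈ e v = trans (sym (Deg-adj {H = H} H∈ v)) (ok-Deg e v)

    fresh+deg : ∀ F {H} → H ∈ 𝒢 → ok H ≡ true → sub F H ≡ true →
      ∀ v → ∑ V (fresh F H v) + deg F v ≡ d v
    fresh+deg F {H} H∈ e₁ e₂ v = trans (sym (∑-+ V (fresh F H v) (nb F v)))
      (trans (∑-cong V lem) (nb-sum H H∈ e₁ v))
      where
      split : ∀ a b → (b ≡ true → a ≡ true) → 𝟙 (a ∧ not b) + 𝟙 b ≡ 𝟙 a
      split true  true  _ = refl
      split true  false _ = refl
      split false false _ = refl
      split false true  h with h refl
      ... | ()
      lem : ∀ w → fresh F H v w + nb F v w ≡ nb H v w
      lem w = split (adj H v w) (adj F v w) (sub-adj F H e₂ v w)

    -- The number of unrevealed edges at v is the same in all counted graphs; this turns sums over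
    -- choices of edges into factors `rem`.
    fresh-sum : ∀ F {H} → H ∈ 𝒢 → ok H ≡ true → sub F H ≡ true →
      ∀ v → ∑ V (fresh F H v) ≡ rem F v
    fresh-sum F H∈ e₁ e₂ v = trans (sym (m+n∸n≡m _ (deg F v))) (cong (_∸ deg F v) (fresh+deg F H∈ e₁ e₂ v))

    private
      lhs : ∀ F p q r t → SimpleGraph n → ℕ
      lhs F p q r t H = wt F H * (fresh F H p q * fresh F H r t * (ν H p r * ν H q t))

      rhs : ∀ F p q r t → SimpleGraph n → ℕ
      rhs F p q r t H = wt F H * (fresh F H p r * fresh F H q t)

      -- The generic case: distinct vertices, none of the four pairs revealed. `toggle₂` removes pq
      -- and rt, and `toggle₂` read backwards inserts pr and qt; both sums pass through the graphs
      -- with none of the four edges.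
      switch-main : ∀ F {p q r t} → p ≢ q → r ≢ t → p ≢ r → q ≢ t → p ≢ t → q ≢ r →
        adj F p q ≡ false → adj F r t ≡ false → adj F p r ≡ false → adj F q t ≡ false →
        ∑ 𝒢 (lhs F p q r t) ≤ ∑ 𝒢 (rhs F p q r t)
      switch-main F {p} {q} {r} {t} pq rt pr qt pt qr fpq frt fpr fqt = begin
        ∑ 𝒢 (lhs F p q r t)
          ≡⟨ (∑-cong 𝒢 λ H → trans (cong₂ (λ a b → wt F H * (a * b * (ν H p r * ν H q t))) (fresh-≡ F H fpq)
              (fresh-≡ F H frt))
               (re₁ (wt F H) (nb H p q) (nb H r t) (ν H p r * ν H q t))) ⟩
        ∑ 𝒢 (λ H → nb H p q * (nb H r t * f₁ H))
          ≡⟨ toggle₂ pq rt (¬match (λ e → pr (proj₁ e)) (λ e → pt (proj₁ e)))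
               (¬match (λ e → pr (sym (proj₁ e))) (λ e → qr (sym (proj₁ e)))) f₁
               (λ {H} {H′} e → cong₂ _*_ (wt-inv F e) (cong₂ (λ a b → 𝟙 (not ((p =F r) ∨ a)) * 𝟙 (not ((q =F t) ∨ b))) (adj≡ e p r) (adj≡ e q t))) ⟩
        ∑ 𝒢 (λ H → μ H p q * (μ H r t * f₁ ((p , q) ∷ (r , t) ∷ H)))
          ≡⟨ ∑-cong 𝒢 pointwise ⟩
        ∑ 𝒢 (λ H → μ H p r * (μ H q t * f₂ ((p , r) ∷ (q , t) ∷ H)))
          ≡⟨ toggle₂ pr qt (¬match (λ e → pq (proj₁ e)) (λ e → pt (proj₁ e)))
               (¬match (λ e → pq (sym (proj₁ e))) (λ e → qr (proj₁ e))) f₂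
               (λ {H} {H′} e → cong₂ _*_ (wt-inv F e) (cong₂ (λ a b → 𝟙 (not a) * 𝟙 (not b)) (adj≡ e p q) (adj≡ e r t))) ⟨
        ∑ 𝒢 (λ H → nb H p r * (nb H q t * f₂ H))
          -- Equality is lost only here: that pq and rt are absent after the switching is forgotten.
          ≤⟨ (∑-mono 𝒢 λ H → ≤-trans (*-monoʳ-≤ (nb H p r) (*-monoʳ-≤ (nb H q t) (*-monoʳ-≤ (wt F H) (*-mono-≤
              (𝟙≤1 (not (adj H p q))) (𝟙≤1 (not (adj H r t)))))))
              (≤-reflexive (trans (re₂ (nb H p r) (nb H q t) (wt F H)) (sym (cong₂ (λ a b → wt F H * (a * b))
                  (fresh-≡ F H fpr) (fresh-≡ F H fqt)))))) ⟩
        ∑ 𝒢 (rhs F p q r t) ∎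
        where
        open ≤-Reasoning
        μ : SimpleGraph n → Fin n → Fin n → ℕ
        μ H a b = 𝟙 (not (adj H a b))
        f₁ f₂ : SimpleGraph n → ℕ
        f₁ H = wt F H * (ν H p r * ν H q t)
        f₂ H = wt F H * (μ H p q * μ H r t)
        re₁ : ∀ a b c e → a * (b * c * e) ≡ b * (c * (a * e))
        re₁ = solve-∀
        re₂ : ∀ a b c → a * (b * (c * (1 * 1))) ≡ c * (a * b)
        re₂ = solve-∀
        re₃ : ∀ a b c e f → a * (b * (c * (e * f))) ≡ e * (f * (c * (a * b)))
        re₃ = solve-∀
        re₄ : ∀ a b c e x → (a + b) + ((c + e) + x) ≡ (a + c) + ((b + e) + x)
        re₄ = solve-∀

        drop₂ : ∀ H a b e e′ → match a b e ≡ false → match a b e′ ≡ false → adj (e ∷ e′ ∷ H) a b ≡ adj H a b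
        drop₂ H a b e e′ m m′ = cong₂ (λ x y → x ∨ (y ∨ adj H a b)) m m′

        degrees : ∀ H z → Deg ((p , q) ∷ (r , t) ∷ H) z ≡ Deg ((p , r) ∷ (q , t) ∷ H) z
        degrees H z =
          trans (expand pq rt) (trans (re₄ (𝟙 (p =F z)) (𝟙 (q =F z)) (𝟙 (r =F z)) (𝟙 (t =F z)) (Deg H z)) (sym
              (expand pr qt)))
          where
          expand : ∀ {a b c e} → a ≢ b → c ≢ e → Deg ((a , b) ∷ (c , e) ∷ H) z ≡
            (𝟙 (a =F z) + 𝟙 (b =F z)) + ((𝟙 (c =F z) + 𝟙 (e =F z)) + Deg H z)
          expand {a} {b} {c} {e} ab ce = cong₂ _+_ (inc-≢ ab z) (cong (_+ Deg H z) (inc-≢ ce z))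

        weights : ∀ H → wt F ((p , q) ∷ (r , t) ∷ H) ≡ wt F ((p , r) ∷ (q , t) ∷ H)
        weights H = cong 𝟙 (cong₂ _∧_ (ok-cong ((p , q) ∷ (r , t) ∷ H) ((p , r) ∷ (q , t) ∷ H) (degrees H))
          (trans (sub-∷ F ((r , t) ∷ H) fpq) (trans (sub-∷ F H frt)
            (sym (trans (sub-∷ F ((q , t) ∷ H) fpr) (sub-∷ F H fqt))))))

        pointwise : ∀ H → μ H p q * (μ H r t * f₁ ((p , q) ∷ (r , t) ∷ H)) ≡ μ H p r * (μ H q t * f₂ ((p , r) ∷
            (q , t) ∷ H))
        pointwise H = trans
          (cong (λ x → μ H p q * (μ H r t * x)) (cong₂ _*_ (weights H) (cong₂ _*_
            (cong (𝟙 ∘ not) (cong₂ _∨_ (=F-no pr) (drop₂ H p r (p , q) (r , t) (¬match (λ e → qr (proj₂ e))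
                (λ e → pr (proj₁ e))) (¬match (λ e → pr (sym (proj₁ e))) (λ e → pt (sym (proj₂ e)))))))
            (cong (𝟙 ∘ not) (cong₂ _∨_ (=F-no qt) (drop₂ H q t (p , q) (r , t) (¬match (λ e → pq (proj₁ e))
                (λ e → pt (proj₁ e))) (¬match (λ e → qr (sym (proj₁ e))) (λ e → rt (proj₁ e)))))))))
          (trans (re₃ (μ H p q) (μ H r t) (wt F ((p , r) ∷ (q , t) ∷ H)) (μ H p r) (μ H q t))
          (cong (λ x → μ H p r * (μ H q t * (wt F ((p , r) ∷ (q , t) ∷ H) * x))) (sym (cong₂ _*_
            (cong (𝟙 ∘ not) (drop₂ H p q (p , r) (q , t) (¬match (λ e → qr (sym (proj₂ e))) (λ e → pq (proj₁ e)))
                (¬match (λ e → pq (sym (proj₁ e))) (λ e → pt (sym (proj₂ e))))))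
            (cong (𝟙 ∘ not) (drop₂ H r t (p , r) (q , t) (¬match (λ e → pr (proj₁ e)) (λ e → pt (proj₁ e)))
                (¬match (λ e → qr (proj₁ e)) (λ e → qt (proj₁ e)))))))))

      zero₁ : ∀ a {b} c e → b ≡ 0 → a * (b * c * e) ≡ 0
      zero₁ a c e refl = *-zeroʳ a

      zero₂ : ∀ a b {c} e → c ≡ 0 → a * (b * c * e) ≡ 0
      zero₂ a b e refl = trans (cong (λ x → a * (x * e)) (*-zeroʳ b)) (*-zeroʳ a)

      zero₃ : ∀ a b c x y → x ≡ true → a * (b * c * (𝟙 (not x) * y)) ≡ 0
      zero₃ a b c x y refl = trans (cong (a *_) (*-zeroʳ (b * c))) (*-zeroʳ a)

      zero₄ : ∀ a b c x y → y ≡ true → a * (b * c * (x * 𝟙 (not y))) ≡ 0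
      zero₄ a b c x y refl = trans (cong (λ z → a * (b * c * z)) (*-zeroʳ x)) (trans (cong (a *_) (*-zeroʳ
          (b * c))) (*-zeroʳ a))

    cl-refl : ∀ H v → cl H v v ≡ true
    cl-refl H v = cong (_∨ adj H v v) (=F-refl v)

    cl-adj : ∀ H {v w} → adj H v w ≡ true → cl H v w ≡ true
    cl-adj H {v} {w} e = trans (cong ((v =F w) ∨_) e) (∨-zeroʳ (v =F w))

    -- Replacing the edges pq, rt by pr, qt is injective and keeps all degrees.
    switch : ∀ F p q r t →
      ∑ 𝒢 (λ H → wt F H * (fresh F H p q * fresh F H r t * (ν H p r * ν H q t))) ≤
      ∑ 𝒢 (λ H → wt F H * (fresh F H p r * fresh F H q t))
    switch F p q r t = go (p ≟F q) (r ≟F t) (p ≟F r) (q ≟F t) (p ≟F t) (q ≟F r)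
      where
      vanish : (∀ H → H ∈ 𝒢 → lhs F p q r t H ≡ 0) → ∑ 𝒢 (lhs F p q r t) ≤ ∑ 𝒢 (rhs F p q r t)
      vanish h = ≤-trans (≤-reflexive (trans (∑-cong∈ 𝒢 h) (∑-0 (𝒢 {n})))) z≤n

      -- A new edge that is already in F lies in every counted graph, where the factor `ν` then
      -- vanishes.
      forced : ∀ a b → adj F a b ≡ true → (∀ H → adj H a b ≡ true → lhs F p q r t H ≡ 0) →
        ∑ 𝒢 (lhs F p q r t) ≤ ∑ 𝒢 (rhs F p q r t)
      forced a b e h = vanish λ H _ → trans
        (wt-cong F H {y = 0} λ e₁ e₂ → trans (sym (+-identityʳ _)) (trans (cong (_* X H) (sym (cong₂ (λ x y → 𝟙
            (x ∧ y)) e₁ e₂))) (h H (sub-adj F H e₂ a b e))))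
        (*-zeroʳ (wt F H))
        where
        X : SimpleGraph n → ℕ
        X H = fresh F H p q * fresh F H r t * (ν H p r * ν H q t)

      go : Dec (p ≡ q) → Dec (r ≡ t) → Dec (p ≡ r) → Dec (q ≡ t) → Dec (p ≡ t) → Dec (q ≡ r) →
        ∑ 𝒢 (lhs F p q r t) ≤ ∑ 𝒢 (rhs F p q r t)
      go (yes refl) _ _ _ _ _ = vanish λ H H∈ → zero₁ (wt F H) (fresh F H r t) (ν H p r * ν H q t) (fresh-0′ F H
          (adj-irrefl H∈ p))
      go (no _) (yes refl) _ _ _ _ = vanish λ H H∈ → zero₂ (wt F H) (fresh F H p q) (ν H p r * ν H q t)
          (fresh-0′ F H (adj-irrefl H∈ r))
      go (no _) (no _) (yes refl) _ _ _ = vanish λ H _ → zero₃ (wt F H) (fresh F H p q) (fresh F H r t) (cl H p p)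
          (ν H q t) (cl-refl H p)
      go (no _) (no _) (no _) (yes refl) _ _ = vanish λ H _ → zero₄ (wt F H) (fresh F H p q) (fresh F H r t)
          (ν H p r) (cl H q q) (cl-refl H q)
      -- p = t: if pq is an edge, then q is a neighbour of t and the second `ν` vanishes. The case q
      -- = r is symmetric.
      go (no _) (no _) (no _) (no _) (yes refl) _ = vanish λ H _ → by H (adj H p q) refl
        where
        by : ∀ H b → adj H p q ≡ b → lhs F p q r p H ≡ 0
        by H false e = zero₁ (wt F H) (fresh F H r t) (ν H p r * ν H q t) (fresh-0′ F H e)
        by H true  e = zero₄ (wt F H) (fresh F H p q) (fresh F H r t) (ν H p r) (cl H q p) (cl-adj H (trans
            (adj-sym H q p) e))
      go (no _) (no _) (no _) (no _) (no _) (yes refl) = vanish λ H _ → by H (adj H p q) refl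
        where
        by : ∀ H b → adj H p q ≡ b → lhs F p q q t H ≡ 0
        by H false e = zero₁ (wt F H) (fresh F H r t) (ν H p r * ν H q t) (fresh-0′ F H e)
        by H true  e = zero₃ (wt F H) (fresh F H p q) (fresh F H q t) (cl H p q) (ν H q t) (cl-adj H e)
      go (no pq) (no rt) (no pr) (no qt) (no pt) (no qr) =
        by (adj F p q) (adj F r t) (adj F p r) (adj F q t) refl refl refl refl
        where
        by : ∀ b₁ b₂ b₃ b₄ → adj F p q ≡ b₁ → adj F r t ≡ b₂ → adj F p r ≡ b₃ → adj F q t ≡ b₄ →
          ∑ 𝒢 (lhs F p q r t) ≤ ∑ 𝒢 (rhs F p q r t)
        by true  _     _     _     e₁ _  _  _  = vanish λ H _ → zero₁ (wt F H) (fresh F H r t) (ν H p r * ν H q t)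
            (fresh-0 F H e₁)
        by false true  _     _     _  e₂ _  _  = vanish λ H _ → zero₂ (wt F H) (fresh F H p q) (ν H p r * ν H q t)
            (fresh-0 F H e₂)
        by false false true  _     _  _  e₃ _  = forced p r e₃ λ H e → zero₃ (wt F H) (fresh F H p q)
            (fresh F H r t) (cl H p r) (ν H q t) (cl-adj H e)
        by false false false true  _  _  _  e₄ = forced q t e₄ λ H e → zero₄ (wt F H) (fresh F H p q)
            (fresh F H r t) (ν H p r) (cl H q t) (cl-adj H e)
        by false false false false e₁ e₂ e₃ e₄ = switch-main F pq rt pr qt pt qr e₁ e₂ e₃ e₄

  -- Upper and lower bounds for the probability of an edge.

  -- E₀ bounds the number of oriented edges spoiling a switching.
  module Switching {n : ℕ} (D : Vec ℕ n) (Δ : ℕ) (d≤Δ : ∀ v → lookup D v ≤ Δ) where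
    open Counting D

    E₀ : ℕ
    E₀ = 2 * (Δ * suc Δ)

    ∑cl : ∀ {H} → H ∈ 𝒢 → ok H ≡ true → ∀ v → ∑ V (λ x → 𝟙 (cl H v x)) ≤ suc Δ
    ∑cl {H} H∈ e v = begin
      ∑ V (λ x → 𝟙 (cl H v x))                  ≤⟨ ∑-mono V (λ x → 𝟙-∨ (v =F x) (adj H v x)) ⟩
      ∑ V (λ x → 𝟙 (v =F x) + nb H v x)         ≡⟨ ∑-+ V (λ x → 𝟙 (v =F x)) (nb H v) ⟩
      ∑ V (λ x → 𝟙 (v =F x)) + ∑ V (nb H v)     ≡⟨ cong₂ _+_ (∑-point1 v) (nb-sum H H∈ e v) ⟩
      1 + d v                                   ≤⟨ s≤s (d≤Δ v) ⟩
      suc Δ                                     ∎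
      where
      open ≤-Reasoning
      𝟙-∨ : ∀ a b → 𝟙 (a ∨ b) ≤ 𝟙 a + 𝟙 b
      𝟙-∨ true  b = m≤m+n 1 _
      𝟙-∨ false b = ≤-refl

    ∑fresh≤Δ : ∀ F {H} → H ∈ 𝒢 → ok H ≡ true → ∀ v → ∑ V (fresh F H v) ≤ Δ
    ∑fresh≤Δ F {H} H∈ e v = ≤-trans (∑-mono V (fresh≤nb F H v)) (≤-trans (≤-reflexive (nb-sum H H∈ e v)) (d≤Δ v))

    -- A closed neighbourhood has at most Δ + 1 vertices, each with at most Δ unrevealed edges.
    blocked : ∀ F {H} → H ∈ 𝒢 → ok H ≡ true → ∀ v →
      ∑ V (λ x → ∑ V (λ y → 𝟙 (cl H v x) * fresh F H x y)) ≤ Δ * suc Δ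
    blocked F {H} H∈ e v = begin
      ∑ V (λ x → ∑ V (λ y → 𝟙 (cl H v x) * fresh F H x y))
        ≡⟨ ∑-cong V (λ x → ∑-*ˡ V (𝟙 (cl H v x)) (fresh F H x)) ⟩
      ∑ V (λ x → 𝟙 (cl H v x) * ∑ V (fresh F H x))
        ≤⟨ ∑-mono V (λ x → *-monoʳ-≤ (𝟙 (cl H v x)) (∑fresh≤Δ F H∈ e x)) ⟩
      ∑ V (λ x → 𝟙 (cl H v x) * Δ)
        ≡⟨ ∑-*ʳ V (λ x → 𝟙 (cl H v x)) Δ ⟩
      ∑ V (λ x → 𝟙 (cl H v x)) * Δ
        ≤⟨ *-monoˡ-≤ Δ (∑cl H∈ e v) ⟩
      suc Δ * Δ
        ≡⟨ *-comm (suc Δ) Δ ⟩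
      Δ * suc Δ ∎
      where open ≤-Reasoning

    private
      𝟙-not : ∀ a b c → c ≤ c * (𝟙 (not a) * 𝟙 (not b)) + (𝟙 a * c + 𝟙 b * c)
      𝟙-not false false c = ≤-trans (≤-reflexive (sym (*-identityʳ c))) (m≤m+n _ _)
      𝟙-not true  b     c = ≤-trans (≤-reflexive (sym (+-identityʳ c)))
                              (≤-trans (m≤m+n (c + 0) _) (m≤n+m _ (c * 0)))
      𝟙-not false true  c = ≤-trans (≤-reflexive (sym (+-identityʳ c))) (m≤n+m _ (c * 0))

    -- Double counting: pairs of a graph counted by `N F` and a choice (x , y) that `k` admits in
    -- it.
    W : SimpleGraph n → (SimpleGraph n → Fin n → Fin n → ℕ) → ℕ
    W F k = ∑ 𝒢 (λ H → wt F H * ∑ V (λ x → ∑ V (k H x)))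

    W-swap : ∀ F k → W F k ≡ ∑ V (λ x → ∑ V (λ y → ∑ 𝒢 (λ H → wt F H * k H x y)))
    W-swap F k = trans (∑-cong 𝒢 λ H → sym (∑∑-*ˡ V V (wt F H) (k H)))
      (∑-swap₃ 𝒢 V V (λ H x y → wt F H * k H x y))

    W-const : ∀ F k c → (∀ H → H ∈ 𝒢 → ok H ≡ true → sub F H ≡ true → ∑ V (λ x → ∑ V (k H x)) ≤ c) → W F k ≤ N F * c
    W-const F k c h = ≤-trans (∑-mono∈ 𝒢 λ H H∈ → wt-mono F H (h H H∈)) (≤-reflexive (∑-*ʳ 𝒢 (wt F) c))

    N-∷ : ∀ v w F → N ((v , w) ∷ F) ≡ ∑ 𝒢 (λ H → wt F H * nb H v w)
    N-∷ v w F = ∑-cong 𝒢 (wt-∷ v w F)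

    -- A graph containing vw has s′ F oriented unrevealed edges xy. All but E₀ of them can be
    -- switched with vw into vx and wy, and a resulting graph offers at most rem F v · rem F w
    -- choices of vx and wy.
    upper : ∀ F {v w} → v ≢ w → adj F v w ≡ false →
      N ((v , w) ∷ F) * s′ F ≤ N F * (rem F v * rem F w) + N ((v , w) ∷ F) * E₀
    upper F {v} {w} v≢w vw∉F = begin
      N ((v , w) ∷ F) * s′ F
        ≡⟨ trans (cong (_* s′ F) (N-∷ v w F)) (sym (∑-*ʳ 𝒢 (λ H → wt F H * nb H v w) (s′ F))) ⟩
      ∑ 𝒢 (λ H → wt F H * nb H v w * s′ F)
        ≤⟨ ∑-mono∈ 𝒢 (λ H H∈ → ≤-trans (≤-reflexive (*-assoc (wt F H) _ _)) (≤-trans (wt-mono F H (step H H∈))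
            (≤-reflexive (expand (wt F H) _ (nb H v w) E₀)))) ⟩
      ∑ 𝒢 (λ H → wt F H * ∑ V (λ x → ∑ V (k H x)) + wt F H * nb H v w * E₀)
        ≡⟨ trans (∑-+ 𝒢 (λ H → wt F H * ∑ V (λ x → ∑ V (k H x))) _)
             (cong (W F k +_) (trans (∑-*ʳ 𝒢 (λ H → wt F H * nb H v w) E₀) (cong (_* E₀) (sym (N-∷ v w F))))) ⟩
      W F k + N ((v , w) ∷ F) * E₀
        ≤⟨ +-monoˡ-≤ _ main ⟩
      N F * (rem F v * rem F w) + N ((v , w) ∷ F) * E₀ ∎
      where
      open ≤-Reasoning
      k k′ : SimpleGraph n → Fin n → Fin n → ℕ
      k H x y = fresh F H v w * fresh F H x y * (ν H v x * ν H w y)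
      k′ H x y = fresh F H v x * fresh F H w y

      expand : ∀ a b c e → a * (b + c * e) ≡ a * b + a * c * e
      expand = solve-∀

      main : W F k ≤ N F * (rem F v * rem F w)
      main = begin
        W F k
          ≡⟨ W-swap F k ⟩
        ∑ V (λ x → ∑ V (λ y → ∑ 𝒢 (λ H → wt F H * k H x y)))
          ≤⟨ ∑-mono V (λ x → ∑-mono V (λ y → switch F v w x y)) ⟩
        ∑ V (λ x → ∑ V (λ y → ∑ 𝒢 (λ H → wt F H * k′ H x y)))
          ≡⟨ W-swap F k′ ⟨
        W F k′
          ≤⟨ W-const F k′ _ (λ H H∈ e₁ e₂ → ≤-reflexive (trans (∑-* V V (fresh F H v) (fresh F H w))
               (cong₂ _*_ (fresh-sum F H∈ e₁ e₂ v) (fresh-sum F H∈ e₁ e₂ w)))) ⟩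
        N F * (rem F v * rem F w) ∎

      step : ∀ H → H ∈ 𝒢 → ok H ≡ true → sub F H ≡ true →
        nb H v w * s′ F ≤ ∑ V (λ x → ∑ V (k H x)) + nb H v w * E₀
      step H H∈ e₁ e₂ = begin
        nb H v w * s′ F
          ≡⟨ cong (nb H v w *_) (∑-cong V (λ x → sym (fresh-sum F H∈ e₁ e₂ x))) ⟩
        nb H v w * ∑ V (λ x → ∑ V (fresh F H x))
          ≤⟨ *-monoʳ-≤ (nb H v w) (∑-mono V λ x → ∑-mono V λ y → 𝟙-not (cl H v x) (cl H w y) (fresh F H x y)) ⟩
        nb H v w * ∑ V (λ x → ∑ V (λ y → a x y + (b x y + c x y)))
          ≡⟨ cong (nb H v w *_) (trans (∑∑-+ a (λ x y → b x y + c x y)) (cong (∑∑ a +_) (∑∑-+ b c))) ⟩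
        nb H v w * (∑∑ a + (∑∑ b + ∑∑ c))
          ≤⟨ *-monoʳ-≤ (nb H v w) (+-monoʳ-≤ (∑∑ a) (+-mono-≤ (blocked F H∈ e₁ v) c-bound)) ⟩
        nb H v w * (∑∑ a + (Δ * suc Δ + Δ * suc Δ))
          ≡⟨ distr (nb H v w) (∑∑ a) (Δ * suc Δ) ⟩
        nb H v w * ∑∑ a + nb H v w * E₀
          ≡⟨ cong (_+ nb H v w * E₀) (trans (sym (∑∑-*ˡ V V (nb H v w) a))
               (∑-cong V λ x → ∑-cong V λ y → trans (sym (*-assoc (nb H v w) _ _))
                 (cong (λ z → z * fresh F H x y * (ν H v x * ν H w y)) (sym (fresh-≡ F H vw∉F))))) ⟩
        ∑ V (λ x → ∑ V (k H x)) + nb H v w * E₀ ∎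
        where
        ∑∑ : (Fin n → Fin n → ℕ) → ℕ
        ∑∑ f = ∑ V (λ x → ∑ V (f x))
        ∑∑-+ : ∀ f g → ∑∑ (λ x y → f x y + g x y) ≡ ∑∑ f + ∑∑ g
        ∑∑-+ f g = trans (∑-cong V (λ x → ∑-+ V (f x) (g x))) (∑-+ V (λ x → ∑ V (f x)) (λ x → ∑ V (g x)))
        a b c : Fin n → Fin n → ℕ
        a x y = fresh F H x y * (ν H v x * ν H w y)
        b x y = 𝟙 (cl H v x) * fresh F H x y
        c x y = 𝟙 (cl H w y) * fresh F H x y
        c-bound : ∑∑ c ≤ Δ * suc Δ
        c-bound = ≤-trans (≤-reflexive (trans (∑-swap V V c)
          (∑-cong V λ y → ∑-cong V λ x → cong (𝟙 (cl H w y) *_) (fresh-sym F H x y)))) (blocked F H∈ e₁ w)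
        distr : ∀ a b c → a * (b + (c + c)) ≡ a * b + a * (2 * c)
        distr = solve-∀

    -- The assumption says that s′ - E₀ is at least s / 2.
    upper′ : ∀ F {v w} → s + 2 * E₀ ≤ 2 * s′ F → v ≢ w → adj F v w ≡ false →
      N ((v , w) ∷ F) * s ≤ 2 * (N F * (rem F v * rem F w))
    upper′ F {v} {w} big v≢w vw∉F = ≤-cert
      (+-mono-≤ (*-monoʳ-≤ (N ((v , w) ∷ F)) big) (*-monoʳ-≤ 2 (upper F v≢w vw∉F)))
      (cert (N ((v , w) ∷ F)) s E₀ (s′ F) (N F * (rem F v * rem F w)))
      where
      cert : ∀ m s e t p → m * s + (m * (2 * t) + 2 * (p + m * e)) ≡ 2 * p + (m * (s + 2 * e) + 2 * (m * t))
      cert = solve-∀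

    deg-∷ : ∀ a b F z → deg ((a , b) ∷ F) z ≤ deg F z + (𝟙 (a =F z) + 𝟙 (b =F z))
    deg-∷ a b F z = begin
      deg ((a , b) ∷ F) z
        ≤⟨ ∑-mono V (λ w → pt w) ⟩
      ∑ V (λ w → nb F z w + (𝟙 (b =F w) * 𝟙 (a =F z) + 𝟙 (a =F w) * 𝟙 (b =F z)))
        ≡⟨ trans (∑-+ V (nb F z) _) (cong (deg F z +_) (trans (∑-+ V (λ w → 𝟙 (b =F w) * 𝟙 (a =F z)) _)
             (cong₂ _+_ (∑-point b (λ _ → 𝟙 (a =F z))) (∑-point a (λ _ → 𝟙 (b =F z)))))) ⟩
      deg F z + (𝟙 (a =F z) + 𝟙 (b =F z)) ∎
      where
      open ≤-Reasoning
      pt : ∀ w → 𝟙 (match z w (a , b) ∨ adj F z w) ≤ nb F z w + (𝟙 (b =F w) * 𝟙 (a =F z) + 𝟙 (a =F w) * 𝟙 (b =F z))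
      pt w with match z w (a , b) in m
      ... | false = m≤m+n _ _
      ... | true with match-sound z w a b m
      ...   | inj₁ (refl , refl) rewrite =F-refl a | =F-refl b = ≤-trans (m≤m+n 1 _) (m≤n+m _ (nb F z w))
      ...   | inj₂ (refl , refl) rewrite =F-refl a | =F-refl b = ≤-trans (m≤n+m 1 _) (m≤n+m _ (nb F z w))

    rem-∷ : ∀ a b F z → rem ((a , b) ∷ F) z ≤ rem F z × rem F z ≤ rem ((a , b) ∷ F) z + (𝟙 (a =F z) + 𝟙 (b =F z))
    rem-∷ a b F z = ∸-monoʳ-≤ (d z) deg-mono , ≤-trans (m≤n+m∸n (rem F z) e)
        (≤-trans (≤-reflexive (trans (+-comm e _) (cong (_+ e) (∸-+-assoc (d z) (deg F z) e))))
                 (+-monoˡ-≤ e (∸-monoʳ-≤ (d z) (deg-∷ a b F z))))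
      where
      e = 𝟙 (a =F z) + 𝟙 (b =F z)
      deg-mono : deg F z ≤ deg ((a , b) ∷ F) z
      deg-mono = ∑-mono V λ w → lem (match z w (a , b)) (adj F z w)
        where
        lem : ∀ p q → 𝟙 q ≤ 𝟙 (p ∨ q)
        lem true  q = 𝟙≤1 q
        lem false q = ≤-refl

    s′-∷ : ∀ a b F → s′ F ≤ s′ ((a , b) ∷ F) + 2
    s′-∷ a b F = ≤-trans (∑-mono V (λ z → proj₂ (rem-∷ a b F z)))
      (≤-reflexive (trans (∑-+ V (rem ((a , b) ∷ F)) _) (cong (s′ ((a , b) ∷ F) +_)
        (trans (∑-+ V (λ z → 𝟙 (a =F z)) _) (cong₂ _+_ (∑-point1 a) (∑-point1 b))))))

    s′≤s : ∀ F → s′ F ≤ s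
    s′≤s F = ∑-mono V (λ z → m∸n≤m (d z) (deg F z))

    rem-untouched : ∀ F {w} → (∀ y → adj F w y ≡ false) → rem F w ≡ d w
    rem-untouched F {w} h = cong (d w ∸_) (∑-zero V (λ y → cong 𝟙 (h y)))

    rem≤Δ : ∀ F v → rem F v ≤ Δ
    rem≤Δ F v = ≤-trans (m∸n≤m (d v) (deg F v)) (d≤Δ v)

    cl-sym : ∀ H x y → cl H x y ≡ cl H y x
    cl-sym H x y = cong₂ _∨_ (=F-sym x y) (adj-sym H x y)

    -- Switchings from a graph without vw fail only along a path v x y w; the probability
    -- of its edge vx given the other two is controlled by the upper bound.
    module Lower (F : SimpleGraph n) {v w : Fin n} (big : s + 2 * E₀ + 8 ≤ 2 * s′ F)
                 (v≢w : v ≢ w) (w∉F : ∀ y → adj F w y ≡ false) where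

      path walk : SimpleGraph n → Fin n → Fin n → ℕ
      path H x y = fresh F H v x * fresh F H w y * (𝟙 (not (adj H v w)) * 𝟙 (cl H x y))
      walk H x y = fresh F H w y * 𝟙 (cl H x y)

      -- If the walk from w through y to x is revealed first, giving F′, then vx is a single further
      -- edge and `upper′` applies. At most two edges are added, hence the 4 here and the 8 in
      -- `big`.
      path-via : ∀ x y F′ → (∀ H → wt F′ H ≡ wt F H * walk H x y) → rem F′ v ≤ rem F v →
        s′ F ≤ s′ F′ + 4 → adj F′ v x ≡ false → v ≢ x →
        ∑ 𝒢 (λ H → wt F H * path H x y) * s ≤ 2 * (rem F v * Δ) * ∑ 𝒢 (λ H → wt F H * walk H x y)
      path-via x y F′ eq rem≤ s′≤ vx∉ v≢x = begin
        ∑ 𝒢 (λ H → wt F H * path H x y) * s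
          ≤⟨ *-monoˡ-≤ s (∑-mono 𝒢 λ H → ≤-trans (*-monoʳ-≤ (wt F H) (drop H)) (≤-reflexive
               (trans (sym (*-assoc (wt F H) (walk H x y) (nb H v x))) (cong (_* nb H v x) (sym (eq H)))))) ⟩
        ∑ 𝒢 (λ H → wt F′ H * nb H v x) * s
          ≡⟨ cong (_* s) (sym (N-∷ v x F′)) ⟩
        N ((v , x) ∷ F′) * s
          ≤⟨ upper′ F′ big′ v≢x vx∉ ⟩
        2 * (N F′ * (rem F′ v * rem F′ x))
          ≤⟨ *-monoʳ-≤ 2 (*-monoʳ-≤ (N F′) (*-mono-≤ rem≤ (rem≤Δ F′ x))) ⟩
        2 * (N F′ * (rem F v * Δ))
          ≡⟨ trans (comm (N F′) (rem F v * Δ)) (cong (2 * (rem F v * Δ) *_) (∑-cong 𝒢 eq)) ⟩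
        2 * (rem F v * Δ) * ∑ 𝒢 (λ H → wt F H * walk H x y) ∎
        where
        open ≤-Reasoning
        comm : ∀ a b → 2 * (a * b) ≡ 2 * b * a
        comm = solve-∀
        drop : ∀ H → path H x y ≤ walk H x y * nb H v x
        drop H = begin
          fresh F H v x * fresh F H w y * (𝟙 (not (adj H v w)) * 𝟙 (cl H x y))
            ≤⟨ *-mono-≤ (*-monoˡ-≤ (fresh F H w y) (fresh≤nb F H v x)) (*-monoˡ-≤ (𝟙 (cl H x y)) (𝟙≤1 (not
                (adj H v w)))) ⟩
          nb H v x * fresh F H w y * (1 * 𝟙 (cl H x y))
            ≡⟨ re (nb H v x) (fresh F H w y) (𝟙 (cl H x y)) ⟩
          walk H x y * nb H v x ∎
          where
          re : ∀ a b c → a * b * (1 * c) ≡ b * c * a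
          re = solve-∀
        big′ : s + 2 * E₀ ≤ 2 * s′ F′
        big′ = ≤-cert (+-mono-≤ big (*-monoʳ-≤ 2 s′≤)) (cert s E₀ (s′ F) (s′ F′))
          where
          cert : ∀ s e a b → s + 2 * e + (2 * a + 2 * (b + 4)) ≡ 2 * b + (s + 2 * e + 8 + 2 * a)
          cert = solve-∀

      path-bound : ∀ x y →
        ∑ 𝒢 (λ H → wt F H * path H x y) * s ≤ 2 * (rem F v * Δ) * ∑ 𝒢 (λ H → wt F H * walk H x y)
      path-bound x y = go (y ≟F v) (v ≟F x) (x ≟F y) (adj F v x) refl
        where
        vanish : (∀ H → H ∈ 𝒢 → path H x y ≡ 0) →
          ∑ 𝒢 (λ H → wt F H * path H x y) * s ≤ 2 * (rem F v * Δ) * ∑ 𝒢 (λ H → wt F H * walk H x y)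
        vanish h = ≤-trans (≤-reflexive (cong (_* s)
          (trans (∑-cong∈ 𝒢 λ H H∈ → trans (cong (wt F H *_) (h H H∈)) (*-zeroʳ (wt F H))) (∑-0 (𝒢 {n}))))) z≤n

        go : Dec (y ≡ v) → Dec (v ≡ x) → Dec (x ≡ y) → ∀ b → adj F v x ≡ b →
          ∑ 𝒢 (λ H → wt F H * path H x y) * s ≤ 2 * (rem F v * Δ) * ∑ 𝒢 (λ H → wt F H * walk H x y)
        go (yes refl) _ _ _ _ = vanish λ H _ → by H (adj H v w) refl
          where
          by : ∀ H b → adj H v w ≡ b → path H x v ≡ 0
          by H true  e rewrite e = *-zeroʳ (fresh F H v x * fresh F H w v)
          by H false e rewrite adj-sym H w v | e | *-zeroʳ (fresh F H v x) = refl
        go (no _) (yes refl) _ _ _ = vanish λ H H∈ →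
          cong (λ z → z * fresh F H w y * (𝟙 (not (adj H v w)) * 𝟙 (cl H x y))) (fresh-0′ F H (adj-irrefl H∈ v))
        go (no _) (no _) _ true e = vanish λ H _ →
          cong (λ z → z * fresh F H w y * (𝟙 (not (adj H v w)) * 𝟙 (cl H x y))) (fresh-0 F H e)
        -- F′ adds the edges of the walk: only wx if x = y, both wy and xy otherwise.
        go (no y≢v) (no v≢x) (yes refl) false e = path-via x x ((w , x) ∷ F)
          (λ H → trans (wt-∷ w x F H) (cong (wt F H *_) (trans (sym (*-identityʳ (nb H w x)))
                   (sym (cong₂ (λ a b → a * 𝟙 b) (fresh-≡ F H (w∉F x)) (cl-refl H x))))))
          (proj₁ (rem-∷ w x F v))
          (≤-trans (s′-∷ w x F) (+-monoʳ-≤ _ (s≤s (s≤s z≤n))))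
          (cong₂ _∨_ (¬match (λ p → v≢w (sym (proj₁ p))) (λ p → y≢v (proj₂ p))) e)
          v≢x
        go (no y≢v) (no v≢x) (no x≢y) false e = path-via x y ((w , y) ∷ (x , y) ∷ F)
          (λ H → trans (wt-∷ w y ((x , y) ∷ F) H) (trans (cong (_* nb H w y) (wt-∷ x y F H))
            (trans (re (wt F H) (nb H x y) (nb H w y)) (cong (wt F H *_) (sym (cong₂ _*_ (fresh-≡ F H (w∉F y))
              (cong (λ b → 𝟙 (b ∨ adj H x y)) (=F-no x≢y))))))))
          (≤-trans (proj₁ (rem-∷ w y ((x , y) ∷ F) v)) (proj₁ (rem-∷ x y F v)))
          (≤-trans (s′-∷ x y F) (≤-trans (+-monoˡ-≤ 2 (s′-∷ w y ((x , y) ∷ F))) (≤-reflexive (+-assoc _ 2 2))))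
          (cong₂ _∨_ (¬match (λ p → v≢w (sym (proj₁ p))) (λ p → y≢v (proj₂ p)))
            (cong₂ _∨_ (¬match (λ p → v≢x (sym (proj₁ p))) (λ p → y≢v (proj₂ p))) e))
          v≢x
          where
          re : ∀ a b c → a * b * c ≡ a * (c * b)
          re = solve-∀

      -- Each counted graph has at most rem F w · (Δ + 1) walks; with the factor 2 Δ from
      -- `path-bound` this makes E₀ again.
      paths : W F path * s ≤ N F * (rem F v * rem F w) * E₀
      paths = begin
        W F path * s
          ≡⟨ trans (cong (_* s) (W-swap F path)) (trans (sym (∑-*ʳ V (λ x → ∑ V (P x)) s)) (∑-cong V λ x → sym
              (∑-*ʳ V (P x) s))) ⟩
        ∑ V (λ x → ∑ V (λ y → ∑ 𝒢 (λ H → wt F H * path H x y) * s))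
          ≤⟨ ∑-mono V (λ x → ∑-mono V (λ y → path-bound x y)) ⟩
        ∑ V (λ x → ∑ V (λ y → 2 * (rem F v * Δ) * ∑ 𝒢 (λ H → wt F H * walk H x y)))
          ≡⟨ trans (∑∑-*ˡ V V (2 * (rem F v * Δ)) (λ x y → ∑ 𝒢 (λ H → wt F H * walk H x y))) (cong (2 *
              (rem F v * Δ) *_) (sym (W-swap F walk))) ⟩
        2 * (rem F v * Δ) * W F walk
          ≤⟨ *-monoʳ-≤ (2 * (rem F v * Δ)) (W-const F walk (rem F w * suc Δ) walks) ⟩
        2 * (rem F v * Δ) * (N F * (rem F w * suc Δ))
          ≡⟨ re (rem F v) Δ (N F) (rem F w) (suc Δ) ⟩
        N F * (rem F v * rem F w) * E₀ ∎
        where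
        open ≤-Reasoning
        P : Fin n → Fin n → ℕ
        P x y = ∑ 𝒢 (λ H → wt F H * path H x y)
        re : ∀ a b c e f → 2 * (a * b) * (c * (e * f)) ≡ c * (a * e) * (2 * (b * f))
        re = solve-∀
        walks : ∀ H → H ∈ 𝒢 → ok H ≡ true → sub F H ≡ true → ∑ V (λ x → ∑ V (walk H x)) ≤ rem F w * suc Δ
        walks H H∈ e₁ e₂ = begin
          ∑ V (λ x → ∑ V (walk H x))
            ≡⟨ ∑-swap V V (walk H) ⟩
          ∑ V (λ y → ∑ V (λ x → fresh F H w y * 𝟙 (cl H x y)))
            ≡⟨ (∑-cong V λ y → trans (∑-*ˡ V (fresh F H w y) (λ x → 𝟙 (cl H x y)))
                 (cong (fresh F H w y *_) (∑-cong V λ x → cong 𝟙 (cl-sym H x y)))) ⟩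
          ∑ V (λ y → fresh F H w y * ∑ V (λ x → 𝟙 (cl H y x)))
            ≤⟨ ∑-mono V (λ y → *-monoʳ-≤ (fresh F H w y) (∑cl H∈ e₁ y)) ⟩
          ∑ V (λ y → fresh F H w y * suc Δ)
            ≡⟨ trans (∑-*ʳ V (fresh F H w) (suc Δ)) (cong (_* suc Δ) (fresh-sum F H∈ e₁ e₂ w)) ⟩
          rem F w * suc Δ ∎

      good : SimpleGraph n → Fin n → Fin n → ℕ
      good H x y = fresh F H v x * fresh F H w y * (ν H v w * ν H x y)

      -- Here vx and wy are switched into vw and xy; a graph containing vw has at most s oriented
      -- edges xy to come from.
      switched : W F good ≤ N ((v , w) ∷ F) * s
      switched = begin
        W F good
          ≡⟨ W-swap F good ⟩
        ∑ V (λ x → ∑ V (λ y → ∑ 𝒢 (λ H → wt F H * good H x y)))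
          ≤⟨ ∑-mono V (λ x → ∑-mono V (λ y → switch F v x w y)) ⟩
        ∑ V (λ x → ∑ V (λ y → ∑ 𝒢 (λ H → wt F H * (fresh F H v w * fresh F H x y))))
          ≡⟨ W-swap F (λ H x y → fresh F H v w * fresh F H x y) ⟨
        W F (λ H x y → fresh F H v w * fresh F H x y)
          ≤⟨ ∑-mono∈ 𝒢 (λ H H∈ → ≤-trans (wt-mono F H (step H H∈)) (≤-reflexive (sym (*-assoc (wt F H)
              (nb H v w) s)))) ⟩
        ∑ 𝒢 (λ H → wt F H * nb H v w * s)
          ≡⟨ trans (∑-*ʳ 𝒢 (λ H → wt F H * nb H v w) s) (cong (_* s) (sym (N-∷ v w F))) ⟩
        N ((v , w) ∷ F) * s ∎
        where
        open ≤-Reasoning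
        step : ∀ H → H ∈ 𝒢 → ok H ≡ true → sub F H ≡ true →
          ∑ V (λ x → ∑ V (λ y → fresh F H v w * fresh F H x y)) ≤ nb H v w * s
        step H H∈ e₁ e₂ = ≤-trans (≤-reflexive (∑∑-*ˡ V V (fresh F H v w) (fresh F H)))
          (*-mono-≤ (fresh≤nb F H v w) (≤-trans (≤-reflexive (∑-cong V (fresh-sum F H∈ e₁ e₂))) (s′≤s F)))

      -- A choice of vx and wy can be switched, or vw is already an edge, which leaves at most Δ²
      -- choices, or x and y are equal or adjacent.
      split : N F * (rem F v * rem F w) ≤ W F good + (N ((v , w) ∷ F) * (Δ * Δ) + W F path)
      split = begin
        N F * (rem F v * rem F w)
          ≡⟨ ∑-*ʳ 𝒢 (wt F) (rem F v * rem F w) ⟨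
        ∑ 𝒢 (λ H → wt F H * (rem F v * rem F w))
          ≤⟨ ∑-mono∈ 𝒢 (λ H H∈ → ≤-trans (wt-mono F H (step H H∈)) (≤-reflexive (expand (wt F H) _ (nb H v w)
              (Δ * Δ) _))) ⟩
        ∑ 𝒢 (λ H → wt F H * ∑∑ (good H) + (wt F H * nb H v w * (Δ * Δ) + wt F H * ∑∑ (path H)))
          ≡⟨ trans (∑-+ 𝒢 (λ H → wt F H * ∑∑ (good H)) _) (cong (W F good +_)
               (trans (∑-+ 𝒢 (λ H → wt F H * nb H v w * (Δ * Δ)) _) (cong (_+ W F path)
                 (trans (∑-*ʳ 𝒢 (λ H → wt F H * nb H v w) (Δ * Δ)) (cong (_* (Δ * Δ)) (sym (N-∷ v w F))))))) ⟩
        W F good + (N ((v , w) ∷ F) * (Δ * Δ) + W F path) ∎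
        where
        open ≤-Reasoning
        expand : ∀ a b c e f → a * (b + (c * e + f)) ≡ a * b + (a * c * e + a * f)
        expand = solve-∀
        ∑∑ : (Fin n → Fin n → ℕ) → ℕ
        ∑∑ f = ∑ V (λ x → ∑ V (f x))
        ∑∑-+ : ∀ f g → ∑∑ (λ x y → f x y + g x y) ≡ ∑∑ f + ∑∑ g
        ∑∑-+ f g = trans (∑-cong V (λ x → ∑-+ V (f x) (g x))) (∑-+ V (λ x → ∑ V (f x)) (λ x → ∑ V (g x)))
        three : ∀ a b c → c ≤ c * (𝟙 (not a) * 𝟙 (not b)) + (𝟙 a * c + c * (𝟙 (not a) * 𝟙 b))
        three true  b     c = ≤-slack (c * 0 + c * 0) (re c)
          where re : ∀ c → c + (c * 0 + c * 0) ≡ c * 0 + (1 * c + c * 0)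
                re = solve-∀
        three false true  c = ≤-slack (c * 0) (re c)
          where re : ∀ c → c + c * 0 ≡ c * 0 + (0 * c + c * 1)
                re = solve-∀
        three false false c = ≤-slack (c * 0) (re c)
          where re : ∀ c → c + c * 0 ≡ c * 1 + (0 * c + c * 0)
                re = solve-∀
        step : ∀ H → H ∈ 𝒢 → ok H ≡ true → sub F H ≡ true →
          rem F v * rem F w ≤ ∑∑ (good H) + (nb H v w * (Δ * Δ) + ∑∑ (path H))
        step H H∈ e₁ e₂ = begin
          rem F v * rem F w
            ≡⟨ cong₂ _*_ (fresh-sum F H∈ e₁ e₂ v) (fresh-sum F H∈ e₁ e₂ w) ⟨
          ∑ V (fresh F H v) * ∑ V (fresh F H w)
            ≡⟨ ∑-* V V (fresh F H v) (fresh F H w) ⟨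
          ∑∑ c
            ≤⟨ (∑-mono V λ x → ∑-mono V λ y → ≤-trans (three (adj H v w) (cl H x y) (c x y))
                 (≤-reflexive (cong (λ b → c x y * (𝟙 (not (b ∨ adj H v w)) * ν H x y) +
                     (nb H v w * c x y + path H x y)) (sym (=F-no v≢w))))) ⟩
          ∑∑ (λ x y → good H x y + (nb H v w * c x y + path H x y))
            ≡⟨ trans (∑∑-+ (good H) _) (cong (∑∑ (good H) +_) (∑∑-+ (λ x y → nb H v w * c x y) (path H))) ⟩
          ∑∑ (good H) + (∑∑ (λ x y → nb H v w * c x y) + ∑∑ (path H))
            ≤⟨ +-monoʳ-≤ (∑∑ (good H)) (+-monoˡ-≤ (∑∑ (path H)) (≤-trans
                 (≤-reflexive (trans (∑∑-*ˡ V V (nb H v w) c) (cong (nb H v w *_)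
                   (trans (∑-* V V (fresh F H v) (fresh F H w)) (cong₂ _*_ (fresh-sum F H∈ e₁ e₂ v)
                       (fresh-sum F H∈ e₁ e₂ w))))))
                 (*-monoʳ-≤ (nb H v w) (*-mono-≤ (rem≤Δ F v) (rem≤Δ F w))))) ⟩
          ∑∑ (good H) + (nb H v w * (Δ * Δ) + ∑∑ (path H)) ∎
          where
          c : Fin n → Fin n → ℕ
          c x y = fresh F H v x * fresh F H w y

      -- In ratios: vw is present with probability at least rem F v · d w · (s - E₀) / ((s + Δ²) s).
      -- As w is untouched, rem F w is the full degree.
      lower : N F * (rem F v * d w) * s ≤ N ((v , w) ∷ F) * ((s + Δ * Δ) * s) + N F * (rem F v * d w) * E₀
      lower = subst (λ r → N F * (rem F v * r) * s ≤ N ((v , w) ∷ F) * ((s + Δ * Δ) * s) + N F * (rem F v * r) * E₀)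
        (rem-untouched F w∉F)
        (≤-cert (+-mono-≤ (*-monoˡ-≤ s split) (+-mono-≤ (*-monoˡ-≤ s switched) paths))
          (cert (N F * (rem F v * rem F w)) s E₀ (Δ * Δ) (N ((v , w) ∷ F)) (W F good) (W F path)))
        where
        cert : ∀ a s e δ m g p → a * s + ((g + (m * δ + p)) * s + (m * s * s + a * e)) ≡
          m * ((s + δ) * s) + a * e + (a * s + (g * s + p * s))
        cert = solve-∀

  -- (x⁺)² as a function of x has second derivative at most 2.
  positive-part-square : ∀ X Y P T → let z = X ∸ Y; z′ = (X + P) ∸ (Y + T) in
    z′ * z′ + 2 * (z * T) ≤ z * z + 2 * (z * P) + (P * P + T * T)
  positive-part-square X Y P T = ≤-trans (+-monoˡ-≤ (2 * (z * T)) (*-mono-≤ z′≤u z′≤u)) (by (≤-total T (z + P)))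
    where
    z z′ u : ℕ
    z = X ∸ Y
    z′ = (X + P) ∸ (Y + T)
    u = (z + P) ∸ T
    z′≤u : z′ ≤ u
    z′≤u = ≤-trans (≤-reflexive (sym (∸-+-assoc (X + P) Y T)))
      (∸-monoˡ-≤ T (m≤n+o⇒m∸n≤o (X + P) Y (≤-trans (+-monoˡ-≤ P (m≤n+m∸n X Y)) (≤-reflexive (+-assoc Y z P)))))
    by : T ≤ z + P ⊎ z + P ≤ T → u * u + 2 * (z * T) ≤ z * z + 2 * (z * P) + (P * P + T * T)
    by (inj₁ T≤) = ≤-cert⁺ (2 * (P * T)) ≤-refl
      (trans (cert₁ u z P T) (trans (cong₂ (λ a b → 2 * (a * T) + b * b + T * T) (sym (m∸n+n≡m T≤)) (m∸n+n≡m T≤))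
          (cert₂ u z P T)))
      where
      cert₁ : ∀ u z P T → u * u + 2 * (z * T) + 2 * (P * T) + (2 * (u * T) + 2 * (T * T)) ≡ 2 * ((z + P) * T) +
          (u + T) * (u + T) + T * T
      cert₁ = solve-∀
      cert₂ : ∀ u z P T → 2 * ((u + T) * T) + (z + P) * (z + P) + T * T ≡ z * z + 2 * (z * P) + (P * P + T * T) +
          (2 * (u * T) + 2 * (T * T))
      cert₂ = solve-∀
    -- The new positive part is 0, and 2 z T ≤ z² + T² suffices.
    by (inj₂ ≤T) rewrite m≤n⇒m∸n≡0 ≤T = two-squares (≤-trans (m≤m+n z P) ≤T)
      where
      two-squares : z ≤ T → 2 * (z * T) ≤ z * z + 2 * (z * P) + (P * P + T * T)
      two-squares z≤T = ≤-slack ((T ∸ z) * (T ∸ z) + 2 * (z * P) + P * P)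
        (trans (cong (λ t → 2 * (z * t) + ((T ∸ z) * (T ∸ z) + 2 * (z * P) + P * P)) (sym (m+[n∸m]≡n z≤T)))
          (trans (cert z (T ∸ z) P) (cong (λ t → z * z + 2 * (z * P) + (P * P + t * t)) (m+[n∸m]≡n z≤T))))
        where
        cert : ∀ z k P → 2 * (z * (z + k)) + (k * k + 2 * (z * P) + P * P) ≡ z * z + 2 * (z * P) + (P * P +
            (z + k) * (z + k))
        cert = solve-∀

  -- With δ = Δ²: of the second moment 2 s + 3 q / 4 outside the explored set, the error (s + δ) /
  -- (s - E) of the switchings may consume q / 2.
  drift-constants : ∀ {s q δ E} → E ≤ 4 * δ → 25 * δ ≤ q → 20 * q ≤ s →
    (8 * s + q) * (s + δ) ≤ (8 * s + 3 * q) * (s ∸ E)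
  drift-constants {s} {q} {δ} {E} E≤ δ≤ q≤ = ≤-cert⁺ (9 * (s * δ) + 7 * (q * δ))
    (+-mono-≤ (*-monoʳ-≤ (8 * s + 3 * q) (≤-trans (m≤n+m∸n s E) (+-monoˡ-≤ (s ∸ E) E≤)))
              (+-mono-≤ (*-monoʳ-≤ (2 * s) δ≤) (*-monoʳ-≤ δ q≤)))
    (cert s q δ (s ∸ E))
    where
    cert : ∀ s q δ t → (8 * s + q) * (s + δ) + (9 * (s * δ) + 7 * (q * δ)) + ((8 * s + 3 * q) * (4 * δ + t) +
        (2 * s * q + δ * s)) ≡
      (8 * s + 3 * q) * t + ((8 * s + 3 * q) * s + (2 * s * (25 * δ) + δ * (20 * q)))
    cert = solve-∀

  -- Reachability, sets of vertices as lists, and a termination measure.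

  iter-⊆ : ∀ {n} (H : SimpleGraph n) {S : Fin n → Bool} k j → k ≤ j → ∀ {c} →
    iter k (reachStep H) S c ≡ true → iter j (reachStep H) S c ≡ true
  iter-⊆ H {S} k j k≤j {c} e with m≤n⇒m<n∨m≡n k≤j
  ... | inj₂ refl = e
  iter-⊆ H {S} k (suc j) k≤j {c} e | inj₁ k<j =
    cong (_∨ any (λ e → (iter j (reachStep H) S (proj₁ e) ∧ (proj₂ e =F c)) ∨ (iter j (reachStep H) S (proj₂ e) ∧
        (proj₁ e =F c))) H)
      (iter-⊆ H k j (s≤s⁻¹ k<j) e)

  reach-adj : ∀ {n}
      (H : SimpleGraph n) {S : Fin n → Bool} {v w} → S v ≡ true → adj H v w ≡ true → reachStep H S w ≡ true
  reach-adj {n} H {S} {v} {w} Sv vw = trans (cong (S w ∨_) (go H vw)) (∨-zeroʳ (S w))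
    where
    test : Edge n → Bool
    test e = (S (proj₁ e) ∧ (proj₂ e =F w)) ∨ (S (proj₂ e) ∧ (proj₁ e =F w))
    go : ∀ G → adj G v w ≡ true → any test G ≡ true
    go ((a , b) ∷ G) e with match v w (a , b) in m
    ... | false = trans (cong (test (a , b) ∨_) (go G e)) (∨-zeroʳ (test (a , b)))
    ... | true with match-sound v w a b m
    ...   | inj₁ (refl , refl) = cong (λ x → x ∨ any test G) (cong (_∨ (S b ∧ (a =F b))) (cong₂ _∧_ Sv (=F-refl b)))
    ...   | inj₂ (refl , refl) = cong (λ x → x ∨ any test G)
            (trans (cong ((S a ∧ (b =F a)) ∨_) (cong₂ _∧_ Sv (=F-refl a))) (∨-zeroʳ (S a ∧ (b =F a))))

  ≤-foldr-⊔ : ∀ {xs : List Ix} (f : Ix → ℕ) {x} → x ∈ xs → f x ≤ foldr _⊔_ 0 (map f xs)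
  ≤-foldr-⊔ f (here refl) = m≤m⊔n _ _
  ≤-foldr-⊔ f (there x∈)  = ≤-trans (≤-foldr-⊔ f x∈) (m≤n⊔m (f _) _)

  module _ {n : ℕ} where

    ∑V-1 : ∑ (V {n}) (λ _ → 1) ≡ n
    ∑V-1 = trans (∑-1 (V {n})) (length-tabulate {n = n} (λ x → x))

    -- Sets of vertices are lists with all multiplicities at most 1; sums over them become sums over
    -- all vertices weighted by `cnt`.
    cnt : List (Fin n) → Fin n → ℕ
    cnt A v = ∑ A (λ u → 𝟙 (u =F v))

    ∑-cnt : ∀ (A : List (Fin n)) f → ∑ A f ≡ ∑ V (λ v → cnt A v * f v)
    ∑-cnt A f = trans (∑-cong A (λ u → sym (∑-point u f)))
      (trans (∑-swap A V (λ u v → 𝟙 (u =F v) * f v)) (∑-cong V (λ v → ∑-*ʳ A (λ u → 𝟙 (u =F v)) (f v))))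

    length-cnt : ∀ (A : List (Fin n)) → length A ≡ ∑ V (cnt A)
    length-cnt A = trans (sym (∑-1 A)) (trans (∑-cnt A (λ _ → 1)) (∑-cong V (λ v → *-identityʳ (cnt A v))))

    ∈-cnt : ∀ {A v} → v ∈ A → 1 ≤ cnt A v
    ∈-cnt {A} {v} v∈ = ≤-trans (≤-reflexive (cong 𝟙 (sym (=F-refl v)))) (∑-∈ (λ u → 𝟙 (u =F v)) v∈)

    cnt-∈ : ∀ A {v} → 1 ≤ cnt A v → v ∈ A
    cnt-∈ (u ∷ A) {v} h with u =F v in e
    ... | true  = here (sym (=F-sound e))
    ... | false = there (cnt-∈ A h)

    simple-length : ∀ (A : List (Fin n)) → (∀ v → cnt A v ≤ 1) → length A ≤ n
    simple-length A simple = ≤-trans (≤-reflexive (length-cnt A)) (≤-trans (∑-mono V simple) (≤-reflexive ∑V-1))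

    -- A list without repetitions has length at most n, so the n rounds in `component` cover the
    -- `length C` rounds assumed.
    Cmax-reach : ∀ (H : SimpleGraph n) C root → (∀ v → cnt C v ≤ 1) →
      (∀ c → c ∈ C → iter (length C) (reachStep H) (root =F_) c ≡ true) → length C ≤ Cmax H
    Cmax-reach H C root simple reach = begin
      length C                               ≡⟨ length-cnt C ⟩
      ∑ V (cnt C)                            ≤⟨ ∑-mono V in-component ⟩
      ∑ V (𝟙 ∘ component H root)             ≡⟨ length-filter (component H root) V ⟨
      componentSize H root                   ≤⟨ ≤-foldr-⊔ (componentSize H) (∈-allFin root) ⟩
      Cmax H                                 ∎
      where
      open ≤-Reasoning
      in-component : ∀ v → cnt C v ≤ 𝟙 (component H root v)
      in-component v with cnt C v in e
      ... | zero  = z≤n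
      ... | suc k = ≤-trans (subst (_≤ 1) e (simple v)) (≤-reflexive (cong 𝟙 (sym
              (iter-⊆ H (length C) n (simple-length C simple) (reach v (cnt-∈ C (subst (1 ≤_) (sym e) (s≤s z≤n))))))))

    -- Decreases whenever an edge is revealed; it is half of the termination measure of `explore`.
    non-edges : SimpleGraph n → ℕ
    non-edges F = ∑ V (λ x → ∑ V (λ y → 𝟙 (not (adj F x y))))

    non-edges-∷ : ∀ F {v w} → adj F v w ≡ false → non-edges ((v , w) ∷ F) + 1 ≤ non-edges F
    non-edges-∷ F {v} {w} e = begin
      non-edges ((v , w) ∷ F) + 1
        ≡⟨ cong (non-edges ((v , w) ∷ F) +_) (trans (∑-* V V (λ x → 𝟙 (v =F x)) (λ y → 𝟙 (w =F y))) (cong₂ _*_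
            (∑-point1 v) (∑-point1 w))) ⟨
      non-edges ((v , w) ∷ F) + ∑ V (λ x → ∑ V (λ y → 𝟙 (v =F x) * 𝟙 (w =F y)))
        ≡⟨ trans (∑-cong V λ x → ∑-+ V (λ y → 𝟙 (not (adj ((v , w) ∷ F) x y))) (λ y → 𝟙 (v =F x) * 𝟙 (w =F y)))
            (∑-+ V (λ x → ∑ V (λ y → 𝟙 (not (adj ((v , w) ∷ F) x y)))) (λ x → ∑ V (λ y → 𝟙 (v =F x) * 𝟙 (w =F y)))) ⟨
      ∑ V (λ x → ∑ V (λ y → 𝟙 (not (match x y (v , w) ∨ adj F x y)) + 𝟙 (v =F x) * 𝟙 (w =F y)))
        ≤⟨ ∑-mono V (λ x → ∑-mono V (λ y → pt x y)) ⟩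
      non-edges F ∎
      where
      open ≤-Reasoning
      pt : ∀ x y → 𝟙 (not (match x y (v , w) ∨ adj F x y)) + 𝟙 (v =F x) * 𝟙 (w =F y) ≤ 𝟙 (not (adj F x y))
      pt x y with match x y (v , w) in m
      ... | true = ≤-trans (*-mono-≤ (𝟙≤1 (v =F x)) (𝟙≤1 (w =F y))) (≤-reflexive (cong (𝟙 ∘ not) (sym (off
          (match-sound x y v w m)))))
        where
        off : (v ≡ x × w ≡ y) ⊎ (v ≡ y × w ≡ x) → adj F x y ≡ false
        off (inj₁ (refl , refl)) = e
        off (inj₂ (refl , refl)) = trans (adj-sym F x y) e
      ... | false with v =F x in vx | w =F y in wy
      ...   | false | _     = ≤-reflexive (+-identityʳ _)
      ...   | true  | false = ≤-reflexive (+-identityʳ _)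
      ...   | true  | true  with trans (sym (match-refl v w)) (trans (cong₂ (λ a b → match a b (v , w))
          (=F-sound vx) (=F-sound wy)) m)
      ...     | ()

  -- The exploration process and its potential.

  module Exploration {n : ℕ} (D : Vec ℕ n) (Δ : ℕ) (d≤Δ : ∀ v → lookup D v ≤ Δ)
    (bad : SimpleGraph n → Bool) (q r M₁ : ℕ)
    (1≤d : ∀ v → 1 ≤ lookup D v)
    (∑d² : ∑ V (λ v → lookup D v * lookup D v) ≡ 2 * Counting.s D + q)
    (∑d³ : ∑ V (λ v → lookup D v * lookup D v * lookup D v) ≤ 17 * (r * Counting.s D))
    (1≤q : 1 ≤ q) (20q≤s : 20 * q ≤ Counting.s D) (s≤3n : Counting.s D ≤ 3 * n)
    (25Δ²≤q : 25 * (Δ * Δ) ≤ q) (1≤r : 1 ≤ r) (1≤M₁ : 1 ≤ M₁)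
    (bad-small : ∀ H → bad H ≡ true → Cmax H < M₁) where

    open Counting D
    open Switching D Δ d≤Δ

    Nbad : SimpleGraph n → ℕ
    Nbad F = ∑ 𝒢 (λ H → wt F H * 𝟙 (bad H))

    sq : Fin n → ℕ
    sq v = d v * d v

    -- L is the value of q a - 4 s Y at a = M₁ and Y = 0, the deviation to be excluded. Λ is what
    -- `h` reaches at such an ending, and γ is the allowance for each new vertex.
    L γ Λ : ℕ
    L = q * M₁
    γ = 1250 * (r * (s * s * q + L * L))
    Λ = L * L * q

    -- For m revealed edges Y = S₁ - 2 m, whence the summand 8 s m; truncated subtraction gives the
    -- positive part.
    drift : ℕ → ℕ → ℕ → ℕ
    drift m a S₁ = (q * a + 8 * s * m) ∸ 4 * s * S₁

    -- F is the set of revealed edges and A the set of explored vertices. The first term squares the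
    -- positive part of q a − 4 s Y, where Y is the number of half-edges at A not matched by F; the
    -- second one penalises exploring vertices of large degree, and the last one pays for the variance.
    h : SimpleGraph n → List (Fin n) → ℕ
    h F A = q * (drift (length F) (length A) (∑ A d) * drift (length F) (length A) (∑ A d))
          + 4 * (L * L) * ∑ A sq + γ * (2 * M₁ ∸ length A)

    -- C is the part of the current component found so far, A₀ the union of the finished ones.
    record State (F : SimpleGraph n) (C A₀ : List (Fin n)) : Set where
      field
        simple    : ∀ v → cnt (C ++ A₀) v ≤ 1
        untouched : ∀ v → cnt (C ++ A₀) v ≡ 0 → ∀ y → adj F v y ≡ false
        closed    : ∀ v → v ∈ A₀ → rem F v ≡ 0
        -- The current component began at time M₁ or earlier, so it has at least M₁ vertices at time
        -- 2 M₁.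
        recent    : length A₀ ≤ M₁
        connected : C ≡ [] ⊎ ∃[ root ] (∀ H → sub F H ≡ true → ∀ c → c ∈ C →
                      iter (length C) (reachStep H) (root =F_) c ≡ true)
    open State

    1≤s : 1 ≤ s
    1≤s = ≤-trans (≤-trans 1≤q (m≤m+n q (19 * q))) 20q≤s

    E₀≤4Δ² : E₀ ≤ 4 * (Δ * Δ)
    E₀≤4Δ² = ≤-trans (≤-reflexive (cert₁ Δ)) (≤-trans (+-monoʳ-≤ (2 * (Δ * Δ)) (*-monoʳ-≤ 2 (m≤m*m Δ)))
        (≤-reflexive (cert₂ Δ)))
      where
      m≤m*m : ∀ m → m ≤ m * m
      m≤m*m zero    = z≤n
      m≤m*m (suc m) = m≤m*n (suc m) (suc m)
      cert₁ : ∀ x → 2 * (x * suc x) ≡ 2 * (x * x) + 2 * x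
      cert₁ = solve-∀
      cert₂ : ∀ x → 2 * (x * x) + 2 * (x * x) ≡ 4 * (x * x)
      cert₂ = solve-∀

    d≤sq : ∀ v → d v ≤ sq v
    d≤sq v = ≤-trans (≤-reflexive (sym (*-identityʳ (d v)))) (*-monoʳ-≤ (d v) (1≤d v))

    S₁≤S₂ : ∀ A → ∑ A d ≤ ∑ A sq
    S₁≤S₂ A = ∑-mono A d≤sq

    length≤S₂ : ∀ A → length A ≤ ∑ A sq
    length≤S₂ A = ≤-trans (≤-reflexive (sym (∑-1 A))) (≤-trans (∑-mono A 1≤d) (S₁≤S₂ A))

    deg-length : ∀ F → ∑ V (deg F) ≤ 2 * length F
    deg-length [] = ≤-reflexive (∑-zero (V {n}) (λ v → ∑-0 (V {n})))
    deg-length ((a , b) ∷ F) = begin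
      ∑ V (deg ((a , b) ∷ F))
        ≤⟨ ∑-mono V (deg-∷ a b F) ⟩
      ∑ V (λ z → deg F z + (𝟙 (a =F z) + 𝟙 (b =F z)))
        ≡⟨ trans (∑-+ V (deg F) _) (cong (∑ V (deg F) +_) (trans (∑-+ V (λ z → 𝟙 (a =F z)) _) (cong₂ _+_
            (∑-point1 a) (∑-point1 b)))) ⟩
      ∑ V (deg F) + 2
        ≤⟨ +-monoˡ-≤ 2 (deg-length F) ⟩
      2 * length F + 2
        ≡⟨ cert (length F) ⟩
      2 * suc (length F) ∎
      where
      open ≤-Reasoning
      cert : ∀ m → 2 * m + 2 ≡ 2 * suc m
      cert = solve-∀

    Nbad≤N : ∀ F → Nbad F ≤ N F
    Nbad≤N F = ∑-mono 𝒢 (λ H → ≤-trans (*-monoʳ-≤ (wt F H) (𝟙≤1 (bad H))) (≤-reflexive (*-identityʳ (wt F H))))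

    module _ {F C A₀} (st : State F C A₀) where
      private
        A = C ++ A₀

      ∑A≤ : ∀ f → ∑ A f ≤ ∑ V f
      ∑A≤ f = ≤-trans (≤-reflexive (∑-cnt A f)) (∑-mono V (λ v → ≤-trans (*-monoˡ-≤ (f v) (simple st v))
          (≤-reflexive (*-identityˡ (f v)))))

      -- C alone has at least M₁ vertices and lies in one component of every counted graph, whereas
      -- components of bad graphs are smaller.
      large-component : 2 * M₁ ≤ length A → Nbad F ≡ 0
      large-component 2M≤ = trans (∑-cong∈ 𝒢 (λ H H∈ → trans (wt-cong F H {y = 0} (λ e₁ e₂ → cong 𝟙
          (not-bad H e₂))) (*-zeroʳ (wt F H)))) (∑-0 (𝒢 {n}))
        where
        M≤C : M₁ ≤ length C
        M≤C = +-cancelʳ-≤ M₁ M₁ (length C) (≤-trans (≤-reflexive (cong (M₁ +_) (sym (+-identityʳ M₁)))) (≤-trans 2M≤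
          (≤-trans (≤-reflexive (length-++ C)) (+-monoʳ-≤ (length C) (recent st)))))
        not-bad : ∀ H → sub F H ≡ true → bad H ≡ false
        not-bad H sb with bad H in e
        ... | false = refl
        ... | true with connected st
        ...   | inj₁ refl = ⊥-elim (<⇒≱ 1≤M₁ M≤C)
        ...   | inj₂ (root , reach) = ⊥-elim (<⇒≱ (bad-small H e) (≤-trans M≤C
                (Cmax-reach H C root (λ v → ≤-trans (≤-trans (m≤m+n (cnt C v) (cnt A₀ v)) (≤-reflexive (sym
                    (∑-++ C A₀ _)))) (simple st v)) (reach H sb))))

      -- If no half-edge at A is unmatched, then S₁ ≤ 2 m, so that q a - 4 s Y is at least q a and
      -- hence at least L.
      saturated-drift : (∀ v → v ∈ A → rem F v ≡ 0) → M₁ ≤ length A → Λ ≤ h F A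
      saturated-drift sat M≤ = begin
        L * L * q                    ≡⟨ *-comm (L * L) q ⟩
        q * (L * L)                  ≤⟨ *-monoʳ-≤ q (*-mono-≤ L≤ L≤) ⟩
        q * (z * z)                  ≤⟨ ≤-trans (m≤m+n (q * (z * z)) (4 * (L * L) * ∑ A sq)) (m≤m+n _ (γ *
            (2 * M₁ ∸ length A))) ⟩
        h F A                        ∎
        where
        open ≤-Reasoning
        z : ℕ
        z = drift (length F) (length A) (∑ A d)
        S₁≤ : ∑ A d ≤ 2 * length F
        S₁≤ = ≤-trans (∑-mono∈ A (λ v v∈ → m∸n≡0⇒m≤n (sat v v∈))) (≤-trans (∑A≤ (deg F)) (deg-length F))
        L≤ : L ≤ z
        L≤ = ≤-trans (*-monoʳ-≤ q M≤) (m+n≤o⇒m≤o∸n (q * length A) (+-monoʳ-≤ (q * length A)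
          (≤-trans (*-monoʳ-≤ (4 * s) S₁≤) (≤-reflexive (cert s (length F))))))
          where
          cert : ∀ s m → 4 * s * (2 * m) ≡ 8 * s * m
          cert = solve-∀

      five : (∀ u → ¬ (cnt A u ≡ 0 × d u ≤ 4)) → ∀ u → 5 ≤ d u + 5 * cnt A u
      five none u = by (cnt A u) refl (d u ≤? 4)
        where
        by : ∀ c → cnt A u ≡ c → Dec (d u ≤ 4) → 5 ≤ d u + 5 * c
        by zero    e (yes d≤4) = ⊥-elim (none u (e , d≤4))
        by zero    e (no  d≰4) = ≤-trans (≰⇒> d≰4) (m≤m+n (d u) (5 * 0))
        by (suc k) e _         = ≤-trans (≤-trans (m≤m+n 5 (5 * k)) (≤-reflexive (sym (*-suc 5 k)))) (m≤n+m
            (5 * suc k) (d u))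

      -- Otherwise all degrees outside A are at least 5, so 5 n ≤ s + 5 |A| ≤ 5 s / 4, which
      -- contradicts s ≤ 3 n.
      room : 4 * ∑ A sq ≤ q → ¬ (∀ u → ¬ (cnt A u ≡ 0 × d u ≤ 4))
      room small none = <⇒≱ 1≤s (≤-trans s≤3n (*-monoʳ-≤ 3 n≤0))
        where
        count : 5 * n ≤ s + 5 * length A
        count = begin
          5 * n                                  ≡⟨ trans (*-comm 5 n) (cong (_* 5) (sym (∑V-1 {n}))) ⟩
          ∑ (V {n}) (λ _ → 1) * 5                ≡⟨ ∑-*ʳ (V {n}) (λ _ → 1) 5 ⟨
          ∑ (V {n}) (λ _ → 5)                    ≤⟨ ∑-mono V (five none) ⟩
          ∑ V (λ u → d u + 5 * cnt A u)          ≡⟨ trans (∑-+ V d (λ u → 5 * cnt A u)) (cong (s +_) (trans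
              (∑-*ˡ V 5 (cnt A)) (cong (5 *_) (sym (length-cnt A))))) ⟩
          s + 5 * length A                       ∎
          where open ≤-Reasoning
        20a≤s : 20 * length A ≤ s
        20a≤s = ≤-trans (*-monoʳ-≤ 20 (length≤S₂ A)) (≤-trans (≤-reflexive (*-assoc 5 4 (∑ A sq)))
          (≤-trans (*-monoʳ-≤ 5 small) (≤-trans (*-monoˡ-≤ q (m≤m+n 5 15)) 20q≤s)))
        cert : ∀ n s a → 5 * n + (4 * (s + 5 * a) + (s + 5 * (3 * n))) ≡ 5 * 0 + (4 * (5 * n) + (20 * a + 5 * s))
        cert = solve-∀
        n≤0 : n ≤ 0
        n≤0 = *-cancelˡ-≤ 5 (≤-cert (+-mono-≤ (*-monoʳ-≤ 4 count) (+-mono-≤ 20a≤s (*-monoʳ-≤ 5 s≤3n))) (cert n s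
            (length A)))

      fresh-root : 4 * ∑ A sq ≤ q → ∃[ u ] (cnt A u ≡ 0 × d u ≤ 4)
      fresh-root small = by (¬∀⟶∃¬ n (λ u → ¬ (cnt A u ≡ 0 × d u ≤ 4)) (λ u → ¬? (decide u)) (room small))
        where
        decide : ∀ u → Dec (cnt A u ≡ 0 × d u ≤ 4)
        decide u = (cnt A u ≟ 0) ×-dec (d u ≤? 4)
        by : ∃[ u ] ¬ ¬ (cnt A u ≡ 0 × d u ≤ 4) → ∃[ u ] (cnt A u ≡ 0 × d u ≤ 4)
        by (u , ¬¬p) = u , decidable-stable (decide u) ¬¬p

    -- One step: drift and variance of the next neighbour of v.

    module Step {F C A₀} (st : State F C A₀) (small : 4 * ∑ (C ++ A₀) sq ≤ q) (young : length (C ++ A₀) < 2 * M₁)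
                {v} (v∈A : v ∈ C ++ A₀) (unsaturated : 1 ≤ rem F v) where

      A : List (Fin n)
      A = C ++ A₀

      new : Fin n → ℕ
      new w = 1 ∸ cnt A w

      -- Divided by 𝒩, `Nᵥ` is the law of the other end of a random unrevealed edge at v, and `Bᵥ`
      -- its part on bad graphs.
      Nᵥ Bᵥ : Fin n → ℕ
      Nᵥ w = ∑ 𝒢 (λ H → wt F H * fresh F H v w)
      Bᵥ w = ∑ 𝒢 (λ H → wt F H * 𝟙 (bad H) * fresh F H v w)

      𝒩 : ℕ
      𝒩 = N F * rem F v

      new+cnt : ∀ w → new w + cnt A w ≡ 1
      new+cnt w = m∸n+n≡m (simple st w)

      new≤1 : ∀ w → new w ≤ 1
      new≤1 w = m∸n≤m 1 (cnt A w)

      ∑Nᵥ : ∑ V Nᵥ ≡ 𝒩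
      ∑Nᵥ = begin
        ∑ V Nᵥ                                          ≡⟨ ∑-swap 𝒢 V (λ H w → wt F H * fresh F H v w) ⟨
        ∑ 𝒢 (λ H → ∑ V (λ w → wt F H * fresh F H v w))  ≡⟨ (∑-cong∈ 𝒢 λ H H∈ → trans (∑-*ˡ V (wt F H) (fresh F H v))
                                                             (wt-cong F H (λ e₁ e₂ → fresh-sum F H∈ e₁ e₂ v))) ⟩
        ∑ 𝒢 (λ H → wt F H * rem F v)                    ≡⟨ ∑-*ʳ 𝒢 (wt F) (rem F v) ⟩
        N F * rem F v                                   ∎
        where open ≡-Reasoning

      ∑Bᵥ : ∑ V Bᵥ ≡ Nbad F * rem F v
      ∑Bᵥ = begin
        ∑ V Bᵥ
          ≡⟨ ∑-swap 𝒢 V (λ H w → wt F H * 𝟙 (bad H) * fresh F H v w) ⟨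
        ∑ 𝒢 (λ H → ∑ V (λ w → wt F H * 𝟙 (bad H) * fresh F H v w))
          ≡⟨ (∑-cong∈ 𝒢 λ H H∈ → trans (∑-*ˡ V (wt F H * 𝟙 (bad H)) (fresh F H v)) (trans (*-assoc (wt F H) _ _)
               (trans (wt-cong F H (λ e₁ e₂ → cong (𝟙 (bad H) *_) (fresh-sum F H∈ e₁ e₂ v))) (sym (*-assoc
                   (wt F H) _ _))))) ⟩
        ∑ 𝒢 (λ H → wt F H * 𝟙 (bad H) * rem F v)
          ≡⟨ ∑-*ʳ 𝒢 (λ H → wt F H * 𝟙 (bad H)) (rem F v) ⟩
        Nbad F * rem F v ∎
        where open ≡-Reasoning

      Nᵥ≡ : ∀ {w} → adj F v w ≡ false → Nᵥ w ≡ N ((v , w) ∷ F)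
      Nᵥ≡ {w} e = trans (∑-cong 𝒢 (λ H → cong (wt F H *_) (fresh-≡ F H e))) (sym (N-∷ v w F))

      Bᵥ≡ : ∀ {w} → adj F v w ≡ false → Bᵥ w ≡ Nbad ((v , w) ∷ F)
      Bᵥ≡ {w} e = ∑-cong 𝒢 (λ H → trans (cong (wt F H * 𝟙 (bad H) *_) (fresh-≡ F H e))
        (trans (re (wt F H) (𝟙 (bad H)) (nb H v w)) (cong (_* 𝟙 (bad H)) (sym (wt-∷ v w F H)))))
        where
        re : ∀ a b c → a * b * c ≡ a * c * b
        re = solve-∀

      Bᵥ≤Nᵥ : ∀ w → Bᵥ w ≤ Nᵥ w
      Bᵥ≤Nᵥ w = ∑-mono 𝒢 (λ H → *-monoˡ-≤ (fresh F H v w)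
        (≤-trans (*-monoʳ-≤ (wt F H) (𝟙≤1 (bad H))) (≤-reflexive (*-identityʳ (wt F H)))))

      Nᵥ-old : ∀ {w} → adj F v w ≡ true → Nᵥ w ≡ 0
      Nᵥ-old {w} e = ∑-zero 𝒢 (λ H → trans (cong (wt F H *_) (fresh-0 F H e)) (*-zeroʳ (wt F H)))

      Nᵥ-loop : Nᵥ v ≡ 0
      Nᵥ-loop = trans (∑-cong∈ 𝒢 (λ H H∈ → trans (cong (wt F H *_) (fresh-0′ F H (adj-irrefl H∈ v))) (*-zeroʳ
          (wt F H)))) (∑-0 (𝒢 {n}))

      by-status : ∀ w → Nᵥ w ≡ 0 ⊎ (adj F v w ≡ false × v ≢ w)
      by-status w = go (adj F v w) refl (v ≟F w)
        where
        go : ∀ b → adj F v w ≡ b → Dec (v ≡ w) → Nᵥ w ≡ 0 ⊎ (adj F v w ≡ false × v ≢ w)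
        go true  e _          = inj₁ (Nᵥ-old e)
        go false e (yes refl) = inj₁ Nᵥ-loop
        go false e (no v≢w)   = inj₂ (e , v≢w)

      s≤s′+S₁ : s ≤ s′ F + ∑ A d
      s≤s′+S₁ = ≤-trans (∑-mono V pt) (≤-reflexive (trans (∑-+ V (rem F) (λ w → cnt A w * d w)) (cong (s′ F +_)
          (sym (∑-cnt A d)))))
        where
        pt : ∀ w → d w ≤ rem F w + cnt A w * d w
        pt w with cnt A w in e
        ... | zero  = ≤-trans (≤-reflexive (sym (rem-untouched F (untouched st w e)))) (m≤m+n _ 0)
        ... | suc k = ≤-trans (m≤m+n (d w) (k * d w)) (m≤n+m _ (rem F w))

      -- The half-edges at A number at most S₁ ≤ S₂ ≤ q / 4, so s′ is close to s; Δ² ≤ q / 25 and q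
      -- ≤ s / 20 absorb the rest.
      big : s + 2 * E₀ + 8 ≤ 2 * s′ F
      big = ≤-cert⁺ (17 * (Δ * Δ) + 2 * ∑ A sq + 10 * q)
        (+-mono-≤ (*-monoʳ-≤ 2 s≤s′+S₁) (+-mono-≤ (*-monoʳ-≤ 2 E₀≤4Δ²) (+-mono-≤ 25Δ²≤q (+-mono-≤ (*-monoʳ-≤ 8 1≤q)
          (+-mono-≤ small (+-mono-≤ (*-monoʳ-≤ 2 (S₁≤S₂ A)) 20q≤s))))))
        (cert s E₀ (Δ * Δ) (s′ F) (∑ A d) (∑ A sq) q)
        where
        cert : ∀ s e δ t a b q → s + 2 * e + 8 + (17 * δ + 2 * b + 10 * q) +
          (2 * (t + a) + (2 * (4 * δ) + (q + (8 * q + (q + (2 * b + s)))))) ≡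
          2 * t + (2 * s + (2 * e + (25 * δ + (8 * 1 + (4 * b + (2 * a + 20 * q))))))
        cert = solve-∀

      -- The next neighbour is w with probability at most 2 d w / s, which is enough for all
      -- second-order terms.
      crude : ∀ w → Nᵥ w * s ≤ 2 * 𝒩 * d w
      crude w with by-status w
      ... | inj₁ e = ≤-trans (≤-reflexive (cong (_* s) e)) z≤n
      ... | inj₂ (e , v≢w) = begin
        Nᵥ w * s                             ≡⟨ cong (_* s) (Nᵥ≡ e) ⟩
        N ((v , w) ∷ F) * s                  ≤⟨ upper′ F (≤-trans (m≤m+n _ 8) big) v≢w e ⟩
        2 * (N F * (rem F v * rem F w))      ≤⟨ *-monoʳ-≤ 2 (*-monoʳ-≤ (N F) (*-monoʳ-≤ (rem F v) (m∸n≤m (d w)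
            (deg F w)))) ⟩
        2 * (N F * (rem F v * d w))          ≡⟨ re (N F) (rem F v) (d w) ⟩
        2 * 𝒩 * d w                          ∎
        where
        open ≤-Reasoning
        re : ∀ a b c → 2 * (a * (b * c)) ≡ 2 * (a * b) * c
        re = solve-∀

      -- Relative to 𝒩: the probability that the next neighbour is new, and the means of its degree
      -- and squared degree, counted as 0 if it is old. This `Y` is not the number of unmatched
      -- half-edges.
      Y X Z : ℕ
      Y = ∑ V (λ w → Nᵥ w * new w)
      X = ∑ V (λ w → Nᵥ w * (new w * d w))
      Z = ∑ V (λ w → Nᵥ w * (new w * sq w))

      -- By `crude` an explored vertex is hit with probability at most 2 S₁ / s, which is below 1 /
      -- 2. Costs arise at every edge but are paid at new vertices, so a fixed share of new ones is
      -- required.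
      mostly-new : 𝒩 ≤ 2 * Y
      mostly-new = ≤-cert (+-mono-≤ (≤-reflexive 𝒩≡) 2O≤𝒩) (cert 𝒩 Y O)
        where
        O : ℕ
        O = ∑ V (λ w → Nᵥ w * cnt A w)
        𝒩≡ : 2 * 𝒩 ≡ 2 * (Y + O)
        𝒩≡ = cong (2 *_) (trans (sym ∑Nᵥ) (trans (∑-cong V (λ w → trans (sym (*-identityʳ (Nᵥ w))) (trans (cong
            (Nᵥ w *_) (sym (new+cnt w))) (*-distribˡ-+ (Nᵥ w) (new w) (cnt A w)))))
          (∑-+ V (λ w → Nᵥ w * new w) (λ w → Nᵥ w * cnt A w))))
        O-bound : O * s ≤ 2 * 𝒩 * ∑ A d
        O-bound = begin
          O * s                                        ≡⟨ ∑-*ʳ V (λ w → Nᵥ w * cnt A w) s ⟨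
          ∑ V (λ w → Nᵥ w * cnt A w * s)               ≤⟨ ∑-mono V (λ w → ≤-trans (≤-reflexive (re (Nᵥ w)
              (cnt A w) s))
                                                            (≤-trans (*-monoˡ-≤ (cnt A w) (crude w)) (≤-reflexive
                                                                (re′ (2 * 𝒩) (d w) (cnt A w))))) ⟩
          ∑ V (λ w → 2 * 𝒩 * (cnt A w * d w))          ≡⟨ trans (∑-*ˡ V (2 * 𝒩) (λ w → cnt A w * d w)) (cong
              (2 * 𝒩 *_) (sym (∑-cnt A d))) ⟩
          2 * 𝒩 * ∑ A d                                ∎
          where
          open ≤-Reasoning
          re : ∀ a b c → a * b * c ≡ a * c * b
          re = solve-∀
          re′ : ∀ a b c → a * b * c ≡ a * (c * b)
          re′ = solve-∀
        2O≤𝒩 : 2 * O ≤ 𝒩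
        2O≤𝒩 = *-cancelʳ-≤ (2 * O) 𝒩 s {{>-nonZero 1≤s}} (begin
          2 * O * s              ≡⟨ *-assoc 2 O s ⟩
          2 * (O * s)            ≤⟨ *-monoʳ-≤ 2 O-bound ⟩
          2 * (2 * 𝒩 * ∑ A d)    ≤⟨ *-monoʳ-≤ 2 (*-monoʳ-≤ (2 * 𝒩) (S₁≤S₂ A)) ⟩
          2 * (2 * 𝒩 * ∑ A sq)   ≡⟨ re 𝒩 (∑ A sq) ⟩
          𝒩 * (4 * ∑ A sq)       ≤⟨ *-monoʳ-≤ 𝒩 (≤-trans small (≤-trans (m≤m+n q (19 * q)) 20q≤s)) ⟩
          𝒩 * s                  ∎)
          where
          open ≤-Reasoning
          re : ∀ a b → 2 * (2 * a * b) ≡ a * (4 * b)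
          re = solve-∀
        cert : ∀ n y o → n + (2 * (y + o) + n) ≡ 2 * y + (2 * n + 2 * o)
        cert = solve-∀

      -- The weights 2 d w / s turn the second moment into the third, and 34 = 2 · 17.
      Z-bound : Z ≤ 34 * r * 𝒩
      Z-bound = *-cancelʳ-≤ Z (34 * r * 𝒩) s {{>-nonZero 1≤s}} (begin
        Z * s
          ≡⟨ ∑-*ʳ V (λ w → Nᵥ w * (new w * sq w)) s ⟨
        ∑ V (λ w → Nᵥ w * (new w * sq w) * s)
          ≤⟨ ∑-mono V pt ⟩
        ∑ V (λ w → 2 * 𝒩 * (d w * d w * d w))
          ≡⟨ ∑-*ˡ V (2 * 𝒩) (λ w → d w * d w * d w) ⟩
        2 * 𝒩 * ∑ V (λ w → d w * d w * d w)
          ≤⟨ *-monoʳ-≤ (2 * 𝒩) ∑d³ ⟩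
        2 * 𝒩 * (17 * (r * s))
          ≡⟨ re 𝒩 r s ⟩
        34 * r * 𝒩 * s ∎)
        where
        open ≤-Reasoning
        re : ∀ n r s → 2 * n * (17 * (r * s)) ≡ 34 * r * n * s
        re = solve-∀
        re₁ : ∀ a b c → a * (1 * b) * c ≡ a * c * b
        re₁ = solve-∀
        re₂ : ∀ a b → 2 * a * b * (b * b) ≡ 2 * a * (b * b * b)
        re₂ = solve-∀
        pt : ∀ w → Nᵥ w * (new w * sq w) * s ≤ 2 * 𝒩 * (d w * d w * d w)
        pt w = begin
          Nᵥ w * (new w * sq w) * s     ≤⟨ *-monoˡ-≤ s (*-monoʳ-≤ (Nᵥ w) (*-monoˡ-≤ (sq w) (new≤1 w))) ⟩
          Nᵥ w * (1 * sq w) * s         ≡⟨ re₁ (Nᵥ w) (sq w) s ⟩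
          Nᵥ w * s * sq w               ≤⟨ *-monoˡ-≤ (sq w) (crude w) ⟩
          2 * 𝒩 * d w * sq w            ≡⟨ re₂ 𝒩 (d w) ⟩
          2 * 𝒩 * (d w * d w * d w)     ∎

      -- A new neighbour brings in the mean at least 2 + q / (4 s) half-edges: two replace those
      -- matched by the edge, the rest is drift. Unexplored vertices are untouched, so `lower`
      -- applies to them, and their squared degrees sum to at least 2 s + 3 q / 4.
      growth : (8 * s + q) * 𝒩 ≤ 4 * s * X
      growth = *-cancelʳ-≤ ((8 * s + q) * 𝒩) (4 * s * X) (s + Δ * Δ) {{>-nonZero (≤-trans 1≤s (m≤m+n s (Δ * Δ)))}}
          (begin
        (8 * s + q) * 𝒩 * (s + Δ * Δ)         ≡⟨ re₁ (8 * s + q) 𝒩 (s + Δ * Δ) ⟩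
        𝒩 * ((8 * s + q) * (s + Δ * Δ))       ≤⟨ *-monoʳ-≤ 𝒩 (drift-constants {δ = Δ * Δ} E₀≤4Δ² 25Δ²≤q 20q≤s) ⟩
        𝒩 * ((8 * s + 3 * q) * (s ∸ E₀))      ≤⟨ *-monoʳ-≤ 𝒩 (*-monoˡ-≤ (s ∸ E₀) Q-bound) ⟩
        𝒩 * (4 * Q₂ * (s ∸ E₀))               ≤⟨ +-cancelʳ-≤ (4 * (𝒩 * Q₂ * E₀)) _ _ summed′ ⟩
        4 * (X * ((s + Δ * Δ) * s))           ≡⟨ re₂ X (s + Δ * Δ) s ⟩
        4 * s * X * (s + Δ * Δ)               ∎)
        where
        open ≤-Reasoning
        Q₂ : ℕ
        Q₂ = ∑ V (λ w → new w * sq w)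
        re₁ : ∀ a b c → a * b * c ≡ b * (a * c)
        re₁ = solve-∀
        re₂ : ∀ a b c → 4 * (a * (b * c)) ≡ 4 * c * a * b
        re₂ = solve-∀
        Q₂+S₂ : Q₂ + ∑ A sq ≡ 2 * s + q
        Q₂+S₂ = trans (cong (Q₂ +_) (∑-cnt A sq)) (trans (sym (∑-+ V (λ w → new w * sq w) (λ w → cnt A w * sq w)))
          (trans (∑-cong V (λ w → trans (sym (*-distribʳ-+ (sq w) (new w) (cnt A w))) (trans (cong (_* sq w)
              (new+cnt w)) (*-identityˡ (sq w))))) ∑d²))
        Q-bound : 8 * s + 3 * q ≤ 4 * Q₂
        Q-bound = ≤-cert (+-mono-≤ small (*-monoʳ-≤ 4 (≤-reflexive (sym Q₂+S₂)))) (cert s q Q₂ (∑ A sq))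
          where
          cert : ∀ s q Q S → 8 * s + 3 * q + (q + 4 * (Q + S)) ≡ 4 * Q + (4 * S + 4 * (2 * s + q))
          cert = solve-∀
        pt : ∀ w → 𝒩 * s * (new w * sq w) ≤ Nᵥ w * (new w * d w) * ((s + Δ * Δ) * s) + 𝒩 * E₀ * (new w * sq w)
        pt w with cnt A w in e
        ... | suc k rewrite 0∸n≡0 k = ≤-trans (≤-reflexive (*-zeroʳ (𝒩 * s))) z≤n
        ... | zero  = begin
          𝒩 * s * (1 * sq w)
            ≡⟨ cert₁ (N F) (rem F v) s (d w) ⟩
          N F * (rem F v * d w) * s * d w
            ≤⟨ *-monoˡ-≤ (d w) (Lower.lower F big v≢w (untouched st w e)) ⟩
          (N ((v , w) ∷ F) * ((s + Δ * Δ) * s) + N F * (rem F v * d w) * E₀) * d w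
            ≡⟨ cong (λ x → (x * ((s + Δ * Δ) * s) + N F * (rem F v * d w) * E₀) * d w) (sym (Nᵥ≡ (trans
                (adj-sym F v w) (untouched st w e v)))) ⟩
          (Nᵥ w * ((s + Δ * Δ) * s) + N F * (rem F v * d w) * E₀) * d w
            ≡⟨ cert₂ (N F) (rem F v) E₀ (d w) (Nᵥ w) ((s + Δ * Δ) * s) ⟩
          Nᵥ w * (1 * d w) * ((s + Δ * Δ) * s) + 𝒩 * E₀ * (1 * sq w) ∎
          where
          v≢w : v ≢ w
          v≢w refl = <⇒≱ (∈-cnt {A = A} v∈A) (≤-reflexive e)
          cert₁ : ∀ m r s x → m * r * s * (1 * (x * x)) ≡ m * (r * x) * s * x
          cert₁ = solve-∀
          cert₂ : ∀ m r e x k l → (k * l + m * (r * x) * e) * x ≡ k * (1 * x) * l + m * r * e * (1 * (x * x))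
          cert₂ = solve-∀
        summed : 𝒩 * s * Q₂ ≤ X * ((s + Δ * Δ) * s) + 𝒩 * E₀ * Q₂
        summed = begin
          𝒩 * s * Q₂                                   ≡⟨ ∑-*ˡ V (𝒩 * s) (λ w → new w * sq w) ⟨
          ∑ V (λ w → 𝒩 * s * (new w * sq w))           ≤⟨ ∑-mono V pt ⟩
          ∑ V (λ w → Nᵥ w * (new w * d w) * ((s + Δ * Δ) * s) + 𝒩 * E₀ * (new w * sq w))
            ≡⟨ trans (∑-+ V (λ w → Nᵥ w * (new w * d w) * ((s + Δ * Δ) * s)) _) (cong₂ _+_ (∑-*ʳ V (λ w → Nᵥ w *
                (new w * d w)) ((s + Δ * Δ) * s)) (∑-*ˡ V (𝒩 * E₀) (λ w → new w * sq w))) ⟩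
          X * ((s + Δ * Δ) * s) + 𝒩 * E₀ * Q₂          ∎
        E₀≤s : E₀ ≤ s
        E₀≤s = ≤-trans E₀≤4Δ² (≤-trans (*-monoˡ-≤ (Δ * Δ) (m≤m+n 4 21)) (≤-trans 25Δ²≤q (≤-trans (m≤m+n q
            (19 * q)) 20q≤s)))
        summed′ : 𝒩 * (4 * Q₂ * (s ∸ E₀)) + 4 * (𝒩 * Q₂ * E₀) ≤ 4 * (X * ((s + Δ * Δ) * s)) + 4 * (𝒩 * Q₂ * E₀)
        summed′ = begin
          𝒩 * (4 * Q₂ * (s ∸ E₀)) + 4 * (𝒩 * Q₂ * E₀)      ≡⟨ cert₁ 𝒩 Q₂ (s ∸ E₀) E₀ ⟩
          4 * (𝒩 * (s ∸ E₀ + E₀) * Q₂)                     ≡⟨ cong (λ x → 4 * (𝒩 * x * Q₂)) (m∸n+n≡m E₀≤s) ⟩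
          4 * (𝒩 * s * Q₂)                                 ≤⟨ *-monoʳ-≤ 4 summed ⟩
          4 * (X * ((s + Δ * Δ) * s) + 𝒩 * E₀ * Q₂)        ≡⟨ cert₂ (X * ((s + Δ * Δ) * s)) 𝒩 E₀ Q₂ ⟩
          4 * (X * ((s + Δ * Δ) * s)) + 4 * (𝒩 * Q₂ * E₀)  ∎
          where
          cert₁ : ∀ n a t e → n * (4 * a * t) + 4 * (n * a * e) ≡ 4 * (n * (t + e) * a)
          cert₁ = solve-∀
          cert₂ : ∀ x n e a → 4 * (x + n * e * a) ≡ 4 * x + 4 * (n * a * e)
          cert₂ = solve-∀

      z : ℕ
      z = drift (length F) (length A) (∑ A d)

      -- The step to w changes q a - 4 s Y by `gain w` minus `loss w`; `cost` collects the
      -- second-order terms and the growth of the second term of `h`.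
      gain loss cost : Fin n → ℕ
      gain w = q * new w + 8 * s
      loss w = 4 * s * (d w * new w)
      cost w = q * (gain w * gain w + loss w * loss w) + 4 * (L * L) * (new w * sq w)

      q≤s : q ≤ s
      q≤s = ≤-trans (m≤m+n q (19 * q)) 20q≤s

      qnew≤q : ∀ w → q * new w ≤ q
      qnew≤q w = ≤-trans (*-monoʳ-≤ q (new≤1 w)) (≤-reflexive (*-identityʳ q))

      -- Origin of 1250: by `mostly-new` and `Z-bound` the coefficient of r s² q is 2 · 81 + 2 · 16
      -- · 34. That of r L² is only 272, which leaves 978.
      cost-bound : ∑ V (λ w → Nᵥ w * cost w) ≤ γ * Y
      cost-bound = begin
        ∑ V (λ w → Nᵥ w * cost w)
          ≤⟨ ∑-mono V pt ⟩
        ∑ V (λ w → a * Nᵥ w + b * (Nᵥ w * (new w * sq w)))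
          ≡⟨ trans (∑-+ V (λ w → a * Nᵥ w) _) (cong₂ _+_ (trans (∑-*ˡ V a Nᵥ) (cong (a *_) ∑Nᵥ)) (∑-*ˡ V b
              (λ w → Nᵥ w * (new w * sq w)))) ⟩
        a * 𝒩 + b * Z
          ≤⟨ +-mono-≤ (*-monoʳ-≤ a mostly-new) (*-monoʳ-≤ b (≤-trans Z-bound (*-monoʳ-≤ (34 * r) mostly-new))) ⟩
        a * (2 * Y) + b * (34 * r * (2 * Y))
          ≤⟨ +-monoˡ-≤ _ (≤-trans (≤-reflexive (sym (*-identityˡ (a * (2 * Y))))) (*-monoˡ-≤ (a * (2 * Y)) 1≤r)) ⟩
        r * (a * (2 * Y)) + b * (34 * r * (2 * Y))
          ≤⟨ ≤-slack (978 * (r * (L * L) * Y)) (cert r q s (L * L) Y) ⟩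
        γ * Y ∎
        where
        open ≤-Reasoning
        a b : ℕ
        a = 81 * (q * (s * s))
        b = 16 * (s * s) * q + 4 * (L * L)
        cert : ∀ r q s l y → r * (81 * (q * (s * s)) * (2 * y)) + (16 * (s * s) * q + 4 * l) * (34 * r *
            (2 * y)) + 978 * (r * l * y) ≡
          1250 * (r * (s * s * q + l)) * y
        cert = solve-∀
        P≤ : ∀ w → gain w ≤ 9 * s
        P≤ w = +-monoˡ-≤ (8 * s) (≤-trans (qnew≤q w) q≤s)
        pt : ∀ w → Nᵥ w * cost w ≤ a * Nᵥ w + b * (Nᵥ w * (new w * sq w))
        pt w = ≤-trans (*-monoʳ-≤ (Nᵥ w) (+-monoˡ-≤ (4 * (L * L) * (new w * sq w)) (*-monoʳ-≤ q (+-mono-≤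
            (*-mono-≤ (P≤ w) (P≤ w)) T²))))
          (≤-reflexive (cert′ (Nᵥ w) q s (L * L) (new w * sq w)))
          where
          re : ∀ s x ν → 4 * s * (x * ν) * (4 * s * (x * ν)) ≡ 16 * (s * s) * (ν * (ν * (x * x)))
          re = solve-∀
          T² : loss w * loss w ≤ 16 * (s * s) * (1 * (new w * sq w))
          T² = ≤-trans (≤-reflexive (re s (d w) (new w))) (*-monoʳ-≤ (16 * (s * s)) (*-monoˡ-≤ (new w * sq w)
              (new≤1 w)))
          cert′ : ∀ m q s l x → m * (q * (9 * s * (9 * s) + 16 * (s * s) * (1 * x)) + 4 * l * x) ≡
            81 * (q * (s * s)) * m + (16 * (s * s) * q + 4 * l) * (m * x)
          cert′ = solve-∀

      -- `growth` makes the first-order change nonpositive even if q is charged for old neighbours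
      -- too.
      drift-bound : ∑ V (λ w → Nᵥ w * gain w) ≤ ∑ V (λ w → Nᵥ w * loss w)
      drift-bound = begin
        ∑ V (λ w → Nᵥ w * gain w)          ≤⟨ ∑-mono V (λ w → ≤-trans (*-monoʳ-≤ (Nᵥ w) (≤-trans (+-monoˡ-≤
            (8 * s) (qnew≤q w)) (≤-reflexive (+-comm q (8 * s))))) (≤-reflexive (*-comm (Nᵥ w) _))) ⟩
        ∑ V (λ w → (8 * s + q) * Nᵥ w)  ≡⟨ trans (∑-*ˡ V (8 * s + q) Nᵥ) (cong ((8 * s + q) *_) ∑Nᵥ) ⟩
        (8 * s + q) * 𝒩                 ≤⟨ growth ⟩
        4 * s * X                       ≡⟨ ∑-*ˡ V (4 * s) (λ w → Nᵥ w * (new w * d w)) ⟨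
        ∑ V (λ w → 4 * s * (Nᵥ w * (new w * d w)))  ≡⟨ ∑-cong V (λ w → re s (Nᵥ w) (new w) (d w)) ⟩
        ∑ V (λ w → Nᵥ w * loss w)          ∎
        where
        open ≤-Reasoning
        re : ∀ s m ν x → 4 * s * (m * (ν * x)) ≡ m * (4 * s * (x * ν))
        re = solve-∀

      -- The potential after the step in one formula, with ν = 1 for a new neighbour and ν = 0 for
      -- an old one.
      after-at : ℕ → Fin n → ℕ
      after-at ν w = q * (z⁺ * z⁺) + 4 * (L * L) * (ν * sq w + ∑ A sq) + γ * (2 * M₁ ∸ (ν + length A))
        where
        z⁺ : ℕ
        z⁺ = (q * length A + 8 * s * length F + (q * ν + 8 * s)) ∸ (4 * s * ∑ A d + 4 * s * (d w * ν))

      z⁺ after : Fin n → ℕ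
      z⁺ w = (q * length A + 8 * s * length F + gain w) ∸ (4 * s * ∑ A d + loss w)
      after w = after-at (new w) w

      after-bound : ∀ w → after w + 2 * (q * (z * loss w)) + γ * new w ≤ h F A + 2 * (q * (z * gain w)) + cost w
      after-bound w = ≤-cert
        (+-mono-≤ (*-monoʳ-≤ q (positive-part-square (q * length A + 8 * s * length F) (4 * s * ∑ A d) (gain w)
            (loss w)))
                  (≤-reflexive (trans (sym (*-distribˡ-+ γ (2 * M₁ ∸ (new w + length A)) (new w))) (cong
                      (γ *_) time))))
        (cert q (z⁺ w) (L * L) (new w * sq w) (∑ A sq) (γ * (2 * M₁ ∸ (new w + length A))) (z * loss w)
            (γ * new w) z (z * gain w) (gain w * gain w + loss w * loss w) (γ * (2 * M₁ ∸ length A)))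
        where
        -- By `young` the clock 2 M₁ - a is still positive, so nothing is truncated.
        time : 2 * M₁ ∸ (new w + length A) + new w ≡ 2 * M₁ ∸ length A
        time = trans (cong (_+ new w) (trans (cong (2 * M₁ ∸_) (+-comm (new w) (length A))) (sym (∸-+-assoc
            (2 * M₁) (length A) (new w)))))
          (m∸n+n≡m (≤-trans (new≤1 w) (m<n⇒0<n∸m young)))
        cert : ∀ q z⁺ l x S g t ν z p c g₀ →
          q * (z⁺ * z⁺) + 4 * l * (x + S) + g + 2 * (q * t) + ν + (q * (z * z + 2 * p + c) + g₀) ≡
          q * (z * z) + 4 * l * S + g₀ + 2 * (q * p) + (q * c + 4 * l * x) + (q * (z⁺ * z⁺ + 2 * t) + (g + ν))
        cert = solve-∀

      potential : ℕ → ℕ → ℕ → ℕ → ℕ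
      potential x y S t = q * ((x ∸ y) * (x ∸ y)) + 4 * (L * L) * S + γ * (2 * M₁ ∸ t)

      after-new : ∀ w → cnt A w ≡ 0 → h ((v , w) ∷ F) (w ∷ A) ≡ after w
      after-new w e = trans
        (trans (cong₂ (λ x y → potential x y (sq w + ∑ A sq) (suc (length A))) (re₁ q (length A) s (length F))
            (re₂ s (d w) (∑ A d)))
          (cong (λ S → potential (q * length A + 8 * s * length F + (q * 1 + 8 * s)) (4 * s * ∑ A d + 4 * s *
              (d w * 1)) (S + ∑ A sq) (suc (length A)))
            (sym (*-identityˡ (sq w)))))
        (cong (λ ν → after-at ν w) (sym (cong (1 ∸_) e)))
        where
        re₁ : ∀ q a s m → q * suc a + 8 * s * suc m ≡ q * a + 8 * s * m + (q * 1 + 8 * s)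
        re₁ = solve-∀
        re₂ : ∀ s x S → 4 * s * (x + S) ≡ 4 * s * S + 4 * s * (x * 1)
        re₂ = solve-∀

      after-old : ∀ w → 1 ≤ cnt A w → h ((v , w) ∷ F) A ≡ after w
      after-old w 1≤c = trans
        (cong₂ (λ x y → potential x y (∑ A sq) (length A)) (re₁ q (length A) s (length F)) (re₂ s (d w) (∑ A d)))
        (cong (λ ν → after-at ν w) (sym (m≤n⇒m∸n≡0 1≤c)))
        where
        re₁ : ∀ q a s m → q * a + 8 * s * suc m ≡ q * a + 8 * s * m + (q * 0 + 8 * s)
        re₁ = solve-∀
        re₂ : ∀ s x S → 4 * s * S ≡ 4 * s * S + 4 * s * (x * 0)
        re₂ = solve-∀

      -- The induction hypotheses are summed over all next neighbours. First-order terms go by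
      -- `drift-bound`, `cost` is paid by γ for each new vertex, and the common factor `rem F v`
      -- cancels.
      supermartingale :
        (∀ w → adj F v w ≡ false → cnt A w ≡ 0 → Nbad ((v , w) ∷ F) * Λ ≤ N ((v , w) ∷ F) * h ((v , w) ∷ F) (w ∷ A)) →
        (∀ w → adj F v w ≡ false → 1 ≤ cnt A w → Nbad ((v , w) ∷ F) * Λ ≤ N ((v , w) ∷ F) * h ((v , w) ∷ F) A) →
        Nbad F * Λ ≤ N F * h F A
      supermartingale ih-new ih-old = *-cancelʳ-≤ (Nbad F * Λ) (N F * h F A) (rem F v) {{>-nonZero unsaturated}}
        (≤-cert (+-mono-≤ (*-monoʳ-≤ (2 * (q * z)) drift-bound) (+-mono-≤ cost-bound summed))
          (cert (Nbad F) Λ (rem F v) (N F) (h F A) (2 * (q * z)) (∑ V (λ w → Nᵥ w * gain w)) (∑ V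
              (λ w → Nᵥ w * loss w)) (∑ V (λ w → Nᵥ w * cost w)) (γ * Y)))
        where
        cert : ∀ b l ρ m h c p t k g → b * l * ρ + (c * t + (g + (h * (m * ρ) + c * p + k))) ≡
          m * h * ρ + (c * p + (k + (l * (b * ρ) + c * t + g)))
        cert = solve-∀
        ih : ∀ w → adj F v w ≡ false → Nbad ((v , w) ∷ F) * Λ ≤ N ((v , w) ∷ F) * after w
        ih w e = by (cnt A w) refl
          where
          by : ∀ c → cnt A w ≡ c → Nbad ((v , w) ∷ F) * Λ ≤ N ((v , w) ∷ F) * after w
          by zero    c = subst (λ x → Nbad ((v , w) ∷ F) * Λ ≤ N ((v , w) ∷ F) * x) (after-new w c) (ih-new w e c)
          by (suc k) c = subst (λ x → Nbad ((v , w) ∷ F) * Λ ≤ N ((v , w) ∷ F) * x) (after-old w 1≤c) (ih-old w e 1≤c)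
            where
            1≤c : 1 ≤ cnt A w
            1≤c = subst (1 ≤_) (sym c) (s≤s z≤n)
        pt : ∀ w → Λ * Bᵥ w + 2 * (q * z) * (Nᵥ w * loss w) + γ * (Nᵥ w * new w) ≤
          h F A * Nᵥ w + 2 * (q * z) * (Nᵥ w * gain w) + Nᵥ w * cost w
        pt w = by (by-status w)
          where
          vanish : ∀ a b c → a * 0 + b * 0 + c * 0 ≡ 0
          vanish = solve-∀
          cert′ : ∀ b l m h q z p t a g ν k →
            l * b + 2 * (q * z) * (m * t) + g * (m * ν) + (m * a + m * (h + 2 * (q * (z * p)) + k)) ≡
            h * m + 2 * (q * z) * (m * p) + m * k + (b * l + m * (a + 2 * (q * (z * t)) + g * ν))
          cert′ = solve-∀
          by : Nᵥ w ≡ 0 ⊎ (adj F v w ≡ false × v ≢ w) → Λ * Bᵥ w + 2 * (q * z) * (Nᵥ w * loss w) + γ *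
              (Nᵥ w * new w) ≤
            h F A * Nᵥ w + 2 * (q * z) * (Nᵥ w * gain w) + Nᵥ w * cost w
          by (inj₁ e) = ≤-trans (≤-reflexive (trans (cong₂ (λ b m → Λ * b + 2 * (q * z) * (m * loss w) + γ *
              (m * new w))
                         (n≤0⇒n≡0 (≤-trans (Bᵥ≤Nᵥ w) (≤-reflexive e))) e) (vanish Λ (2 * (q * z)) γ))) z≤n
          by (inj₂ (e , _)) = ≤-cert
            (+-mono-≤ (≤-trans (≤-reflexive (cong (_* Λ) (Bᵥ≡ e))) (≤-trans (ih w e) (≤-reflexive (cong
                (_* after w) (sym (Nᵥ≡ e))))))
                      (*-monoʳ-≤ (Nᵥ w) (after-bound w)))
            (cert′ (Bᵥ w) Λ (Nᵥ w) (h F A) q z (gain w) (loss w) (after w) γ (new w) (cost w))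
        ∑₃ : ∀ a b c (f g k : Fin n → ℕ) → ∑ V (λ w → a * f w + b * g w + c * k w) ≡ a * ∑ V f + b * ∑ V g + c * ∑ V k
        ∑₃ a b c f g k = trans (∑-+ V (λ w → a * f w + b * g w) (λ w → c * k w))
          (cong₂ _+_ (trans (∑-+ V (λ w → a * f w) (λ w → b * g w)) (cong₂ _+_ (∑-*ˡ V a f) (∑-*ˡ V b g)))
              (∑-*ˡ V c k))
        summed : Λ * (Nbad F * rem F v) + 2 * (q * z) * ∑ V (λ w → Nᵥ w * loss w) + γ * Y ≤
          h F A * (N F * rem F v) + 2 * (q * z) * ∑ V (λ w → Nᵥ w * gain w) + ∑ V (λ w → Nᵥ w * cost w)
        summed = begin
          Λ * (Nbad F * rem F v) + 2 * (q * z) * ∑ V (λ w → Nᵥ w * loss w) + γ * Y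
            ≡⟨ cong (λ x → Λ * x + 2 * (q * z) * ∑ V (λ w → Nᵥ w * loss w) + γ * Y) ∑Bᵥ ⟨
          Λ * ∑ V Bᵥ + 2 * (q * z) * ∑ V (λ w → Nᵥ w * loss w) + γ * Y
            ≡⟨ ∑₃ Λ (2 * (q * z)) γ Bᵥ (λ w → Nᵥ w * loss w) (λ w → Nᵥ w * new w) ⟨
          ∑ V (λ w → Λ * Bᵥ w + 2 * (q * z) * (Nᵥ w * loss w) + γ * (Nᵥ w * new w))
            ≤⟨ ∑-mono V pt ⟩
          ∑ V (λ w → h F A * Nᵥ w + 2 * (q * z) * (Nᵥ w * gain w) + Nᵥ w * cost w)
            ≡⟨ ∑-cong V (λ w → cong (h F A * Nᵥ w + 2 * (q * z) * (Nᵥ w * gain w) +_) (sym (*-identityˡ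
                (Nᵥ w * cost w)))) ⟩
          ∑ V (λ w → h F A * Nᵥ w + 2 * (q * z) * (Nᵥ w * gain w) + 1 * (Nᵥ w * cost w))
            ≡⟨ ∑₃ (h F A) (2 * (q * z)) 1 Nᵥ (λ w → Nᵥ w * gain w) (λ w → Nᵥ w * cost w) ⟩
          h F A * ∑ V Nᵥ + 2 * (q * z) * ∑ V (λ w → Nᵥ w * gain w) + 1 * ∑ V (λ w → Nᵥ w * cost w)
            ≡⟨ cong₂ (λ x y → h F A * x + 2 * (q * z) * ∑ V (λ w → Nᵥ w * gain w) + y) ∑Nᵥ (*-identityˡ _) ⟩
          h F A * (N F * rem F v) + 2 * (q * z) * ∑ V (λ w → Nᵥ w * gain w) + ∑ V (λ w → Nᵥ w * cost w) ∎
          where open ≤-Reasoning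

    module _ {F C A₀} (st : State F C A₀) where
      private
        A : List (Fin n)
        A = C ++ A₀

      cnt-new : ∀ w → cnt A w ≡ 0 → ∀ x → cnt (w ∷ A) x ≤ 1
      cnt-new w e x with w =F x in wx
      ... | false = simple st x
      ... | true with =F-sound wx
      ...   | refl = s≤s (≤-reflexive e)

      off-edge : ∀ {v w x} → 1 ≤ cnt A v → x ≢ w → cnt A x ≡ 0 → ∀ y → adj ((v , w) ∷ F) x y ≡ false
      off-edge {v} {w} {x} v∈ x≢w e y = cong₂ _∨_
        (¬match (λ p → <⇒≱ v∈ (≤-reflexive (trans (cong (cnt A) (proj₁ p)) e))) (λ p → x≢w (sym (proj₂ p))))
            (untouched st x e y)

      closed-∷ : ∀ v w x → x ∈ A₀ → rem ((v , w) ∷ F) x ≡ 0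
      closed-∷ v w x x∈ = n≤0⇒n≡0 (≤-trans (proj₁ (rem-∷ v w F x)) (≤-reflexive (closed st x x∈)))

      add-old : ∀ {v w} → 1 ≤ cnt A v → 1 ≤ cnt A w → State ((v , w) ∷ F) C A₀
      add-old {v} {w} v∈ w∈ = record
        { simple    = simple st
        ; untouched = λ x e → off-edge v∈ (λ { refl → <⇒≱ w∈ (≤-reflexive e) }) e
        ; closed    = closed-∷ v w
        ; recent    = recent st
        ; connected = by (connected st)
        }
        where
        by : _ → _
        by (inj₁ e) = inj₁ e
        by (inj₂ (root , reach)) = inj₂ (root , λ H sb → reach H (∧-trueʳ {adj H v w} sb))

      add-new : ∀ {v w} → v ∈ C → cnt A w ≡ 0 → State ((v , w) ∷ F) (w ∷ C) A₀
      add-new {v} {w} v∈C e = record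
        { simple    = cnt-new w e
        ; untouched = λ x ex → off-edge {v} {w} (∈-cnt (∈-++⁺ˡ v∈C)) (x≢w x ex) (m+n≡0⇒n≡0 (𝟙 (w =F x)) ex)
        ; closed    = closed-∷ v w
        ; recent    = recent st
        ; connected = by (connected st)
        }
        where
        ¬∈[] : ∀ {x : Fin n} → ¬ (x ∈ [])
        ¬∈[] ()
        x≢w : ∀ x → cnt (w ∷ A) x ≡ 0 → x ≢ w
        x≢w x ex refl with trans (sym (cong 𝟙 (=F-refl x))) (m+n≡0⇒m≡0 (𝟙 (x =F x)) ex)
        ... | ()
        by : C ≡ [] ⊎ ∃[ root ] (∀ H → sub F H ≡ true → ∀ c → c ∈ C → iter (length C) (reachStep H)
            (root =F_) c ≡ true) →
          w ∷ C ≡ [] ⊎ ∃[ root ] (∀ H → sub ((v , w) ∷ F) H ≡ true → ∀ c → c ∈ w ∷ C → iter (suc (length C))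
              (reachStep H) (root =F_) c ≡ true)
        by (inj₁ refl) = ⊥-elim (¬∈[] v∈C)
        by (inj₂ (root , reach)) = inj₂ (root , extend)
          where
          extend : ∀ H → sub ((v , w) ∷ F) H ≡ true → ∀ c → c ∈ w ∷ C → iter (suc (length C)) (reachStep H)
              (root =F_) c ≡ true
          extend H sb c (here refl) = reach-adj H {S = iter (length C) (reachStep H) (root =F_)} {v = v}
            (reach H (∧-trueʳ {adj H v w} sb) v v∈C) (∧-trueˡ sb)
          extend H sb c (there c∈)  = iter-⊆ H (length C) (suc (length C)) (n≤1+n _) (reach H
              (∧-trueʳ {adj H v w} sb) c c∈)

      restart : ∀ u → cnt A u ≡ 0 → (∀ v → v ∈ A → rem F v ≡ 0) → length A ≤ M₁ → State F (u ∷ []) A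
      restart u e sat a≤ = record
        { simple    = cnt-new u e
        ; untouched = λ x ex → untouched st x (m+n≡0⇒n≡0 (𝟙 (u =F x)) ex)
        ; closed    = sat
        ; recent    = a≤
        ; connected = inj₂ (u , λ { H _ c (here refl) → iter-⊆ H {S = u =F_} 0 1 z≤n (=F-refl u) })
        }

      -- As q ≤ 4 s and d u ≥ 1, the drift term does not grow. The second term grows by at most 4 L²
      -- · 16 = 64 L², less than the γ released by the clock.
      restart-cheap : ∀ u → d u ≤ 4 → length A < 2 * M₁ → h F (u ∷ A) ≤ h F A
      restart-cheap u d≤4 a< = ≤-cert⁺ (1250 * (r * (s * s * q)) + 1186 * (r * (L * L)))
        (+-mono-≤ (*-monoʳ-≤ q (*-mono-≤ z≤ z≤)) (+-mono-≤ (*-monoʳ-≤ (4 * (L * L)) (*-mono-≤ d≤4 d≤4)) (+-mono-≤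
            (*-monoʳ-≤ (64 * (L * L)) 1≤r) (≤-reflexive (time γ)))))
        (cert q (zz (suc (length A)) (∑ (u ∷ A) d)) (zz (length A) (∑ A d)) (L * L) (sq u) (∑ A sq) r (s * s * q)
            (γ * (2 * M₁ ∸ suc (length A))) (γ * (2 * M₁ ∸ length A)))
        where
        zz : ℕ → ℕ → ℕ
        zz a S = drift (length F) a S
        time : ∀ g → g * (2 * M₁ ∸ suc (length A)) + g ≡ g * (2 * M₁ ∸ length A)
        time g = trans (trans (+-comm _ g) (sym (*-suc g _))) (cong (g *_) (sym (+-∸-assoc 1 a<)))
        z≤ : zz (suc (length A)) (∑ (u ∷ A) d) ≤ zz (length A) (∑ A d)
        z≤ = begin
          (q * suc (length A) + 8 * s * length F) ∸ 4 * s * (d u + ∑ A d)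
            ≡⟨ cong₂ _∸_ (re₁ q (length A) s (length F)) (re₂ s (d u) (∑ A d)) ⟩
          (q + (q * length A + 8 * s * length F)) ∸ (4 * s * d u + 4 * s * ∑ A d)
            ≤⟨ ∸-monoˡ-≤ (4 * s * d u + 4 * s * ∑ A d) (+-monoˡ-≤ _ q≤) ⟩
          (4 * s * d u + (q * length A + 8 * s * length F)) ∸ (4 * s * d u + 4 * s * ∑ A d)
            ≡⟨ [m+n]∸[m+o]≡n∸o (4 * s * d u) _ _ ⟩
          (q * length A + 8 * s * length F) ∸ 4 * s * ∑ A d ∎
          where
          open ≤-Reasoning
          re₁ : ∀ q a s m → q * suc a + 8 * s * m ≡ q + (q * a + 8 * s * m)
          re₁ = solve-∀
          re₂ : ∀ s x S → 4 * s * (x + S) ≡ 4 * s * x + 4 * s * S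
          re₂ = solve-∀
          q≤ : q ≤ 4 * s * d u
          q≤ = ≤-trans (≤-trans (m≤m+n q (19 * q)) 20q≤s) (≤-trans (m≤m+n s (3 * s)) (≤-trans (≤-reflexive (sym
              (*-identityʳ (4 * s)))) (*-monoʳ-≤ (4 * s) (1≤d u))))
        cert : ∀ q x y l u S r k g g₀ →
          q * (x * x) + 4 * l * (u + S) + g + (1250 * (r * k) + 1186 * (r * l)) + (q * (y * y) + (4 * l * 16 +
              (64 * l * r + g₀))) ≡
          q * (y * y) + 4 * l * S + g₀ + (q * (x * x) + (4 * l * u + (64 * l * 1 + (g + 1250 * (r * (k + l))))))
        cert = solve-∀

    saturation : ∀ F A → (∃[ v ] (v ∈ A × 1 ≤ rem F v)) ⊎ (∀ v → v ∈ A → rem F v ≡ 0)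
    saturation F [] = inj₂ (λ v ())
    saturation F (u ∷ A) with rem F u in e | saturation F A
    ... | suc k | _ = inj₁ (u , here refl , subst (1 ≤_) (sym e) (s≤s z≤n))
    ... | zero  | inj₁ (v , v∈ , p) = inj₁ (v , there v∈ , p)
    ... | zero  | inj₂ sat = inj₂ (λ { v (here refl) → e ; v (there v∈) → sat v v∈ })

    -- Revealing an edge lowers the number of non-edges, a restart lowers the number of unexplored
    -- vertices; k bounds their sum.
    explore : ∀ k {F C A₀} → State F C A₀ → non-edges F + (n ∸ length (C ++ A₀)) < k →
      Nbad F * Λ ≤ N F * h F (C ++ A₀)
    explore (suc k) {F} {C} {A₀} st μ< = by-size (2 * M₁ ≤? length A) (4 * ∑ A sq ≤? q)
      where
      A : List (Fin n)
      A = C ++ A₀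

      decided : Λ ≤ h F A → Nbad F * Λ ≤ N F * h F A
      decided = *-mono-≤ (Nbad≤N F)

      shrink : ∀ {v w} m → adj F v w ≡ false → n ∸ m ≤ n ∸ length A → non-edges ((v , w) ∷ F) + (n ∸ m) < k
      shrink {v} {w} m e m≤ = ≤-trans (≤-trans (≤-reflexive (re (non-edges ((v , w) ∷ F)) (n ∸ m)))
        (+-mono-≤ (non-edges-∷ F e) m≤)) (s≤s⁻¹ μ<)
        where
        re : ∀ a b → suc (a + b) ≡ a + 1 + b
        re = solve-∀

      by-saturation : 4 * ∑ A sq ≤ q → length A < 2 * M₁ →
        (∃[ v ] (v ∈ A × 1 ≤ rem F v)) ⊎ (∀ v → v ∈ A → rem F v ≡ 0) → Dec (M₁ ≤ length A) →
        Nbad F * Λ ≤ N F * h F A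
      by-saturation small young (inj₁ (v , v∈A , unsat)) _ = Step.supermartingale st small young v∈A unsat
        (λ w e c → explore k (add-new st v∈C c) (shrink (suc (length A)) e (∸-monoʳ-≤ n (n≤1+n (length A)))))
        (λ w e c → explore k (add-old st (∈-cnt v∈A) c) (shrink (length A) e ≤-refl))
        where
        -- Vertices of finished components have no unmatched half-edges.
        v∈C : v ∈ C
        v∈C = by (∈-++⁻ C v∈A)
          where
          by : v ∈ C ⊎ v ∈ A₀ → v ∈ C
          by (inj₁ v∈)  = v∈
          by (inj₂ v∈₀) = ⊥-elim (<⇒≱ unsat (≤-reflexive (closed st v v∈₀)))
      by-saturation small young (inj₂ sat) (yes M≤) = decided (saturated-drift st sat M≤)
      by-saturation small young (inj₂ sat) (no M≰) = from (fresh-root st small)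
        where
        from : ∃[ u ] (cnt A u ≡ 0 × d u ≤ 4) → Nbad F * Λ ≤ N F * h F A
        from (u , e , d≤4) = ≤-trans
          (explore k (restart st u e sat (<⇒≤ (≰⇒> M≰))) (≤-trans (+-monoʳ-< (non-edges F)
            (∸-monoʳ-< (n<1+n (length A)) (simple-length (u ∷ A) (cnt-new st u e)))) (s≤s⁻¹ μ<)))
          (*-monoʳ-≤ (N F) (restart-cheap st u d≤4 young))

      by-size : Dec (2 * M₁ ≤ length A) → Dec (4 * ∑ A sq ≤ q) → Nbad F * Λ ≤ N F * h F A
      by-size (yes 2M≤) _ = ≤-trans (≤-reflexive (cong (_* Λ) (large-component st 2M≤))) z≤n
      -- The squared degrees exceed q / 4, so already 4 L² S₂ is at least Λ = L² q.
      by-size (no _) (no ≰q) = decided (≤-trans (*-monoʳ-≤ (L * L) (<⇒≤ (≰⇒> ≰q))) (≤-trans (≤-reflexive (re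
          (L * L) (∑ A sq)))
        (≤-trans (m≤n+m _ (q * (drift (length F) (length A) (∑ A d) * drift (length F) (length A) (∑ A d))))
            (m≤m+n _ (γ * (2 * M₁ ∸ length A))))))
        where
        re : ∀ a b → a * (4 * b) ≡ 4 * a * b
        re = solve-∀
      by-size (no 2M≰) (yes small) = by-saturation small (≰⇒> 2M≰) (saturation F A) (M₁ ≤? length A)

    -- With nothing explored, only the clock contributes to `h`.
    few-bad : Nbad [] * Λ ≤ N [] * (γ * (2 * M₁))
    few-bad = ≤-trans (explore (suc (non-edges {n} [] + (n ∸ 0))) initial ≤-refl) (*-monoʳ-≤ (N [])
        (≤-reflexive start))
      where
      initial : State [] [] []
      initial = record { simple = λ _ → z≤n ; untouched = λ _ _ _ → refl ; closed = λ _
          () ; recent = z≤n ; connected = inj₁ refl }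
      start : h [] [] ≡ γ * (2 * M₁)
      start = trans (cong (λ z → q * (z * z) + 4 * (L * L) * 0 + γ * (2 * M₁)) (m≤n⇒m∸n≡0 (≤-reflexive (re q s))))
          (re′ q (L * L) (γ * (2 * M₁)))
        where
        re : ∀ q s → q * 0 + 8 * s * 0 ≡ 4 * s * 0
        re = solve-∀
        re′ : ∀ q l g → q * (0 * 0) + 4 * l * 0 + g ≡ g
        re′ = solve-∀

  -- From the degree conditions to the exploration: choice of r and M₁.

  cube-cancel : ∀ {x y} → x * x * x ≤ y * y * y → x ≤ y
  cube-cancel {x} {y} h with x ≤? y
  ... | yes p = p
  ... | no ≰y = ⊥-elim (<⇒≱ (*-mono-< (*-mono-< y<x y<x) y<x) h)
    where
    y<x : y < x
    y<x = ≰⇒> ≰y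

  -- (x − 2)², free of truncated subtraction.
  centred-square : ℕ → ℕ
  centred-square 0             = 4
  centred-square 1             = 1
  centred-square (suc (suc k)) = k * k

  k≤k² : ∀ k → k ≤ k * k
  k≤k² zero    = z≤n
  k≤k² (suc k) = m≤m*n (suc k) (suc k)

  -- Multiplied by x and summed, this bounds the third moment by 9 ρ + 8 s, hence the 17 in `∑d³`.
  square-≤ : ∀ x → x * x ≤ 9 * centred-square x + 8
  square-≤ 0             = z≤n
  square-≤ 1             = s≤s z≤n
  square-≤ (suc (suc k)) = ≤-cert⁺ (4 * (k * k) + 4) (*-monoʳ-≤ 4 (k≤k² k)) (cert k)
    where
    cert : ∀ k → (2 + k) * (2 + k) + (4 * (k * k) + 4) + 4 * (k * k) ≡ 9 * (k * k) + 8 + 4 * k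
    cert = solve-∀

  -- Every vertex of degree other than 2 contributes to ρ; summed, n ≤ n₂ + ρ.
  off-two : ∀ x → 1 ≤ x → 1 ≤ 𝟙 (x ≡ᵇ 2) + x * centred-square x
  off-two 1                   _ = ≤-refl
  off-two 2                   _ = ≤-refl
  off-two (suc (suc (suc k))) _ = s≤s z≤n

  -- This is (x - 2)² ≥ 0; summed, it keeps the mean degree below 3.
  four-≤ : ∀ x → 4 * x ≤ x * x + 4
  four-≤ 0             = z≤n
  four-≤ 1             = s≤s (s≤s (s≤s (s≤s z≤n)))
  four-≤ (suc (suc k)) = ≤-slack (k * k) (cert k)
    where
    cert : ∀ k → 4 * (2 + k) + k * k ≡ (2 + k) * (2 + k) + 4
    cert = solve-∀

  -- A = 1 / A₀, and W₀ is the value that ω must exceed, for 1 / K < ε and 1 / Z < ζ.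
  module Constants (K Z : ℕ) where
    D₀ c₃ : ℕ
    -- 5000 = 4 · 1250, with 1250 from `γ`; c₃ is the constant in r s ≤ c₃ ρ.
    D₀ = 5000 * K
    c₃ = 1 + 3 * Z

    opaque
      A₀ W₀ : ℕ
      A₀ = 2 * (c₃ * D₀)
      -- The first summand makes the deviation unlikely, the second gives 25 Δ² ≤ q after comparing
      -- cubes.
      W₀ = 2 * (D₀ * D₀) * (c₃ * c₃) + 25 * 25 * 25

      A₀-def : A₀ ≡ 2 * (c₃ * D₀)
      A₀-def = refl

      W₀-window : 2 * (D₀ * D₀) * (c₃ * c₃) ≤ W₀
      W₀-window = m≤m+n (2 * (D₀ * D₀) * (c₃ * c₃)) (25 * 25 * 25)

      W₀-degree : 25 * 25 * 25 ≤ W₀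
      W₀-degree = m≤n+m (25 * 25 * 25) (2 * (D₀ * D₀) * (c₃ * c₃))

    1≤A₀ : 1 ≤ K → 1 ≤ A₀
    1≤A₀ 1≤K = ≤-trans (*-mono-≤ {1} {2} (s≤s z≤n) (*-mono-≤ {1} {c₃} (s≤s z≤n) (*-mono-≤ {1} {5000} (s≤s z≤n) 1≤K)))
      (≤-reflexive (sym A₀-def))

  -- In the notation of the paper s = 2|E|, q = 2|E| Q and ρ = 2|E| R, while r below is an integer of the order of R.
  module Reduction {n : ℕ} (D : Vec ℕ n) (K Z Δ q : ℕ) (bad : SimpleGraph n → Bool)
    (1≤K : 1 ≤ K) (1≤n : 1 ≤ n)
    (d≤Δ : ∀ v → lookup D v ≤ Δ) (1≤d : ∀ v → 1 ≤ lookup D v)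
    (∑d² : ∑ V (λ v → lookup D v * lookup D v) ≡ 2 * Counting.s D + q)
    (1≤q : 1 ≤ q) (20q≤s : 20 * q ≤ Counting.s D)
    (n≤Zρ : n ≤ Z * ∑ V (λ v → lookup D v * centred-square (lookup D v)))
    (Δ³≤ρ : Δ * Δ * Δ ≤ ∑ V (λ v → lookup D v * centred-square (lookup D v)))
    (window : Constants.W₀ K Z * (∑ V (λ v → lookup D v * centred-square (lookup D v)) * ∑ V (λ v → lookup D v * centred-square (lookup D v))) ≤ q * q * q)
    (bad-Cmax : ∀ H → bad H ≡ true →
      Constants.A₀ K Z * (Cmax H * ∑ V (λ v → lookup D v * centred-square (lookup D v))) ≤ q * n) where

    open Constants K Z
    open Counting D

    ρ : ℕ
    ρ = ∑ V (λ v → d v * centred-square (d v))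

    instance
      q-nonZero : NonZero q
      q-nonZero = >-nonZero 1≤q

    1≤s : 1 ≤ s
    1≤s = ≤-trans (≤-trans 1≤q (m≤m+n q (19 * q))) 20q≤s

    instance
      s-nonZero : NonZero s
      s-nonZero = >-nonZero 1≤s

    n≤s : n ≤ s
    n≤s = ≤-trans (≤-reflexive (sym (∑V-1 {n}))) (∑-mono V 1≤d)

    s≤3n : s ≤ 3 * n
    s≤3n = *-cancelˡ-≤ 39 (≤-cert⁺ (37 * n) (+-mono-≤ (*-monoʳ-≤ 20 4s≤) 20q≤s) (cert s n q))
      where
      4s≤ : 4 * s ≤ 2 * s + q + 4 * n
      4s≤ = begin
        4 * s                                   ≡⟨ ∑-*ˡ V 4 d ⟨
        ∑ V (λ v → 4 * d v)                     ≤⟨ ∑-mono V (λ v → four-≤ (d v)) ⟩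
        ∑ V (λ v → d v * d v + 4)               ≡⟨ trans (∑-+ V (λ v → d v * d v) (λ _ → 4)) (cong₂ _+_ ∑d² (trans
            (∑-*ˡ (V {n}) 4 (λ _ → 1)) (cong (4 *_) (∑V-1 {n})))) ⟩
        2 * s + q + 4 * n                       ∎
        where open ≤-Reasoning
      cert : ∀ s n q → 39 * s + 37 * n + (20 * (2 * s + q + 4 * n) + s) ≡ 39 * (3 * n) + (20 * (4 * s) + 20 * q)
      cert = solve-∀

    -- Rounding up yields ρ ≤ r s and r ≥ 1. The extra s is at most 3 Z ρ, which is absorbed by c₃.
    r : ℕ
    r = suc (ρ / s)

    ρ≤rs : ρ ≤ r * s
    ρ≤rs = ≤-trans (≤-reflexive (m≡m%n+[m/n]*n ρ s)) (+-monoˡ-≤ (ρ / s * s) (<⇒≤ (m%n<n ρ s)))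

    rs≤c₃ρ : r * s ≤ c₃ * ρ
    rs≤c₃ρ = ≤-cert (+-mono-≤ (m/n*n≤m ρ s) (+-mono-≤ s≤3n (*-monoʳ-≤ 3 n≤Zρ))) (cert (ρ / s) s n ρ Z)
      where
      cert : ∀ x s n ρ Z → suc x * s + (ρ + (3 * n + 3 * (Z * ρ))) ≡ (1 + 3 * Z) * ρ + (x * s + (s + 3 * n))
      cert = solve-∀

    ∑d³ : ∑ V (λ v → d v * d v * d v) ≤ 17 * (r * s)
    ∑d³ = begin
      ∑ V (λ v → d v * d v * d v)
        ≤⟨ ∑-mono V (λ v → ≤-trans (≤-reflexive (*-assoc (d v) (d v) (d v))) (≤-trans (*-monoʳ-≤ (d v) (square-≤
            (d v))) (≤-reflexive (re (d v) (centred-square (d v)))))) ⟩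
      ∑ V (λ v → 9 * (d v * centred-square (d v)) + 8 * d v)
        ≡⟨ trans (∑-+ V (λ v → 9 * (d v * centred-square (d v))) (λ v → 8 * d v)) (cong₂ _+_ (∑-*ˡ V 9
            (λ v → d v * centred-square (d v))) (∑-*ˡ V 8 d)) ⟩
      9 * ρ + 8 * s
        ≤⟨ +-mono-≤ (*-monoʳ-≤ 9 ρ≤rs) (*-monoʳ-≤ 8 (m≤m+n s (ρ / s * s))) ⟩
      9 * (r * s) + 8 * (r * s)
        ≡⟨ *-distribʳ-+ (r * s) 9 8 ⟨
      17 * (r * s) ∎
      where
      open ≤-Reasoning
      re : ∀ x e → x * (9 * e + 8) ≡ 9 * (x * e) + 8 * x
      re = solve-∀

    -- On the level of cubes: c³ Δ⁶ ≤ W₀ ρ² ≤ q³.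
    degree-bound : ∀ c → c * c * c ≤ W₀ → c * (Δ * Δ) ≤ q
    degree-bound c c³≤W₀ = cube-cancel (begin
      c * (Δ * Δ) * (c * (Δ * Δ)) * (c * (Δ * Δ))      ≡⟨ re c Δ ⟩
      c * c * c * (Δ * Δ * Δ * (Δ * Δ * Δ))            ≤⟨ *-mono-≤ c³≤W₀ (*-mono-≤ Δ³≤ρ Δ³≤ρ) ⟩
      W₀ * (ρ * ρ)                                     ≤⟨ window ⟩
      q * q * q                                        ∎)
      where
      open ≤-Reasoning
      re : ∀ c x → c * (x * x) * (c * (x * x)) * (c * (x * x)) ≡ c * c * c * (x * x * x * (x * x * x))
      re = solve-∀

    25Δ²≤q : 25 * (Δ * Δ) ≤ q
    25Δ²≤q = degree-bound 25 W₀-degree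

    window-r : 2 * (D₀ * D₀) * (r * s * (r * s)) ≤ q * q * q
    window-r = begin
      2 * (D₀ * D₀) * (r * s * (r * s))        ≤⟨ *-monoʳ-≤ (2 * (D₀ * D₀)) (*-mono-≤ rs≤c₃ρ rs≤c₃ρ) ⟩
      2 * (D₀ * D₀) * (c₃ * ρ * (c₃ * ρ))      ≡⟨ re (2 * (D₀ * D₀)) c₃ ρ ⟩
      2 * (D₀ * D₀) * (c₃ * c₃) * (ρ * ρ)      ≤⟨ *-monoˡ-≤ (ρ * ρ) W₀-window ⟩
      W₀ * (ρ * ρ)                             ≤⟨ window ⟩
      q * q * q                                ∎
      where
      open ≤-Reasoning
      re : ∀ a c x → a * (c * x * (c * x)) ≡ a * (c * c) * (x * x)
      re = solve-∀

    instance
      K-nonZero : NonZero K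
      K-nonZero = >-nonZero 1≤K
      D₀-nonZero : NonZero D₀
      D₀-nonZero = m*n≢0 5000 K
      rD₀-nonZero : NonZero (r * D₀)
      rD₀-nonZero = m*n≢0 r D₀
      qq-nonZero : NonZero (q * q)
      qq-nonZero = m*n≢0 q q

    rD₀≤q : r * D₀ ≤ q
    rD₀≤q = *-cancelʳ-≤ (r * D₀) q (q * q) (begin
      r * D₀ * (q * q)                          ≤⟨ *-monoˡ-≤ (q * q) (k≤k² (r * D₀)) ⟩
      r * D₀ * (r * D₀) * (q * q)               ≤⟨ *-monoʳ-≤ (r * D₀ * (r * D₀)) (*-mono-≤ q≤s q≤s) ⟩
      r * D₀ * (r * D₀) * (s * s)               ≤⟨ m≤n*m _ 2 ⟩
      2 * (r * D₀ * (r * D₀) * (s * s))         ≡⟨ re r D₀ s ⟩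
      2 * (D₀ * D₀) * (r * s * (r * s))         ≤⟨ window-r ⟩
      q * q * q                                 ≡⟨ *-assoc q q q ⟩
      q * (q * q)                               ∎)
      where
      open ≤-Reasoning
      q≤s : q ≤ s
      q≤s = ≤-trans (m≤m+n q (19 * q)) 20q≤s
      re : ∀ r D s → 2 * (r * D * (r * D) * (s * s)) ≡ 2 * (D * D) * (r * s * (r * s))
      re = solve-∀

    -- Since q = s Q, s has the order of n and r that of R, this is a small multiple of Q n / R;
    -- rounding down loses less than a factor 2.
    M₁ : ℕ
    M₁ = q / (r * D₀)

    1≤M₁ : 1 ≤ M₁
    1≤M₁ = m≥n⇒m/n>0 rD₀≤q

    M₁-lower : M₁ * (r * D₀) ≤ q
    M₁-lower = m/n*n≤m q (r * D₀)

    M₁-upper : q < 2 * (M₁ * (r * D₀))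
    M₁-upper = begin-strict
      q                                            ≡⟨ m≡m%n+[m/n]*n q (r * D₀) ⟩
      q % (r * D₀) + M₁ * (r * D₀)                 <⟨ +-monoˡ-< (M₁ * (r * D₀)) (m%n<n q (r * D₀)) ⟩
      r * D₀ + M₁ * (r * D₀)                       ≤⟨ +-monoˡ-≤ (M₁ * (r * D₀)) (≤-trans (≤-reflexive (sym
          (*-identityˡ (r * D₀)))) (*-monoˡ-≤ (r * D₀) 1≤M₁)) ⟩
      M₁ * (r * D₀) + M₁ * (r * D₀)                ≡⟨ cong (M₁ * (r * D₀) +_) (sym (+-identityʳ _)) ⟩
      2 * (M₁ * (r * D₀))                          ∎
      where open ≤-Reasoning

    -- A₀ = 2 c₃ D₀ is chosen for this: c₃ pays for r s ≤ c₃ ρ, and 2 D₀ for q < 2 M₁ r D₀.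
    bad-small : ∀ H → bad H ≡ true → Cmax H < M₁
    bad-small H b = *-cancelˡ-< (2 * (c₃ * D₀) * (r * s)) (Cmax H) M₁ (begin-strict
      2 * (c₃ * D₀) * (r * s) * Cmax H            ≤⟨ *-monoˡ-≤ (Cmax H) (*-monoʳ-≤ (2 * (c₃ * D₀)) rs≤c₃ρ) ⟩
      2 * (c₃ * D₀) * (c₃ * ρ) * Cmax H           ≡⟨ trans (re₁ (2 * (c₃ * D₀)) c₃ ρ (Cmax H)) (cong (λ a → c₃ *
          (a * (Cmax H * ρ))) (sym A₀-def)) ⟩
      c₃ * (A₀ * (Cmax H * ρ))                    ≤⟨ *-monoʳ-≤ c₃ (≤-trans (bad-Cmax H b) (*-monoʳ-≤ q n≤s)) ⟩
      c₃ * (q * s)                                <⟨ *-monoʳ-< c₃ (*-monoˡ-< s M₁-upper) ⟩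
      c₃ * (2 * (M₁ * (r * D₀)) * s)              ≡⟨ re₂ c₃ M₁ r D₀ s ⟩
      2 * (c₃ * D₀) * (r * s) * M₁                ∎)
      where
      open ≤-Reasoning
      re₁ : ∀ a c ρ k → a * (c * ρ) * k ≡ c * (a * (k * ρ))
      re₁ = solve-∀
      re₂ : ∀ c M r D s → c * (2 * (M * (r * D)) * s) ≡ 2 * (c * D) * (r * s) * M
      re₂ = solve-∀

    open Exploration D Δ d≤Δ bad q r M₁ 1≤d ∑d² ∑d³ 1≤q 20q≤s s≤3n 25Δ²≤q (s≤s z≤n) 1≤M₁ bad-small using
        (Nbad; Λ; γ; few-bad)

    -- Doubled, the left side splits along the two summands of γ. Each part is at most Λ: the first
    -- by `window-r`, the second by M₁ r D₀ ≤ q.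
    Kγ≤Λ : K * (γ * (2 * M₁)) ≤ Λ
    Kγ≤Λ = *-cancelˡ-≤ 2 (begin
      2 * (K * (γ * (2 * M₁)))
        ≡⟨ re₁ K r s q M₁ ⟩
      D₀ * (r * (s * s)) * (q * M₁) + M₁ * (r * D₀) * (q * q * (M₁ * M₁))
        ≤⟨ +-mono-≤ (*-monoˡ-≤ (q * M₁) variance) (*-monoˡ-≤ (q * q * (M₁ * M₁)) M₁-lower) ⟩
      q * q * M₁ * (q * M₁) + q * (q * q * (M₁ * M₁))
        ≡⟨ re₂ q M₁ ⟩
      2 * Λ ∎)
      where
      open ≤-Reasoning
      re₁ : ∀ K r s q M → 2 * (K * (1250 * (r * (s * s * q + q * M * (q * M))) * (2 * M))) ≡
        5000 * K * (r * (s * s)) * (q * M) + M * (r * (5000 * K)) * (q * q * (M * M))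
      re₁ = solve-∀
      re₂ : ∀ q M → q * q * M * (q * M) + q * (q * q * (M * M)) ≡ 2 * (q * M * (q * M) * q)
      re₂ = solve-∀
      variance : D₀ * (r * (s * s)) ≤ q * q * M₁
      variance = *-cancelˡ-≤ (2 * (r * D₀)) {{m*n≢0 2 (r * D₀)}} (begin
        2 * (r * D₀) * (D₀ * (r * (s * s)))         ≡⟨ re₃ r D₀ s ⟩
        2 * (D₀ * D₀) * (r * s * (r * s))           ≤⟨ window-r ⟩
        q * q * q                                   ≤⟨ *-monoʳ-≤ (q * q) (<⇒≤ M₁-upper) ⟩
        q * q * (2 * (M₁ * (r * D₀)))               ≡⟨ re₄ (q * q) M₁ (r * D₀) ⟩
        2 * (r * D₀) * (q * q * M₁)                 ∎)
        where
        re₃ : ∀ r D s → 2 * (r * D) * (D * (r * (s * s))) ≡ 2 * (D * D) * (r * s * (r * s))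
        re₃ = solve-∀
        re₄ : ∀ a M b → a * (2 * (M * b)) ≡ 2 * b * (a * M)
        re₄ = solve-∀

    bad-rare : K * Nbad [] ≤ N []
    bad-rare = *-cancelʳ-≤ (K * Nbad []) (N []) Λ {{Λ-nonZero}} (begin
      K * Nbad [] * Λ                  ≡⟨ *-assoc K (Nbad []) Λ ⟩
      K * (Nbad [] * Λ)                ≤⟨ *-monoʳ-≤ K few-bad ⟩
      K * (N [] * (γ * (2 * M₁)))      ≡⟨ re K (N []) (γ * (2 * M₁)) ⟩
      N [] * (K * (γ * (2 * M₁)))      ≤⟨ *-monoʳ-≤ (N []) Kγ≤Λ ⟩
      N [] * Λ                         ∎)
      where
      open ≤-Reasoning
      re : ∀ a b c → a * (b * c) ≡ b * (a * c)
      re = solve-∀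
      instance
        M₁-nonZero : NonZero M₁
        M₁-nonZero = >-nonZero 1≤M₁
        L-nonZero : NonZero (q * M₁)
        L-nonZero = m*n≢0 q M₁
        LL-nonZero : NonZero (q * M₁ * (q * M₁))
        LL-nonZero = m*n≢0 (q * M₁) (q * M₁)
      Λ-nonZero : NonZero Λ
      Λ-nonZero = m*n≢0 (q * M₁ * (q * M₁)) q

    count-all : length (filterᵇ (hasDegSeq D) 𝒢) ≡ N []
    count-all = trans (length-filter (hasDegSeq D) 𝒢) (∑-cong 𝒢 (λ H → cong 𝟙 (trans (sym (ok-def H)) (sym
        (∧-identityʳ (ok H))))))

    count-bad : length (filterᵇ bad (filterᵇ (hasDegSeq D) 𝒢)) ≡ Nbad []
    count-bad = trans (length-filter bad (filterᵇ (hasDegSeq D) 𝒢)) (trans (∑-filter (hasDegSeq D) 𝒢 (𝟙 ∘ bad))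
      (∑-cong 𝒢 (λ H → cong (λ b → 𝟙 b * 𝟙 (bad H)) (trans (sym (ok-def H)) (sym (∧-identityʳ (ok H)))))))

    bad-fraction : K * length (filterᵇ bad (filterᵇ (hasDegSeq D) 𝒢)) ≤ length (filterᵇ (hasDegSeq D) 𝒢)
    bad-fraction = subst₂ (λ x y → K * x ≤ y) (sym count-bad) (sym count-all) bad-rare

-- Natural numbers in the rationals, and the exponential series.

module Embedding where

  open import Data.Empty using (⊥-elim)
  open import Data.Integer as ℤ using (+_)
  import Data.Integer.Properties as ℤP
  open import Data.Nat as ℕ using (ℕ; zero; suc; _!)
  import Data.Nat.Properties as ℕP
  import Data.Nat.Coprimality as Coprime
  open import Data.Product using (_×_; _,_; ∃-syntax)
  open import Data.Rational
  open import Data.Rational.Properties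
  import Data.Rational.Unnormalised as ℚᵘ
  import Data.Rational.Unnormalised.Properties as ℚᵘP
  open import Data.Rational.Solver using (module +-*-Solver)
  open import Relation.Nullary using (yes; no; ¬_)
  open import Relation.Binary.PropositionalEquality

  ι : ℕ → ℚ
  ι = ℕtoℚ

  ι-mkℚ : ∀ m → ι m ≡ mkℚ (+ m) 0 (Coprime.sym (Coprime.1-coprimeTo m))
  ι-mkℚ m = normalize-coprime (Coprime.sym (Coprime.1-coprimeTo m))

  ι-+ : ∀ m k → ι (m ℕ.+ k) ≡ ι m + ι k
  ι-+ m k rewrite ι-mkℚ m | ι-mkℚ k =
    cong (_/ 1) (sym (cong₂ ℤ._+_ (ℤP.*-identityʳ (+ m)) (ℤP.*-identityʳ (+ k))))

  ι-* : ∀ m k → ι (m ℕ.* k) ≡ ι m * ι k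
  ι-* m k rewrite ι-mkℚ m | ι-mkℚ k = cong (_/ 1) (ℤP.pos-* m k)

  ι-mono-≤ : ∀ {m k} → m ℕ.≤ k → ι m ≤ ι k
  ι-mono-≤ {m} {k} h rewrite ι-mkℚ m | ι-mkℚ k = *≤* (ℤP.*-monoʳ-≤-nonNeg (+ 1) (ℤ.+≤+ h))

  ι-mono-< : ∀ {m k} → m ℕ.< k → ι m < ι k
  ι-mono-< {m} {k} h rewrite ι-mkℚ m | ι-mkℚ k = *<* (ℤP.*-monoʳ-<-pos (+ 1) (ℤ.+<+ h))

  <⇒≱ : ∀ {p q} → p < q → ¬ (q ≤ p)
  <⇒≱ p<q q≤p = <-irrefl refl (<-≤-trans p<q q≤p)

  ι-cancel-≤ : ∀ {m k} → ι m ≤ ι k → m ℕ.≤ k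
  ι-cancel-≤ {m} {k} h with m ℕ.≤? k
  ... | yes p = p
  ... | no ≰k = ⊥-elim (<⇒≱ (ι-mono-< (ℕP.≰⇒> ≰k)) h)

  0≤ι : ∀ m → 0ℚ ≤ ι m
  0≤ι m = ι-mono-≤ {0} {m} ℕ.z≤n

  0<ι : ∀ m → 1 ℕ.≤ m → 0ℚ < ι m
  0<ι m h = ι-mono-< {0} {m} h

  *-monoʳ : ∀ {p q} r → 0ℚ ≤ r → p ≤ q → p * r ≤ q * r
  *-monoʳ r 0≤r h = *-monoʳ-≤-nonNeg r {{nonNegative 0≤r}} h

  *-monoˡ : ∀ {p q} r → 0ℚ ≤ r → p ≤ q → r * p ≤ r * q
  *-monoˡ r 0≤r h = *-monoˡ-≤-nonNeg r {{nonNegative 0≤r}} h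

  *-cancelʳ : ∀ {p q} r → 0ℚ < r → p * r ≤ q * r → p ≤ q
  *-cancelʳ r 0<r h = *-cancelʳ-≤-pos r {{positive 0<r}} h

  *-cancelʳ-≡ : ∀ {p q} r → 0ℚ < r → p * r ≡ q * r → p ≡ q
  *-cancelʳ-≡ r 0<r e = ≤-antisym (*-cancelʳ r 0<r (≤-reflexive e)) (*-cancelʳ r 0<r (≤-reflexive (sym e)))

  0≤* : ∀ {p q} → 0ℚ ≤ p → 0ℚ ≤ q → 0ℚ ≤ p * q
  0≤* {p} {q} 0≤p 0≤q = ≤-trans (≤-reflexive (sym (*-zeroˡ q))) (*-monoʳ q 0≤q 0≤p)

  0≤+ : ∀ {p q} → 0ℚ ≤ p → 0ℚ ≤ q → 0ℚ ≤ p + q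
  0≤+ 0≤p 0≤q = +-mono-≤ 0≤p 0≤q

  ÷′-* : ∀ p q → q ≢ 0ℚ → (p ÷' q) * q ≡ p
  ÷′-* p q q≢0 with q ≟ 0ℚ
  ... | yes q≡0 = ⊥-elim (q≢0 q≡0)
  ... | no q≢0′ = trans (*-assoc p _ q) (trans (cong (p *_) (*-inverseˡ q {{≢-nonZero q≢0′}})) (*-identityʳ p))

  pos≢0 : ∀ {p} → 0ℚ < p → p ≢ 0ℚ
  pos≢0 0<p refl = <-irrefl refl 0<p

  cube-mono : ∀ {p q} → 0ℚ ≤ p → p ≤ q → p * p * p ≤ q * q * q
  cube-mono {p} {q} 0≤p p≤q = ≤-trans (*-monoʳ p 0≤p sq-mono) (*-monoˡ (q * q) (0≤* 0≤q 0≤q) p≤q)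
    where
    0≤q : 0ℚ ≤ q
    0≤q = ≤-trans 0≤p p≤q
    sq-mono : p * p ≤ q * q
    sq-mono = ≤-trans (*-monoʳ p 0≤p p≤q) (*-monoˡ q 0≤q p≤q)

  term : ℚ → ℕ → ℚ
  term y k = (y ^ℚ k) ÷' ι (k !)

  0<! : ∀ k → 0ℚ < ι (k !)
  0<! k = 0<ι (k !) (ℕP.1≤n! k)

  -- A recursion for yᵏ / k! without division, from which the bounds on terms follow by induction.
  term-suc : ∀ y k → term y (suc k) * ι (suc k) ≡ y * term y k
  term-suc y k = *-cancelʳ-≡ (ι (k !)) (0<! k) (begin
    term y (suc k) * ι (suc k) * ι (k !)    ≡⟨ *-assoc (term y (suc k)) _ _ ⟩
    term y (suc k) * (ι (suc k) * ι (k !))  ≡⟨ cong (term y (suc k) *_) (sym (ι-* (suc k) (k !))) ⟩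
    term y (suc k) * ι (suc k !)            ≡⟨ ÷′-* (y ^ℚ suc k) _ (pos≢0 (0<! (suc k))) ⟩
    y * (y ^ℚ k)                            ≡⟨ cong (y *_) (sym (÷′-* (y ^ℚ k) _ (pos≢0 (0<! k)))) ⟩
    y * (term y k * ι (k !))                ≡⟨ *-assoc y _ _ ⟨
    y * term y k * ι (k !)                  ∎)
    where open ≡-Reasoning

  term-zero : ∀ y → term y 0 ≡ 1ℚ
  term-zero y = *-cancelʳ-≡ (ι 1) (0<! 0) (trans (÷′-* 1ℚ (ι 1) (pos≢0 (0<! 0))) refl)

  0≤term : ∀ {y} k → 0ℚ ≤ y → 0ℚ ≤ term y k
  0≤term {y} zero    0≤y = ≤-trans (0≤ι 1) (≤-reflexive (sym (term-zero y)))
  0≤term {y} (suc k) 0≤y = *-cancelʳ (ι (suc k)) (0<ι (suc k) (ℕ.s≤s ℕ.z≤n))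
    (≤-trans (≤-reflexive (*-zeroˡ (ι (suc k)))) (≤-trans (0≤* 0≤y (0≤term k 0≤y)) (≤-reflexive (sym
        (term-suc y k)))))

  term-mono : ∀ {y b} k → 0ℚ ≤ y → y ≤ b → term y k ≤ term b k
  term-mono {y} {b} zero    0≤y y≤b = ≤-reflexive (trans (term-zero y) (sym (term-zero b)))
  term-mono {y} {b} (suc k) 0≤y y≤b = *-cancelʳ (ι (suc k)) (0<ι (suc k) (ℕ.s≤s ℕ.z≤n)) (begin
    term y (suc k) * ι (suc k)    ≡⟨ term-suc y k ⟩
    y * term y k                  ≤⟨ *-monoʳ (term y k) (0≤term k 0≤y) y≤b ⟩
    b * term y k                  ≤⟨ *-monoˡ b (≤-trans 0≤y y≤b) (term-mono k 0≤y y≤b) ⟩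
    b * term b k                  ≡⟨ term-suc b k ⟨
    term b (suc k) * ι (suc k)    ∎)
    where open ≤-Reasoning

  -- The mean value inequality for y ↦ yᵏ⁺¹ / (k+1)!, whose derivative is yᵏ / k!.
  term-shift : ∀ y u → 0ℚ ≤ y → 0ℚ ≤ u → ∀ k → term (y + u) (suc k) ≤ term y (suc k) + u * term (y + u) k
  term-shift y u 0≤y 0≤u k = *-cancelʳ (ι (suc k)) (0<ι (suc k) (ℕ.s≤s ℕ.z≤n)) (≤-trans (scaled k) (≤-reflexive
      (regroup k)))
    where
    b : ℚ
    b = y + u
    0≤b : 0ℚ ≤ b
    0≤b = 0≤+ 0≤y 0≤u
    open +-*-Solver
    regroup : ∀ k → y * term y k + u * (term b k * ι k) + u * term b k ≡ (term y (suc k) + u * term b k) * ι (suc k)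
    regroup k = begin
      y * term y k + u * (term b k * ι k) + u * term b k
        ≡⟨ cong (λ x → x + u * (term b k * ι k) + u * term b k) (sym (term-suc y k)) ⟩
      term y (suc k) * ι (suc k) + u * (term b k * ι k) + u * term b k
        ≡⟨ cong (λ x → term y (suc k) * x + u * (term b k * ι k) + u * term b k) (ι-+ 1 k) ⟩
      term y (suc k) * (1ℚ + ι k) + u * (term b k * ι k) + u * term b k
        ≡⟨ solve 4 (λ a c w t → a :* (con 1ℚ :+ c) :+ w :* (t :* c) :+ w :* t := (a :+ w :* t) :*
            (con 1ℚ :+ c)) refl (term y (suc k)) (ι k) u (term b k) ⟩
      (term y (suc k) + u * term b k) * (1ℚ + ι k)
        ≡⟨ cong ((term y (suc k) + u * term b k) *_) (sym (ι-+ 1 k)) ⟩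
      (term y (suc k) + u * term b k) * ι (suc k) ∎
      where open ≡-Reasoning
    -- `term b k * ι k` stands for b times the preceding term, so that no index falls below 0 at k =
    -- 0.
    scaled : ∀ k → term b (suc k) * ι (suc k) ≤ y * term y k + u * (term b k * ι k) + u * term b k
    scaled zero = ≤-reflexive (begin
      term b 1 * ι 1                                       ≡⟨ term-suc b 0 ⟩
      (y + u) * term b 0                                   ≡⟨ cong ((y + u) *_) (trans (term-zero b) (sym
          (term-zero y))) ⟩
      (y + u) * term y 0                                   ≡⟨ solve 4 (λ y u t c → (y :+ u) :* t := y :* t :+ u :*
          (c :* con 0ℚ) :+ u :* t) refl y u (term y 0) (term b 0) ⟩
      y * term y 0 + u * (term b 0 * 0ℚ) + u * term y 0    ≡⟨ cong (λ x → y * term y 0 + u *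
          (term b 0 * 0ℚ) + u * x) (trans (term-zero y) (sym (term-zero b))) ⟩
      y * term y 0 + u * (term b 0 * ι 0) + u * term b 0   ∎)
      where open ≡-Reasoning
    scaled (suc k) = begin
      term b (suc (suc k)) * ι (suc (suc k))
        ≡⟨ term-suc b (suc k) ⟩
      (y + u) * term b (suc k)
        ≡⟨ *-distribʳ-+ (term b (suc k)) y u ⟩
      y * term b (suc k) + u * term b (suc k)
        ≤⟨ +-monoˡ-≤ (u * term b (suc k)) (*-monoˡ y 0≤y (*-cancelʳ (ι (suc k)) (0<ι (suc k) (ℕ.s≤s ℕ.z≤n))
            (≤-trans (scaled k) (≤-reflexive (regroup k))))) ⟩
      y * (term y (suc k) + u * term b k) + u * term b (suc k)
        ≡⟨ cong (_+ u * term b (suc k)) (solve 4 (λ y t u c → y :* (t :+ u :* c) := y :* t :+ u :*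
            (y :* c)) refl y (term y (suc k)) u (term b k)) ⟩
      y * term y (suc k) + u * (y * term b k) + u * term b (suc k)
        ≤⟨ +-monoˡ-≤ (u * term b (suc k)) (+-monoʳ-≤ (y * term y (suc k)) (*-monoˡ u 0≤u (*-monoʳ (term b k)
            (0≤term k 0≤b) y≤b))) ⟩
      y * term y (suc k) + u * (b * term b k) + u * term b (suc k)
        ≡⟨ cong (λ x → y * term y (suc k) + u * x + u * term b (suc k)) (term-suc b k) ⟨
      y * term y (suc k) + u * (term b (suc k) * ι (suc k)) + u * term b (suc k) ∎
      where
      open ≤-Reasoning
      y≤b : y ≤ b
      y≤b = ≤-trans (≤-reflexive (sym (+-identityʳ y))) (+-monoʳ-≤ y 0≤u)

  exp-mono : ∀ {y b} K → 0ℚ ≤ y → y ≤ b → expPartial y K ≤ expPartial b K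
  exp-mono zero    0≤y y≤b = ≤-refl
  exp-mono (suc K) 0≤y y≤b = +-mono-≤ (exp-mono K 0≤y y≤b) (term-mono K 0≤y y≤b)

  -- The mean value inequality for exp, summed from `term-shift`; the index shift on the right is
  -- filled by a nonnegative last term.
  exp-shift : ∀ y u → 0ℚ ≤ y → 0ℚ ≤ u → ∀ K → expPartial (y + u) K ≤ expPartial y K + u * expPartial (y + u) K
  exp-shift y u 0≤y 0≤u zero    = ≤-reflexive (sym (trans (cong (λ x → 0ℚ + x) (*-zeroʳ u)) (+-identityʳ 0ℚ)))
  exp-shift y u 0≤y 0≤u (suc K) = ≤-trans (go K) (+-monoʳ-≤ (expPartial y (suc K)) (*-monoˡ u 0≤u
      (≤-trans (≤-reflexive (sym (+-identityʳ _))) (+-monoʳ-≤ (expPartial b K) (0≤term K (0≤+ 0≤y 0≤u))))))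
    where
    b : ℚ
    b = y + u
    open +-*-Solver
    go : ∀ K → expPartial b (suc K) ≤ expPartial y (suc K) + u * expPartial b K
    go zero    = ≤-reflexive (trans (cong (λ x → 0ℚ + x) (trans (term-zero b) (sym (term-zero y))))
      (solve 2 (λ t u → con 0ℚ :+ t := con 0ℚ :+ t :+ u :* con 0ℚ) refl (term y 0) u))
    go (suc K) = ≤-trans (+-mono-≤ (go K) (term-shift y u 0≤y 0≤u K))
      (≤-reflexive (solve 5 (λ a u c t s → (a :+ u :* c) :+ (t :+ u :* s) := (a :+ t) :+ u :* (c :+ s)) refl
        (expPartial y (suc K)) u (expPartial b K) (term y (suc K)) (term b K)))

  -- At u = ½ half of the left side of `exp-shift` is absorbed, in place of the square root of e
  -- being below 2.
  exp-half : ∀ y → 0ℚ ≤ y → ∀ K → expPartial (y + ½) K ≤ ι 2 * expPartial y K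
  exp-half y 0≤y K = begin
    e′                        ≡⟨ solve 1 (λ e → e := con (ι 2) :* (e :+ :- (con ½ :* e))) refl e′ ⟩
    ι 2 * (e′ - ½ * e′)       ≤⟨ *-monoˡ (ι 2) (0≤ι 2) (≤-trans (+-monoˡ-≤ (- (½ * e′)) (exp-shift y ½ 0≤y 0≤½ K))
                                   (≤-reflexive (solve 2 (λ e f → (e :+ f) :+ :- f := e) refl (expPartial y K)
                                       (½ * e′)))) ⟩
    ι 2 * expPartial y K      ∎
    where
    open ≤-Reasoning
    open +-*-Solver
    e′ : ℚ
    e′ = expPartial (y + ½) K
    0≤½ : 0ℚ ≤ ½
    0≤½ = nonNegative⁻¹ ½

  -- In place of e < 4: a unit step consists of two half-steps, each of which at most doubles.
  exp-4^ : ∀ m K → expPartial (ι m) K ≤ ι (4 ℕ.^ m)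
  exp-4^ zero    K = ≤-trans (bounded K) (≤-reflexive refl)
    where
    term-0 : ∀ k → term (ι 0) (suc k) ≡ 0ℚ
    term-0 k = *-cancelʳ-≡ (ι (suc k)) (0<ι (suc k) (ℕ.s≤s ℕ.z≤n)) (trans (term-suc (ι 0) k) (trans (*-zeroˡ (term
        (ι 0) k)) (sym (*-zeroˡ (ι (suc k))))))
    ends : ∀ K → expPartial (ι 0) (suc K) ≡ 1ℚ
    ends zero    = trans (cong (λ x → 0ℚ + x) (term-zero (ι 0))) (+-identityˡ 1ℚ)
    ends (suc K) = trans (cong₂ _+_ (ends K) (term-0 K)) (+-identityʳ 1ℚ)
    bounded : ∀ K → expPartial (ι 0) K ≤ 1ℚ
    bounded zero    = 0≤ι 1
    bounded (suc K) = ≤-reflexive (ends K)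
  exp-4^ (suc m) K = begin
    expPartial (ι (suc m)) K                  ≡⟨ cong (λ x → expPartial x K) (trans (ι-+ 1 m) (solve 1
        (λ x → con 1ℚ :+ x := (x :+ con ½) :+ con ½) refl (ι m))) ⟩
    expPartial ((ι m + ½) + ½) K              ≤⟨ exp-half (ι m + ½) (0≤+ (0≤ι m) (nonNegative⁻¹ ½)) K ⟩
    ι 2 * expPartial (ι m + ½) K              ≤⟨ *-monoˡ (ι 2) (0≤ι 2) (exp-half (ι m) (0≤ι m) K) ⟩
    ι 2 * (ι 2 * expPartial (ι m) K)          ≤⟨ *-monoˡ (ι 2) (0≤ι 2) (*-monoˡ (ι 2) (0≤ι 2) (exp-4^ m K)) ⟩
    ι 2 * (ι 2 * ι (4 ℕ.^ m))                 ≡⟨ trans (sym (*-assoc (ι 2) (ι 2) (ι (4 ℕ.^ m)))) (sym (ι-* 4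
        (4 ℕ.^ m))) ⟩
    ι (4 ℕ.^ suc m)                           ∎
    where
    open ≤-Reasoning
    open +-*-Solver

  archimedean : ∀ p → 0ℚ < p → ∃[ K ] (1 ℕ.≤ K × 1ℚ < p * ι K)
  -- A positive p is at least 1 / `den`; the factor 2 makes the inequality strict.
  archimedean p 0<p = 2 ℕ.* den , ℕP.≤-trans (ℕ.s≤s ℕ.z≤n) (ℕP.m≤m+n den _) , (begin-strict
    1ℚ                         <⟨ ι-mono-< {1} {2} (ℕ.s≤s (ℕ.s≤s ℕ.z≤n)) ⟩
    ι 2                        ≡⟨ *-identityʳ (ι 2) ⟨
    ι 2 * 1ℚ                   ≤⟨ *-monoˡ (ι 2) (0≤ι 2) integral ⟩
    ι 2 * (p * ι den)          ≡⟨ solve 3 (λ a b c → a :* (b :* c) := b :* (a :* c)) refl (ι 2) p (ι den) ⟩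
    p * (ι 2 * ι den)          ≡⟨ cong (p *_) (ι-* 2 den) ⟨
    p * ι (2 ℕ.* den)          ∎)
    where
    open ≤-Reasoning
    open +-*-Solver
    den : ℕ
    den = ↧ₙ p
    instance
      p-pos : Positive p
      p-pos = positive 0<p
    integral : 1ℚ ≤ p * ι den
    integral = toℚᵘ-cancel-≤ (ℚᵘP.≤-respʳ-≃ (ℚᵘP.≃-sym (toℚᵘ-homo-* p (ι den)))
      (subst (λ x → toℚᵘ 1ℚ ℚᵘ.≤ toℚᵘ p ℚᵘ.* toℚᵘ x) (sym (ι-mkℚ den)) (cross p {{p-pos}})))
      where
      cross : ∀ p .{{_ : Positive p}} → toℚᵘ 1ℚ ℚᵘ.≤ toℚᵘ p ℚᵘ.* toℚᵘ (mkℚ (+ (↧ₙ p)) 0 (Coprime.sym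
          (Coprime.1-coprimeTo (↧ₙ p))))
      cross (mkℚ (+ suc a) b-1 c) = ℚᵘ.*≤* (ℤP.≤-trans (ℤP.≤-reflexive (trans (ℤP.*-identityˡ _) (cong
          (λ x → + suc x) (ℕP.*-identityʳ b-1))))
        (ℤP.≤-trans (ℤ.+≤+ (ℕP.m≤m+n (suc b-1) (a ℕ.* suc b-1))) (ℤP.≤-reflexive (sym (trans (ℤP.*-identityʳ _)
            (sym (ℤP.pos-* (suc a) (suc b-1))))))))

-- Translating Condition D and the event into inequalities between natural numbers.

module Conclusion where

  open import Data.Bool using (true)
  open import Data.Empty using (⊥-elim)
  open import Data.Fin using (Fin; fromℕ<)
  open import Data.Integer as ℤ using (+_)
  open import Data.List using (List; []; _∷_; map; length; filterᵇ; foldr; allFin)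
  open import Data.List.Membership.Propositional.Properties using (∈-allFin)
  open import Data.Nat as ℕ using (ℕ; suc)
  import Data.Nat.Properties as ℕP
  open import Data.Product using (_×_; _,_; ∃-syntax)
  open import Data.Sum using (_⊎_; inj₁; inj₂)
  open import Data.Rational hiding (floor)
  open import Data.Rational.Properties
  open import Data.Rational.Solver using (module +-*-Solver)
  open import Data.Vec using (Vec)
  open import Relation.Nullary using (yes; no; ¬_)
  open import Relation.Nullary.Decidable using (⌊_⌋)
  open import Relation.Binary.PropositionalEquality
  open Combinatorics
  open Embedding

  sumℚ-ι : ∀ {I : Set} (xs : List I) (f : I → ℚ) g → (∀ x → f x ≡ ι (g x)) → sumℚ (map f xs) ≡ ι (∑ xs g)
  sumℚ-ι []       f g e = refl
  sumℚ-ι (x ∷ xs) f g e = trans (cong₂ _+_ (e x) (sumℚ-ι xs f g e)) (sym (ι-+ (g x) (∑ xs g)))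

  centred-square-ι : ∀ x → (ι x - ι 2) * (ι x - ι 2) ≡ ι (centred-square x)
  centred-square-ι 0             = refl
  centred-square-ι 1             = refl
  centred-square-ι (suc (suc k)) = trans (cong (λ x → x * x) minus) (sym (ι-* k k))
    where
    open +-*-Solver
    minus : ι (2 ℕ.+ k) - ι 2 ≡ ι k
    minus = trans (cong (λ x → x - ι 2) (ι-+ 2 k)) (solve 2 (λ a b → (a :+ b) :+ :- a := b) refl (ι 2) (ι k))

  ≤?-sound : ∀ {p q} → ⌊ p ≤? q ⌋ ≡ true → p ≤ q
  ≤?-sound {p} {q} e with p ≤? q
  ... | yes h = h

  fraction-< : ∀ {ε} K a b → 0ℚ < ε → 1ℚ < ε * ι K → K ℕ.* a ℕ.≤ b → ι a ÷' ι b < ε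
  fraction-< {ε} K a b 0<ε 1<εK Ka≤b with ι b ≟ 0ℚ in e
  -- For b = 0 the quotient is 0 by the convention of `÷'`.
  ... | yes _ = 0<ε
  ... | no b≢0 = subst (_< ε) unfold (≰⇒> not-above)
    where
    open +-*-Solver
    unfold : ι a ÷' ι b ≡ _÷_ (ι a) (ι b) {{≢-nonZero b≢0}}
    unfold with ι b ≟ 0ℚ
    ... | yes b≡0 = ⊥-elim (b≢0 b≡0)
    ... | no _    = refl
    0<b : 0ℚ < ι b
    0<b = ≰⇒> (λ b≤0 → b≢0 (≤-antisym b≤0 (0≤ι b)))
    not-above : ¬ (ε ≤ ι a ÷' ι b)
    not-above h = <⇒≱ 1<εK (*-cancelʳ (ι b) 0<b (begin
      ε * ι K * ι b                    ≡⟨ solve 3 (λ ε k b → ε :* k :* b := k :* (ε :* b)) refl ε (ι K) (ι b) ⟩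
      ι K * (ε * ι b)                  ≤⟨ *-monoˡ (ι K) (0≤ι K) (*-monoʳ (ι b) (0≤ι b) h) ⟩
      ι K * ((ι a ÷' ι b) * ι b)       ≡⟨ cong (ι K *_) (÷′-* (ι a) (ι b) b≢0) ⟩
      ι K * ι a                        ≡⟨ ι-* K a ⟨
      ι (K ℕ.* a)                      ≤⟨ ι-mono-≤ Ka≤b ⟩
      ι b                              ≡⟨ *-identityˡ (ι b) ⟨
      1ℚ * ι b                         ∎))
      where open ≤-Reasoning

  Pr-< : ∀ {n} (D : Vec ℕ n) P {ε} K → 0ℚ < ε → 1ℚ < ε * ι K →
    K ℕ.* length (filterᵇ P (filterᵇ (hasDegSeq D) (allGraphs n))) ℕ.≤ length (filterᵇ (hasDegSeq D) (allGraphs n)) →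
    Pr D P < ε
  Pr-< {n} D P K = fraction-< K (length (filterᵇ P (filterᵇ (hasDegSeq D) (allGraphs n)))) (length (filterᵇ
      (hasDegSeq D) (allGraphs n)))

  0<A₀ : ∀ K Z → 1 ℕ.≤ K → 0ℚ < ι (Constants.A₀ K Z)
  0<A₀ K Z 1≤K = 0<ι (Constants.A₀ K Z) (Constants.1≤A₀ K Z 1≤K)

  opaque
    threshold : ℕ → ℕ → ℚ
    threshold K Z = 1ℚ ÷' ι (Constants.A₀ K Z)

    threshold-* : ∀ K Z → 1 ℕ.≤ K → threshold K Z * ι (Constants.A₀ K Z) ≡ 1ℚ
    threshold-* K Z 1≤K = ÷′-* 1ℚ (ι (Constants.A₀ K Z)) (pos≢0 (0<A₀ K Z 1≤K))

  0<threshold : ∀ K Z → 1 ℕ.≤ K → 0ℚ < threshold K Z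
  0<threshold K Z 1≤K = ≰⇒> λ A≤0 → <⇒≱ (0<ι 1 ℕP.≤-refl) (begin
    1ℚ                                    ≡⟨ threshold-* K Z 1≤K ⟨
    threshold K Z * ι (Constants.A₀ K Z)  ≤⟨ *-monoʳ (ι (Constants.A₀ K Z)) (0≤ι (Constants.A₀ K Z)) A≤0 ⟩
    0ℚ * ι (Constants.A₀ K Z)             ≡⟨ *-zeroˡ (ι (Constants.A₀ K Z)) ⟩
    0ℚ                                    ∎)
    where open ≤-Reasoning

  module Translation {n : ℕ} (D : Vec ℕ n) (ε ζ : ℚ) (0<ε : 0ℚ < ε) (0<ζ : 0ℚ < ζ) (ζ<⅒ : ζ < + 1 / 10)
    (K Z : ℕ) (1≤K : 1 ℕ.≤ K) (1<εK : 1ℚ < ε * ι K) (1<ζZ : 1ℚ < ζ * ι Z)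
    (w : ℚ) (W₀<w : ι (Constants.W₀ K Z) < w) (5≤n : 5 ℕ.≤ n)
    (condition : DegSeq.ConditionD D ζ)
    (supercritical : (w * w * w) * (DegSeq.R D * DegSeq.R D) < (DegSeq.Q D * DegSeq.Q D * DegSeq.Q D) * ℕtoℚ n) where

    open Constants K Z
    open DegSeq D using (d; Q; R; Δ; twoE; nOf)
    open DegSeq.ConditionD condition
    open +-*-Solver

    s ρ S₂ : ℕ
    s = ∑ V d
    ρ = ∑ V (λ v → d v ℕ.* centred-square (d v))
    S₂ = ∑ V (λ v → d v ℕ.* d v)

    private
      A : ℚ
      A = threshold K Z

    1≤n : 1 ℕ.≤ n
    1≤n = ℕP.≤-trans (ℕ.s≤s ℕ.z≤n) 5≤n

    1≤d : ∀ v → 1 ℕ.≤ d v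
    1≤d v = ℕP.n≢0⇒n>0 (λ e → absurd (cong (λ x → 𝟙 (x ℕ.≡ᵇ 0)) e))
      where
      absurd : 𝟙 (d v ℕ.≡ᵇ 0) ≢ 1
      absurd e with ℕP.≤-trans (ℕP.≤-reflexive (sym e)) (ℕP.≤-trans (∑-∈ (λ v → 𝟙 (d v ℕ.≡ᵇ 0)) (∈-allFin v))
        (ℕP.≤-reflexive (trans (sym (length-filter (λ v → d v ℕ.≡ᵇ 0) V)) condB)))
      ... | ()

    n≤s : n ℕ.≤ s
    n≤s = ℕP.≤-trans (ℕP.≤-reflexive (sym (∑V-1 {n}))) (∑-mono V 1≤d)

    0<s : 0ℚ < ι s
    0<s = 0<ι s (ℕP.≤-trans 1≤n n≤s)

    0≤s : 0ℚ ≤ ι s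
    0≤s = 0≤ι s

    d≤Δ : ∀ v → d v ℕ.≤ Δ
    d≤Δ v = ≤-foldr-⊔ d (∈-allFin v)

    ÷'-twoE : ∀ p → (p ÷' ι twoE) * ι s ≡ p
    ÷'-twoE p = trans (cong (λ x → (p ÷' ι x) * ι s) (foldr-∑ V d)) (÷′-* p (ι s) (pos≢0 0<s))

    R*s : R * ι s ≡ ι ρ
    R*s = trans (÷'-twoE _) (sumℚ-ι V _ _ (λ v → trans (cong (ι (d v) *_) (centred-square-ι (d v))) (sym (ι-*
        (d v) (centred-square (d v))))))

    Q*s : Q * ι s + ι (2 ℕ.* s) ≡ ι S₂
    Q*s = begin
      (X ÷' ι twoE - ι 2) * ι s + ι (2 ℕ.* s)
        ≡⟨ cong₂ _+_ (*-distribʳ-+ (ι s) (X ÷' ι twoE) (- ι 2)) (ι-* 2 s) ⟩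
      (X ÷' ι twoE) * ι s + (- ι 2) * ι s + ι 2 * ι s
        ≡⟨ solve 3 (λ a b c → (a :+ :- b :* c) :+ b :* c := a) refl ((X ÷' ι twoE) * ι s) (ι 2) (ι s) ⟩
      (X ÷' ι twoE) * ι s
        ≡⟨ ÷'-twoE X ⟩
      X
        ≡⟨ cong ι (foldr-∑ V (λ v → d v ℕ.* d v)) ⟩
      ι S₂ ∎
      where
      open ≡-Reasoning
      X : ℚ
      X = ι (foldr ℕ._+_ 0 (map (λ v → d v ℕ.* d v) (allFin n)))

    0≤R : 0ℚ ≤ R
    0≤R = *-cancelʳ (ι s) 0<s (≤-trans (≤-reflexive (*-zeroˡ (ι s))) (≤-trans (0≤ι ρ) (≤-reflexive (sym R*s))))

    1≤W₀ : 1 ℕ.≤ W₀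
    1≤W₀ = ℕP.≤-trans (ℕ.s≤s ℕ.z≤n) W₀-degree

    -- W₀ ≥ 1, hence W₀ ≤ W₀³, and exceeding W₀ itself suffices.
    W₀≤w³ : ι W₀ ≤ w * w * w
    W₀≤w³ = begin
      ι W₀                        ≤⟨ ι-mono-≤ (ℕP.≤-trans (k≤k² W₀) (ℕP.m≤m*n (W₀ ℕ.* W₀) W₀ {{ℕ.>-nonZero 1≤W₀}})) ⟩
      ι (W₀ ℕ.* W₀ ℕ.* W₀)        ≡⟨ trans (ι-* (W₀ ℕ.* W₀) W₀) (cong (_* ι W₀) (ι-* W₀ W₀)) ⟩
      ι W₀ * ι W₀ * ι W₀          ≤⟨ cube-mono (0≤ι W₀) (<⇒≤ W₀<w) ⟩
      w * w * w                   ∎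
      where open ≤-Reasoning

    window-R : ι W₀ * (R * R) < Q * Q * Q * ι n
    window-R = ≤-<-trans (*-monoʳ (R * R) (0≤* 0≤R 0≤R) W₀≤w³) supercritical

    -- In the cubed form of the hypothesis Q³ n exceeds a nonnegative number, which determines the
    -- sign of Q.
    0<Q : 0ℚ < Q
    0<Q = ≰⇒> λ Q≤0 → <⇒≱ window-R (≤-trans (≤-trans (*-monoʳ (ι n) (0≤ι n) (cube≤0 Q≤0)) (≤-reflexive (*-zeroˡ
        (ι n))))
      (0≤* (0≤ι W₀) (0≤* 0≤R 0≤R)))
      where
      cube≤0 : Q ≤ 0ℚ → Q * Q * Q ≤ 0ℚ
      cube≤0 Q≤0 = ≤-trans (*-monoˡ (Q * Q) square Q≤0) (≤-reflexive (*-zeroʳ (Q * Q)))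
        where
        square : 0ℚ ≤ Q * Q
        square = ≤-trans (≤-reflexive (sym (*-zeroˡ Q))) (*-monoʳ-≤-nonPos Q {{nonPositive Q≤0}} Q≤0)

    2s≤S₂ : 2 ℕ.* s ℕ.≤ S₂
    2s≤S₂ = ι-cancel-≤ (begin
      ι (2 ℕ.* s)                 ≡⟨ +-identityˡ (ι (2 ℕ.* s)) ⟨
      0ℚ + ι (2 ℕ.* s)            ≤⟨ +-monoˡ-≤ (ι (2 ℕ.* s)) (0≤* (<⇒≤ 0<Q) 0≤s) ⟩
      Q * ι s + ι (2 ℕ.* s)       ≡⟨ Q*s ⟩
      ι S₂                        ∎)
      where open ≤-Reasoning

    q : ℕ
    q = S₂ ℕ.∸ 2 ℕ.* s

    S₂≡ : S₂ ≡ 2 ℕ.* s ℕ.+ q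
    S₂≡ = sym (ℕP.m+[n∸m]≡n 2s≤S₂)

    Qs≡q : Q * ι s ≡ ι q
    Qs≡q = begin
      Q * ι s                                         ≡⟨ solve 2 (λ a b → a := (a :+ b) :+ :- b) refl (Q * ι s) (ι
          (2 ℕ.* s)) ⟩
      (Q * ι s + ι (2 ℕ.* s)) - ι (2 ℕ.* s)           ≡⟨ cong (λ x → x - ι (2 ℕ.* s)) (trans Q*s (trans
          (cong ι S₂≡) (ι-+ (2 ℕ.* s) q))) ⟩
      (ι (2 ℕ.* s) + ι q) - ι (2 ℕ.* s)               ≡⟨ solve 2 (λ a b → (a :+ b) :+ :- a := b) refl (ι
          (2 ℕ.* s)) (ι q) ⟩
      ι q                                             ∎
      where open ≡-Reasoning

    1≤q : 1 ℕ.≤ q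
    1≤q = ℕP.n≢0⇒n>0 λ q≡0 → <⇒≱ 0<Q (*-cancelʳ (ι s) 0<s
      (≤-reflexive (trans Qs≡q (trans (cong ι q≡0) (sym (*-zeroˡ (ι s)))))))

    -- Condition (d) with ζ < 1/10 gives Q ≤ 1/20.
    20q≤s : 20 ℕ.* q ℕ.≤ s
    20q≤s = ι-cancel-≤ (begin
      ι (20 ℕ.* q)                ≡⟨ trans (ι-* 20 q) (cong (ι 20 *_) (sym Qs≡q)) ⟩
      ι 20 * (Q * ι s)            ≡⟨ *-assoc (ι 20) Q (ι s) ⟨
      ι 20 * Q * ι s              ≤⟨ *-monoʳ (ι s) 0≤s (*-monoˡ (ι 20) (0≤ι 20) Q≤) ⟩
      ι 20 * (+ 1 / 20) * ι s     ≡⟨ *-identityˡ (ι s) ⟩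
      ι s                         ∎)
      where
      open ≤-Reasoning
      Q≤ : Q ≤ + 1 / 20
      Q≤ = begin
        Q                         ≡⟨ 0≤p⇒∣p∣≡p (<⇒≤ 0<Q) ⟨
        ∣ Q ∣                     ≤⟨ condD ⟩
        ζ * (+ 1 / 2)             ≤⟨ *-monoʳ (+ 1 / 2) (nonNegative⁻¹ (+ 1 / 2)) (<⇒≤ ζ<⅒) ⟩
        (+ 1 / 10) * (+ 1 / 2)    ≡⟨⟩
        + 1 / 20                  ∎

    n≤n₂+ρ : n ℕ.≤ nOf 2 ℕ.+ ρ
    n≤n₂+ρ = ℕP.≤-trans (ℕP.≤-reflexive (sym (∑V-1 {n}))) (ℕP.≤-trans (∑-mono V (λ v → off-two (d v) (1≤d v)))
      (ℕP.≤-reflexive (trans (∑-+ V (λ v → 𝟙 (d v ℕ.≡ᵇ 2)) (λ v → d v ℕ.* centred-square (d v)))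
        (cong (ℕ._+ ρ) (sym (length-filter (λ v → d v ℕ.≡ᵇ 2) V))))))

    -- By condition (c) at least ζ n vertices have a degree other than 2, and each adds at least 1
    -- to ρ.
    n≤Zρ : n ℕ.≤ Z ℕ.* ρ
    n≤Zρ = ι-cancel-≤ (begin
      ι n                         ≡⟨ *-identityˡ (ι n) ⟨
      1ℚ * ι n                    ≤⟨ *-monoʳ (ι n) (0≤ι n) (<⇒≤ 1<ζZ) ⟩
      ζ * ι Z * ι n               ≡⟨ solve 3 (λ a b c → a :* b :* c := b :* (a :* c)) refl ζ (ι Z) (ι n) ⟩
      ι Z * (ζ * ι n)             ≤⟨ *-monoˡ (ι Z) (0≤ι Z) ζn≤ρ ⟩
      ι Z * ι ρ                   ≡⟨ ι-* Z ρ ⟨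
      ι (Z ℕ.* ρ)                 ∎)
      where
      open ≤-Reasoning
      ζn≤ρ : ζ * ι n ≤ ι ρ
      ζn≤ρ = begin
        ζ * ι n                                         ≡⟨ solve 2 (λ z m → z :* m := m :+ :-
            ((con 1ℚ :+ :- z) :* m)) refl ζ (ι n) ⟩
        ι n - (1ℚ - ζ) * ι n                            ≤⟨ +-monoˡ-≤ (- ((1ℚ - ζ) * ι n)) (≤-trans
            (ι-mono-≤ n≤n₂+ρ) (≤-trans (≤-reflexive (ι-+ (nOf 2) ρ)) (+-monoˡ-≤ (ι ρ) condC))) ⟩
        (1ℚ - ζ) * ι n + ι ρ - (1ℚ - ζ) * ι n           ≡⟨ solve 2 (λ a b → (a :+ b) :+ :- a := b) refl
            ((1ℚ - ζ) * ι n) (ι ρ) ⟩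
        ι ρ                                             ∎

    1≤ρ : 1 ℕ.≤ ρ
    1≤ρ = ℕP.n≢0⇒n>0 λ ρ≡0 → ℕP.<⇒≱ 1≤n (ℕP.≤-trans n≤Zρ (ℕP.≤-reflexive (trans (cong (Z ℕ.*_) ρ≡0) (ℕP.*-zeroʳ Z))))

    0<R : 0ℚ < R
    0<R = ≰⇒> λ R≤0 → <⇒≱ (0<ι ρ 1≤ρ) (≤-trans (≤-reflexive (sym R*s)) (≤-trans (*-monoʳ (ι s) 0≤s R≤0)
        (≤-reflexive (*-zeroˡ (ι s)))))

    ι-cube : ∀ m → ι (m ℕ.* m ℕ.* m) ≡ ι m * ι m * ι m
    ι-cube m = trans (ι-* (m ℕ.* m) m) (cong (_* ι m) (ι-* m m))

    -- Condition (a) is tested at 4^Δ, which is below n^Δ as n ≥ 5. It yields y with y³ ≤ n R and a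
    -- partial sum above 4^Δ; by `exp-4^` the same partial sum at Δ is at most 4^Δ, so y ≤ Δ is
    -- impossible.
    Δ³≤nR : ι Δ * ι Δ * ι Δ ≤ ι n * R
    Δ³≤nR = from (condA (ι (4 ℕ.^ Δ)) (ι-mono-< (ℕP.^-monoˡ-< Δ {{ℕ.>-nonZero 1≤Δ}} 5≤n)))
      where
      some : Fin n → 1 ℕ.≤ Δ
      some v = ℕP.≤-trans (1≤d v) (d≤Δ v)
      1≤Δ : 1 ℕ.≤ Δ
      1≤Δ = some (fromℕ< 1≤n)
      from : ∃[ y ] (0ℚ ≤ y × (y * y * y) ≤ ι n * R × ∃[ k ] (ι
          (4 ℕ.^ Δ) < expPartial y k)) → ι Δ * ι Δ * ι Δ ≤ ι n * R
      from (y , 0≤y , y³≤ , k , q<) = by (≤-total (ι Δ) y)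
        where
        by : ι Δ ≤ y ⊎ y ≤ ι Δ → ι Δ * ι Δ * ι Δ ≤ ι n * R
        by (inj₁ Δ≤y) = ≤-trans (cube-mono (0≤ι Δ) Δ≤y) y³≤
        by (inj₂ y≤Δ) = ⊥-elim (<⇒≱ q< (≤-trans (exp-mono k 0≤y y≤Δ) (exp-4^ Δ k)))

    Δ³≤ρ : Δ ℕ.* Δ ℕ.* Δ ℕ.≤ ρ
    Δ³≤ρ = ℕP.*-cancelʳ-≤ (Δ ℕ.* Δ ℕ.* Δ) ρ n {{ℕ.>-nonZero 1≤n}} (ℕP.≤-trans (ℕP.*-monoʳ-≤ (Δ ℕ.* Δ ℕ.* Δ) n≤s)
        (ι-cancel-≤ (begin
      ι (Δ ℕ.* Δ ℕ.* Δ ℕ.* s)              ≡⟨ trans (ι-* (Δ ℕ.* Δ ℕ.* Δ) s) (cong (_* ι s) (ι-cube Δ)) ⟩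
      ι Δ * ι Δ * ι Δ * ι s                ≤⟨ *-monoʳ (ι s) 0≤s Δ³≤nR ⟩
      ι n * R * ι s                        ≡⟨ trans (*-assoc (ι n) R (ι s)) (cong (ι n *_) R*s) ⟩
      ι n * ι ρ                            ≡⟨ *-comm (ι n) (ι ρ) ⟩
      ι ρ * ι n                            ≡⟨ ι-* ρ n ⟨
      ι (ρ ℕ.* n)                          ∎)))
      where open ≤-Reasoning

    -- `window-R` times s³, with R s = ρ and Q s = q; the remaining n is raised to s, which then
    -- cancels.
    window : W₀ ℕ.* (ρ ℕ.* ρ) ℕ.≤ q ℕ.* q ℕ.* q
    window = ℕP.*-cancelʳ-≤ (W₀ ℕ.* (ρ ℕ.* ρ)) (q ℕ.* q ℕ.* q) s {{ℕ.>-nonZero (ℕP.≤-trans 1≤n n≤s)}}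
      (ℕP.≤-trans (ι-cancel-≤ scaled) (ℕP.*-monoʳ-≤ (q ℕ.* q ℕ.* q) n≤s))
      where
      open ≤-Reasoning
      scaled : ι (W₀ ℕ.* (ρ ℕ.* ρ) ℕ.* s) ≤ ι (q ℕ.* q ℕ.* q ℕ.* n)
      scaled = begin
        ι (W₀ ℕ.* (ρ ℕ.* ρ) ℕ.* s)
          ≡⟨ trans (ι-* (W₀ ℕ.* (ρ ℕ.* ρ)) s) (cong (_* ι s) (trans (ι-* W₀ (ρ ℕ.* ρ)) (cong (ι W₀ *_) (ι-* ρ ρ)))) ⟩
        ι W₀ * (ι ρ * ι ρ) * ι s
          ≡⟨ cong (λ x → ι W₀ * (x * x) * ι s) R*s ⟨
        ι W₀ * (R * ι s * (R * ι s)) * ι s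
          ≡⟨ solve 3 (λ a r t → a :* (r :* t :* (r :* t)) :* t := a :* (r :* r) :* (t :* t :* t)) refl (ι W₀) R
              (ι s) ⟩
        ι W₀ * (R * R) * (ι s * ι s * ι s)
          ≤⟨ *-monoʳ (ι s * ι s * ι s) (0≤* (0≤* 0≤s 0≤s) 0≤s) (<⇒≤ window-R) ⟩
        Q * Q * Q * ι n * (ι s * ι s * ι s)
          ≡⟨ solve 3 (λ x m t → x :* x :* x :* m :* (t :* t :* t) := x :* t :* (x :* t) :* (x :* t) :* m) refl Q
              (ι n) (ι s) ⟩
        Q * ι s * (Q * ι s) * (Q * ι s) * ι n
          ≡⟨ cong (λ x → x * x * x * ι n) Qs≡q ⟩
        ι q * ι q * ι q * ι n
          ≡⟨ trans (ι-* (q ℕ.* q ℕ.* q) n) (cong (_* ι n) (ι-cube q)) ⟨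
        ι (q ℕ.* q ℕ.* q ℕ.* n) ∎

    -- The event freed of its quotients; `0<R` ensures that `÷'` is a true division here.
    bad-Cmax : ∀ H → smallCmax D A H ≡ true → A₀ ℕ.* (Cmax H ℕ.* ρ) ℕ.≤ q ℕ.* n
    bad-Cmax H bad = ι-cancel-≤ (begin
      ι (A₀ ℕ.* (Cmax H ℕ.* ρ))
        ≡⟨ trans (ι-* A₀ (Cmax H ℕ.* ρ)) (cong (ι A₀ *_) (trans (ι-* (Cmax H) ρ) (cong (ι (Cmax H) *_) (sym R*s)))) ⟩
      ι A₀ * (ι (Cmax H) * (R * ι s))
        ≤⟨ *-monoˡ (ι A₀) (<⇒≤ (0<A₀ K Z 1≤K)) (*-monoʳ (R * ι s) (0≤* 0≤R 0≤s) (≤?-sound bad)) ⟩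
      ι A₀ * (((A * Q * ι n) ÷' R) * (R * ι s))
        ≡⟨ cong (ι A₀ *_) (trans (sym (*-assoc ((A * Q * ι n) ÷' R) R (ι s))) (cong (_* ι s) (÷′-* (A * Q * ι n) R
            (pos≢0 0<R)))) ⟩
      ι A₀ * (A * Q * ι n * ι s)
        ≡⟨ solve 5 (λ a b c m t → a :* (b :* c :* m :* t) := b :* a :* (c :* t :* m)) refl (ι A₀) A Q (ι n) (ι s) ⟩
      A * ι A₀ * (Q * ι s * ι n)
        ≡⟨ cong₂ _*_ (threshold-* K Z 1≤K) (cong (_* ι n) Qs≡q) ⟩
      1ℚ * (ι q * ι n)
        ≡⟨ trans (*-identityˡ (ι q * ι n)) (sym (ι-* q n)) ⟩
      ι (q ℕ.* n) ∎)
      where open ≤-Reasoning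

    rare : Pr D (smallCmax D (threshold K Z)) < ε
    rare = Pr-< D (smallCmax D (threshold K Z)) K 0<ε 1<εK
      (Reduction.bad-fraction D K Z Δ q (smallCmax D
          (threshold K Z)) 1≤K 1≤n d≤Δ 1≤d S₂≡ 1≤q 20q≤s n≤Zρ Δ³≤ρ window bad-Cmax)

open import Data.Nat using (ℕ; _≤_)
open import Data.Vec using (Vec)
open import Data.Product using (_×_; ∃-syntax)
open import Data.Integer using (+_)
open import Data.Rational using (ℚ; 0ℚ; _*_; _<_; _/_)
open import Data.Nat using (_⊔_)
open import Data.Product using (_,_)
open import Data.Rational using (1ℚ)
open import Data.Nat.Properties using (≤-trans; m≤m⊔n; m≤n⊔m)

open Combinatorics.Constants using (W₀)
open Embedding using (archimedean)
open Conclusion using (threshold; 0<threshold; module Translation)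

theorem3 : (ε ζ : ℚ) → 0ℚ < ε → 0ℚ < ζ → ζ < + 1 / 10 →
    (ω : ℕ → ℚ) → TendsToInfinity ω →
    ∃[ A ] ∃[ N ] (0ℚ < A ×
    (∀ (n : ℕ) → N ≤ n → (D : Vec ℕ n) → Graphical D →
    DegSeq.ConditionD D ζ →
    (ω n * ω n * ω n) * (DegSeq.R D * DegSeq.R D)
    < (DegSeq.Q D * DegSeq.Q D * DegSeq.Q D) * ℕtoℚ n →
    Pr D (smallCmax D A) < ε))
theorem3 ε ζ 0<ε 0<ζ ζ<⅒ ω ω→∞ = choose (archimedean ε 0<ε) (archimedean ζ 0<ζ)
  where
  choose : ∃[ K ] (1 ≤ K × 1ℚ < ε * ℕtoℚ K) → ∃[ Z ] (1 ≤ Z × 1ℚ < ζ * ℕtoℚ Z) →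
    ∃[ A ] ∃[ N ] (0ℚ < A ×
    (∀ (n : ℕ) → N ≤ n → (D : Vec ℕ n) → Graphical D →
    DegSeq.ConditionD D ζ →
    (ω n * ω n * ω n) * (DegSeq.R D * DegSeq.R D)
    < (DegSeq.Q D * DegSeq.Q D * DegSeq.Q D) * ℕtoℚ n →
    Pr D (smallCmax D A) < ε))
  choose (K , 1≤K , 1<εK) (Z , _ , 1<ζZ) = with-N (ω→∞ (ℕtoℚ (W₀ K Z)))
    where
    with-N : ∃[ N₀ ] (∀ n → N₀ ≤ n → ℕtoℚ (W₀ K Z) < ω n) → _
    -- A depends only on ε and ζ. Beyond N₀ the function ω exceeds W₀, and n ≥ 5 serves the
    -- comparison of n^Δ with 4^Δ.
    with-N (N₀ , W₀<ω) = threshold K Z , N₀ ⊔ 5 , 0<threshold K Z 1≤K ,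
      λ n N≤n D _ condition supercritical →
        Translation.rare D ε ζ 0<ε 0<ζ ζ<⅒ K Z 1≤K 1<εK 1<ζZ (ω n)
          (W₀<ω n (≤-trans (m≤m⊔n N₀ 5) N≤n)) (≤-trans (m≤n⊔m N₀ 5) N≤n) condition supercritical
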